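{- Let $k$ and $\ell$ be positive integers with $\gcd(2k,\ell)=1$, and write $q:=2^k$, $Q:=2^\ell$ and $u:=(Q^{k+1}-1)/(Q-1)$. Let $a\in\mathbb{F}_{q^2}^*$ and $b\in\mathbb{F}_q^*$ with $a+b\ne 1$. Then $f(X):=X+bX^q+aX^u$ permutes $\mathbb{F}_{q^2}$ if and only if there exist $\lambda\in\mathbb{F}_q$ and $\epsilon\in\mathbb{F}_2$ such that all of the following hold: (1) $\lambda^{Q-1}=b$; (2) $a=\epsilon\lambda^Q+\sum_{i=1}^{\ell}\lambda^{Q-2^i}$; (3) $\mathrm{Tr}_{\mathbb{F}_q/\mathbb{F}_2}\bigl(\frac{a}{a+b+1}\bigr)=0$.
   Context: A polynomial permutes $\mathbb{F}_{q^2}$ if it induces a bijection of $\mathbb{F}_{q^2}$. $\mathrm{Tr}_{\mathbb{F}_q/\mathbb{F}_2}$ denotes the polynomial $X+X^2+X^4+\dots+X^{q/2}$ (which on $\mathbb{F}_q$ is the trace map to $\mathbb{F}_2$); note that (2) forces $a\in\mathbb{F}_q$. -}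

module Defs where

open import Level using (Level; _⊔_; suc)
open import Algebra.Bundles using (CommutativeRing)
open import Algebra.Core using (Op₁; Op₂)
open import Data.Fin.Base using (Fin; toℕ)
open import Data.Nat.Base as ℕ using (ℕ; NonZero)
open import Data.Nat.Properties using (m<n⇒0<n∸m; ^-monoʳ-<)
open import Data.Product.Base using (proj₁)
open import Data.Sum.Base using (_⊎_)
open import Function.Bundles using (Inverse)
open import Function.Definitions using (Bijective)
open import Relation.Binary.Bundles using (Setoid)
open import Relation.Binary.Definitions using (_Respects_)
open import Relation.Binary.PropositionalEquality using (setoid)
open import Relation.Nullary.Negation using (¬_)
open import Relation.Unary using (Pred)
import Algebra.Properties.Semiring.Exp as Exp
import Algebra.Properties.Semiring.Sum as Sum
import Relation.Binary.Construct.On as On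

-- The inverse is a total function, but nothing is assumed about 0# ⁻¹.
record Field c ℓ : Set (suc (c ⊔ ℓ)) where
  infix  9 _⁻¹
  infixl 7 _/_
  field
    commutativeRing : CommutativeRing c ℓ

  open CommutativeRing commutativeRing public

  field
    _⁻¹        : Op₁ Carrier
    ⁻¹-cong    : ∀ {x y} → x ≈ y → x ⁻¹ ≈ y ⁻¹
    *-inverseʳ : ∀ x → ¬ x ≈ 0# → x * x ⁻¹ ≈ 1#
    1≉0        : ¬ 1# ≈ 0#

  _/_ : Op₂ Carrier
  x / y = x * y ⁻¹

  open Exp semiring public using (_^_)
  open Sum semiring public using (sum-syntax)

HasOrder : ∀ {c ℓ} → Setoid c ℓ → ℕ → Set (c ⊔ ℓ)
HasOrder S n = Inverse S (setoid (Fin n))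

record Subfield {c ℓ} (K : Field c ℓ) p : Set (c ⊔ ℓ ⊔ suc p) where
  open Field K hiding (setoid)
  infix 4 _∈
  field
    _∈       : Pred Carrier p
    ∈-resp   : _∈ Respects _≈_
    0∈       : 0# ∈
    1∈       : 1# ∈
    +-closed : ∀ {x y} → x ∈ → y ∈ → (x + y) ∈
    *-closed : ∀ {x y} → x ∈ → y ∈ → (x * y) ∈
    -‿closed : ∀ {x} → x ∈ → (- x) ∈
    ⁻¹-closed : ∀ {x} → ¬ x ≈ 0# → x ∈ → (x ⁻¹) ∈

  elements : Setoid (c ⊔ p) ℓ
  elements = On.setoid (Field.setoid K) (proj₁ {B = _∈})

2^ℓ∸1≢0 : ∀ ℓ .{{_ : NonZero ℓ}} → NonZero (2 ℕ.^ ℓ ℕ.∸ 1)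
2^ℓ∸1≢0 (ℕ.suc ℓ) = ℕ.>-nonZero (m<n⇒0<n∸m (^-monoʳ-< 2 (ℕ.s≤s (ℕ.s≤s ℕ.z≤n)) (ℕ.s≤s (ℕ.z≤n {ℓ}))))

-- The division is exact: this is 1 + Q + … + Q^k for Q = 2^ℓ.
exponent-u : (k ℓ : ℕ) .{{_ : NonZero ℓ}} → ℕ
exponent-u k ℓ = (Q ℕ.^ (k ℕ.+ 1) ℕ.∸ 1) ℕ./ (Q ℕ.∸ 1)
  where
  Q = 2 ℕ.^ ℓ
  instance
    _ = 2^ℓ∸1≢0 ℓ

module FieldNotions {c ℓ} (K : Field c ℓ) where
  open Field K
  infix 4 _∈𝔽₂

  -- A polynomial is represented by the function it induces on K.
  Permutes : (Carrier → Carrier) → Set (c ⊔ ℓ)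
  Permutes = Bijective _≈_ _≈_

  -- Membership in the prime field, for K of characteristic 2.
  _∈𝔽₂ : Pred Carrier ℓ
  x ∈𝔽₂ = x ≈ 0# ⊎ x ≈ 1#

  -- The polynomial X + X² + X⁴ + … + X^(2^(k-1)), evaluated at any element
  -- of K; it is the trace to 𝔽₂ on the subfield of order 2^k.
  Tr : ℕ → Carrier → Carrier
  Tr k x = ∑[ i < k ] (x ^ (2 ℕ.^ toℕ i))

module Submission where

-- Write z̄ = z^q and substitute X = W^(Q-1), a bijection of 𝔽_{q²} because gcd(2k, ℓ) = 1.  Then
-- f(X) W W̄ = P(W) := W^Q W̄ + b W W̄^Q + a W̄^(Q+1), and f permutes 𝔽_{q²} exactly when P is injective on the
-- projective line of 𝔽_q-lines in 𝔽_{q²}.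
--
-- If T = t^Q is a root of ā X² + (b² + 1 + a ā) X + a, then a combination of P and P̄ factors as
-- (W + t W̄)^Q (b ā W + S W̄) with S = b² + 1 + ā T.  If T T̄ = 1 both factors vanish on 𝔽_q-lines, which must
-- coincide, so S = b ā t.  If T T̄ ≠ 1 then Y = W + t W̄ is a coordinate on 𝔽_{q²}, and Hermite's criterion for
-- Y^Q (α Y + β Ȳ) in degree q - 1 gives α β = 0: the second factor is proportional to Y or Ȳ.  Either way
-- sum and product of the two roots force a ∈ 𝔽_q and a λ^Q = (a + b + 1)² with λ^Q = b λ, which is (1) and (2).
--
-- Conversely (1) and (2) put P in the form κ ((v+1)(ω+1) y₁^Q l₁ + v ω y₂^Q l₂) with {l₁, l₂} = {y₁, y₂},
-- where w² + w = 1/λ and v = w^Q; so P is in essence Y^(Q+1) (ε = 1) or Y^(Q-1) (ε = 0) on a projective line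
-- that is split or not according to d = w̄ + w.  As a/(a+b+1) = ε + w + w^Q has trace k ε + d, condition (3)
-- says exactly that this map is injective.

open import Algebra.Bundles using (RawRing)
open import Algebra.Solver.Ring.AlmostCommutativeRing
  using (fromCommutativeRing; _-Raw-AlmostCommutative⟶_; Induced-equivalence)
open import Data.Bool.Base using (Bool; true; false; _xor_; _∧_)
open import Data.Fin.Base using (Fin; zero; suc; toℕ; fromℕ<; opposite; punchOut; punchIn; inject≤)
open import Data.Fin.Permutation using (permutation; _⟨$⟩ʳ_)
open import Data.Maybe.Base using (just; nothing)
open import Data.Nat.Base as ℕ using (ℕ; NonZero; zero; suc)
open import Data.Nat.Divisibility as ℕ using (_∣_; divides)
open import Data.Nat.DivMod using (_%_; m≡m%n+[m/n]*n; m%n<n; m*[n/m]≡n)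
open import Data.Nat.GCD using (gcd; gcd-GCD; gcd-greatest; c*gcd[m,n]≡gcd[cm,cn]; module Bézout)
open import Data.Nat.Tactic.RingSolver using (solve-∀)
open import Data.Product.Base using (∃-syntax; _×_; _,_; proj₁; proj₂)
open import Data.Sum.Base as Sum using (_⊎_; inj₁; inj₂; [_,_]′)
open import Data.Vec.Base using (Vec; []; _∷_; zipWith)
open import Function.Base using (_∘_; id)
open import Function.Bundles using (_⇔_; mk⇔; Inverse)
open import Function.Definitions using (Injective; Bijective)
open import Level using (_⊔_)
open import Relation.Binary.Core using (_Preserves_⟶_)
open import Relation.Binary.Definitions using (Decidable; WeaklyDecidable; tri<; tri≈; tri>)
open import Relation.Binary.PropositionalEquality as ≡ using (_≡_; _≢_)
open import Relation.Nullary.Decidable using (Dec; yes; no; ¬?; map′)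
open import Relation.Nullary.Negation using (¬_; contradiction)
import Algebra.Properties.CommutativeMonoid.Sum as MonoidSum
import Algebra.Properties.CommutativeSemiring.Exp as Exp
import Algebra.Properties.Semiring.Mult as Mult
import Algebra.Properties.Semiring.Sum as Summation
import Algebra.Solver.Ring as RingSolver
import Data.Fin.Properties as Fin
import Data.Nat.Coprimality as Coprimality
import Data.Nat.Properties as ℕ
import Relation.Binary.Reasoning.Setoid as SetoidReasoning
open import Defs

-- The quadratic for T is a determinant. Read b P̄ + d P as a bilinear form in (W^Q, W̄^Q) and (W,
-- W̄); it splits into two linear factors exactly when its 2 by 2 coefficient determinant vanishes,
-- and d = ā T + 1 turns that determinant into the quadratic, up to a nonzero factor. Hermite's
-- criterion is decisive here because (A + B)^(q-1) has all coefficients 1 in characteristic 2. The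
-- exponents of Y are then (q-1) s with s = Q + 1, ..., Q + q, and the sum of Y^((q-1) s) over the
-- field is nonzero only if q + 1 divides s. As q + 1 is odd and exceeds 1, it does not divide Q, so
-- exactly one s qualifies and a single monomial in α and β must vanish. That a lies in 𝔽_q comes
-- from the product π of the two values of t: both ā π and ā π^Q equal a, so π lies in 𝔽₂ and is 1.
-- In the converse, Y^(Q+1) can fail to be injective only through the cube roots of unity, because ℓ
-- is odd and gcd(4k, 2ℓ) = 2. Whether they lie in 𝔽_q or have norm 1 depends on the parity of k,
-- which is how k ε enters the trace.

-- Injective self-maps of a finite set

injective⇒surjective : ∀ {n} {f : Fin n → Fin n} → Injective _≡_ _≡_ f → ∀ y → ∃[ x ] f x ≡ y
injective⇒surjective {suc n} {f} f-inj y with Fin.any? (λ x → f x Fin.≟ y)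
... | yes hit = hit
... | no miss = contradiction
        (λ {i} {j} eq → f-inj (Fin.punchOut-injective (avoid i) (avoid j) eq))
        (Fin.<⇒notInjective {f = λ x → punchOut (avoid x)} (ℕ.n<1+n n))
  where
  avoid : ∀ x → y ≢ f x
  avoid x eq = miss (x , ≡.sym eq)

injective⇒permutation : ∀ {n} (f : Fin n → Fin n) → Injective _≡_ _≡_ f →
                        ∃[ π ] ∀ i → π ⟨$⟩ʳ i ≡ f i
injective⇒permutation f f-inj = permutation f f⁻¹ f∘f⁻¹ (f-inj ∘ f∘f⁻¹ ∘ f) , λ _ → ≡.refl
  where
  f⁻¹ = proj₁ ∘ injective⇒surjective f-inj
  f∘f⁻¹ = proj₂ ∘ injective⇒surjective f-inj

-- Fields with decidable equality, and Fermat's little theorem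

module FieldProperties {c e} (K : Field c e) (_≟_ : Decidable (Field._≈_ K)) where
  open Field K hiding (_≉_; zero) public
  open Exp commutativeSemiring public hiding (_^_)
  open SetoidReasoning setoid

  infix 4 _≉_
  _≉_ : Carrier → Carrier → Set e
  x ≉ y = ¬ x ≈ y

  *-inverseˡ : ∀ {x} → x ≉ 0# → x ⁻¹ * x ≈ 1#
  *-inverseˡ {x} x≉0 = trans (*-comm _ _) (*-inverseʳ x x≉0)

  cancel-⁻¹ˡ : ∀ {x} y → x ≉ 0# → x ⁻¹ * (x * y) ≈ y
  cancel-⁻¹ˡ y x≉0 = trans (sym (*-assoc _ _ _)) (trans (*-congʳ (*-inverseˡ x≉0)) (*-identityˡ y))

  cancel-⁻¹ʳ : ∀ {x} y → x ≉ 0# → x * (x ⁻¹ * y) ≈ y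
  cancel-⁻¹ʳ {x} y x≉0 = trans (sym (*-assoc _ _ _)) (trans (*-congʳ (*-inverseʳ x x≉0)) (*-identityˡ y))

  *-cancelˡ : ∀ {x y z} → x ≉ 0# → x * y ≈ x * z → y ≈ z
  *-cancelˡ {x} {y} {z} x≉0 eq = trans (sym (cancel-⁻¹ˡ y x≉0)) (trans (*-congˡ eq) (cancel-⁻¹ˡ z x≉0))

  *-cancelʳ : ∀ {x y z} → x ≉ 0# → y * x ≈ z * x → y ≈ z
  *-cancelʳ x≉0 eq = *-cancelˡ x≉0 (trans (*-comm _ _) (trans eq (*-comm _ _)))

  no-zero-divisorʳ : ∀ {x y} → x ≉ 0# → x * y ≈ 0# → y ≈ 0#
  no-zero-divisorʳ x≉0 eq = *-cancelˡ x≉0 (trans eq (sym (zeroʳ _)))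

  *-≉0 : ∀ {x y} → x ≉ 0# → y ≉ 0# → x * y ≉ 0#
  *-≉0 x≉0 y≉0 eq = y≉0 (no-zero-divisorʳ x≉0 eq)

  zero-product : ∀ {x y} → x * y ≈ 0# → x ≈ 0# ⊎ y ≈ 0#
  zero-product {x} eq with x ≟ 0#
  ... | yes x≈0 = inj₁ x≈0
  ... | no  x≉0 = inj₂ (no-zero-divisorʳ x≉0 eq)

  factor-≉0ˡ : ∀ {x y} → x * y ≉ 0# → x ≉ 0#
  factor-≉0ˡ xy≉0 x≈0 = xy≉0 (trans (*-congʳ x≈0) (zeroˡ _))

  factor-≉0ʳ : ∀ {x y} → x * y ≉ 0# → y ≉ 0#
  factor-≉0ʳ xy≉0 y≈0 = xy≉0 (trans (*-congˡ y≈0) (zeroʳ _))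

  ⁻¹-≉0 : ∀ {x} → x ≉ 0# → x ⁻¹ ≉ 0#
  ⁻¹-≉0 {x} x≉0 = factor-≉0ʳ λ eq → 1≉0 (trans (sym (*-inverseʳ x x≉0)) eq)

  ≉0-resp : ∀ {x y} → x ≈ y → x ≉ 0# → y ≉ 0#
  ≉0-resp x≈y x≉0 y≈0 = x≉0 (trans x≈y y≈0)

  ^-≉0 : ∀ {x} n → x ≉ 0# → x ^ n ≉ 0#
  ^-≉0 zero    _   = 1≉0
  ^-≉0 (suc n) x≉0 = *-≉0 x≉0 (^-≉0 n x≉0)

  ^-≈0 : ∀ {x} n → x ^ n ≈ 0# → x ≈ 0#
  ^-≈0 {x} n eq with x ≟ 0#
  ... | yes x≈0 = x≈0
  ... | no  x≉0 = contradiction eq (^-≉0 n x≉0)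

  1^ : ∀ n → 1# ^ n ≈ 1#
  1^ zero    = refl
  1^ (suc n) = trans (*-identityˡ _) (1^ n)

  0^ : ∀ n → .{{NonZero n}} → 0# ^ n ≈ 0#
  0^ (suc n) = zeroˡ _

  open MonoidSum *-commutativeMonoid public using ()
    renaming (sum to product; sum-remove to product-remove; ∑-distrib-+ to product-distrib-*;
              sum-cong-≋ to product-cong; sum-permute to product-permute; sum-replicate to product-replicate)

  product-≉0 : ∀ {n} (t : Fin n → Carrier) → (∀ i → t i ≉ 0#) → product t ≉ 0#
  product-≉0 {zero}  t _    = 1≉0
  product-≉0 {suc n} t t≉0 = *-≉0 (t≉0 zero) (product-≉0 (t ∘ suc) (t≉0 ∘ suc))

  -- Multiplication by b permutes the nonzero elements, so their product equals itself times
  -- b^(n-1). The enumerated set need not be all of K: `f` only records that it is stable under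
  -- multiplication by b, so the argument also serves a subfield.
  fermat : ∀ {n} (enum : Fin n → Carrier) → Injective _≡_ _≈_ enum →
           ∀ i₀ → enum i₀ ≈ 0# → ∀ {b} → b ≉ 0# →
           (f : Fin n → Fin n) → (∀ i → enum (f i) ≈ b * enum i) →
           b ^ n ≈ b
  fermat {suc n} enum enum-inj i₀ at-i₀ {b} b≉0 f enum-f = begin
    b * b ^ n                                 ≈⟨ *-congˡ (product-replicate n) ⟨
    b * product {n} (λ _ → b)                 ≈⟨ *-congˡ (product-cong (g-nonzero ∘ others)) ⟨
    b * product (g ∘ enum ∘ punchIn i₀)       ≈⟨ *-congˡ (*-identityˡ _) ⟨
    b * (1# * product (g ∘ enum ∘ punchIn i₀)) ≈⟨ *-congˡ (*-congʳ (g-zero at-i₀)) ⟨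
    b * (g (enum i₀) * product (g ∘ enum ∘ punchIn i₀)) ≈⟨ *-congˡ (product-remove {i = i₀} (g ∘ enum)) ⟨
    b * product (g ∘ enum)                    ≈⟨ *-congˡ product-g ⟩
    b * 1#                                    ≈⟨ *-identityʳ b ⟩
    b                                         ∎
    where
    -- Both take the value 1 at zero, so products may run over the whole index set and be permuted
    -- there while remaining invertible.
    g h : Carrier → Carrier
    g y with y ≟ 0#
    ... | yes _ = 1#
    ... | no  _ = b
    h y with y ≟ 0#
    ... | yes _ = 1#
    ... | no  _ = y

    g-zero : ∀ {y} → y ≈ 0# → g y ≈ 1#
    g-zero {y} y≈0 with y ≟ 0#
    ... | yes _   = refl
    ... | no  y≉0 = contradiction y≈0 y≉0

    g-nonzero : ∀ {y} → y ≉ 0# → g y ≈ b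
    g-nonzero {y} y≉0 with y ≟ 0#
    ... | yes y≈0 = contradiction y≈0 y≉0
    ... | no  _   = refl

    h-≉0 : ∀ y → h y ≉ 0#
    h-≉0 y with y ≟ 0#
    ... | yes _   = 1≉0
    ... | no  y≉0 = y≉0

    h-scale : ∀ {z y} → z ≈ b * y → h z ≈ g y * h y
    h-scale {z} {y} z≈by with z ≟ 0# | y ≟ 0#
    ... | yes _   | yes _   = sym (*-identityˡ 1#)
    ... | yes z≈0 | no  y≉0 = contradiction (trans (sym z≈by) z≈0) (*-≉0 b≉0 y≉0)
    ... | no  z≉0 | yes y≈0 = contradiction (trans z≈by (trans (*-congˡ y≈0) (zeroʳ b))) z≉0
    ... | no  _   | no  _   = z≈by

    others : ∀ j → enum (punchIn i₀ j) ≉ 0#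
    others j eq = Fin.punchInᵢ≢i i₀ j (enum-inj (trans eq (sym at-i₀)))

    f-inj : Injective _≡_ _≡_ f
    f-inj {i} {j} eq = enum-inj (*-cancelˡ b≉0
      (trans (sym (enum-f i)) (trans (reflexive (≡.cong enum eq)) (enum-f j))))

    π = proj₁ (injective⇒permutation f f-inj)
    π≡f = proj₂ (injective⇒permutation f f-inj)

    product-g : product (g ∘ enum) ≈ 1#
    product-g = *-cancelʳ (product-≉0 (h ∘ enum) (h-≉0 ∘ enum)) (begin
      product (g ∘ enum) * product (h ∘ enum)  ≈⟨ product-distrib-* (g ∘ enum) (h ∘ enum) ⟨
      product (λ i → g (enum i) * h (enum i))
        ≈⟨ product-cong (λ i → h-scale (trans (reflexive (≡.cong enum (π≡f i))) (enum-f i))) ⟨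
      product (λ i → h (enum (π ⟨$⟩ʳ i)))      ≈⟨ product-permute (h ∘ enum) π ⟨
      product (h ∘ enum)                       ≈⟨ *-identityˡ _ ⟨
      1# * product (h ∘ enum)                  ∎)

-- Sums over a finite field

module FiniteFieldProperties {c e} (K : Field c e) {n} (order : HasOrder (Field.setoid K) n) where
  open Inverse order public using () renaming (to to index; from to enum; to-cong to index-cong; from-cong to enum-cong)

  enum-index : ∀ x → Field._≈_ K (enum (index x)) x
  enum-index x = Inverse.strictlyInverseʳ order x

  index-enum : ∀ i → index (enum i) ≡ i
  index-enum = Inverse.strictlyInverseˡ order

  index-injective : ∀ {x y} → index x ≡ index y → Field._≈_ K x y
  index-injective {x} {y} eq = trans (sym (enum-index x)) (trans (enum-cong eq) (enum-index y))
    where open Field K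

  ≈-dec : Decidable (Field._≈_ K)
  ≈-dec x y = map′ index-injective index-cong (index x Fin.≟ index y)

  open FieldProperties K ≈-dec public
  open Summation semiring public using (sum; sum-remove; ∑-distrib-+; sum-cong-≋; sum-permute; sum-replicate; sum-replicate-zero; *-distribˡ-sum; ∑-comm)
  open Mult semiring public using (×1-homo-*) renaming (_×_ to _·_)
  open SetoidReasoning setoid

  enum-injective : Injective _≡_ _≈_ enum
  enum-injective {i} {j} eq = ≡.trans (≡.sym (index-enum i)) (≡.trans (index-cong eq) (index-enum j))

  ∑K : (Carrier → Carrier) → Carrier
  ∑K F = sum (F ∘ enum)

  ∑K-cong : ∀ {F G} → (∀ x → F x ≈ G x) → ∑K F ≈ ∑K G
  ∑K-cong F≈G = sum-cong-≋ (F≈G ∘ enum)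

  private
    module _ {g : Carrier → Carrier} (g-cong : g Preserves _≈_ ⟶ _≈_) (g-inj : Injective _≈_ _≈_ g) where
      ĝ : Fin n → Fin n
      ĝ i = index (g (enum i))

      ĝ-injective : Injective _≡_ _≡_ ĝ
      ĝ-injective = enum-injective ∘ g-inj ∘ index-injective

  injective⇒bijective : ∀ {g} → g Preserves _≈_ ⟶ _≈_ → Injective _≈_ _≈_ g → Bijective _≈_ _≈_ g
  injective⇒bijective {g} g-cong g-inj = g-inj , λ y →
    let i , ĝi≡ = injective⇒surjective (ĝ-injective g-cong g-inj) (index y)
    in enum i , λ z≈ → trans (g-cong z≈) (index-injective ĝi≡)

  ∑K-reindex : ∀ {F g} → F Preserves _≈_ ⟶ _≈_ → g Preserves _≈_ ⟶ _≈_ → Injective _≈_ _≈_ g →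
               ∑K (F ∘ g) ≈ ∑K F
  ∑K-reindex {F} {g} F-cong g-cong g-inj = begin
    ∑K (F ∘ g)                        ≈⟨ sum-cong-≋ (λ i → F-cong (trans (sym (enum-index _)) (enum-cong (≡.sym (π≡ĝ i))))) ⟩
    sum (λ i → F (enum (π ⟨$⟩ʳ i)))  ≈⟨ sum-permute (F ∘ enum) π ⟨
    ∑K F                              ∎
    where
    π = proj₁ (injective⇒permutation _ (ĝ-injective g-cong g-inj))
    π≡ĝ = proj₂ (injective⇒permutation _ (ĝ-injective g-cong g-inj))

  -- Translation by 1 permutes K, so the sum of all elements is unchanged when n copies of 1 are
  -- added to it.
  order·1≈0 : n · 1# ≈ 0#
  order·1≈0 = begin
    n · 1#                            ≈⟨ +-identityˡ _ ⟨
    0# + n · 1#                       ≈⟨ +-congʳ (-‿inverseˡ _) ⟨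
    - ∑K id + ∑K id + n · 1#          ≈⟨ +-assoc _ _ _ ⟩
    - ∑K id + (∑K id + n · 1#)        ≈⟨ +-congˡ (+-congˡ (sum-replicate n)) ⟨
    - ∑K id + (∑K id + ∑K (λ _ → 1#)) ≈⟨ +-congˡ (∑-distrib-+ enum (λ _ → 1#)) ⟨
    - ∑K id + ∑K (_+ 1#)              ≈⟨ +-congˡ (∑K-reindex {F = id} id +-congʳ +1-injective) ⟩
    - ∑K id + ∑K id                   ≈⟨ -‿inverseˡ _ ⟩
    0#                                ∎
    where
    +1-injective : Injective _≈_ _≈_ (_+ 1#)
    +1-injective {x} {y} eq = begin
      x                ≈⟨ +-identityʳ x ⟨
      x + 0#           ≈⟨ +-congˡ (-‿inverseʳ 1#) ⟨
      x + (1# + - 1#)  ≈⟨ +-assoc _ _ _ ⟨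
      x + 1# + - 1#    ≈⟨ +-congʳ eq ⟩
      y + 1# + - 1#    ≈⟨ +-assoc _ _ _ ⟩
      y + (1# + - 1#)  ≈⟨ +-congˡ (-‿inverseʳ 1#) ⟩
      y + 0#           ≈⟨ +-identityʳ y ⟩
      y                ∎

  order-nonZero : NonZero n
  order-nonZero = Fin.nonZeroIndex (index 0#)

  ^order : ∀ x → x ^ n ≈ x
  ^order x with ≈-dec x 0#
  ... | yes x≈0 = trans (^-congˡ n x≈0) (trans (0^ n {{order-nonZero}}) (sym x≈0))
  ... | no  x≉0 = fermat enum enum-injective (index 0#) (enum-index 0#) x≉0
                    (λ i → index (x * enum i)) (λ i → enum-index _)

  ∃-≉0 : ∀ {F} → F Preserves _≈_ ⟶ _≈_ → ¬ (∀ x → F x ≈ 0#) → ∃[ x ] F x ≉ 0#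
  ∃-≉0 {F} F-cong ¬all with Fin.any? (λ i → ¬? (≈-dec (F (enum i)) 0#))
  ... | yes (i , Fi≉0) = enum i , Fi≉0
  ... | no  none = contradiction all ¬all
    where
    all : ∀ x → F x ≈ 0#
    all x with ≈-dec (F x) 0#
    ... | yes Fx≈0 = Fx≈0
    ... | no  Fx≉0 = contradiction (index x , Fx≉0 ∘ trans (F-cong (sym (enum-index x)))) none

  -- The substitution of z x for x permutes K and multiplies the sum by z^m, which differs from 1.
  ∑K-^-vanishes : ∀ m → ∀ {z} → z ≉ 0# → z ^ m ≉ 1# → ∑K (_^ m) ≈ 0#
  ∑K-^-vanishes m {z} z≉0 zᵐ≉1 with ≈-dec (∑K (_^ m)) 0#
  ... | yes eq = eq
  ... | no s≉0 = contradiction (*-cancelʳ s≉0 (begin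
    z ^ m * ∑K (_^ m)           ≈⟨ *-distribˡ-sum (z ^ m) (λ i → enum i ^ m) ⟩
    ∑K (λ x → z ^ m * x ^ m)    ≈⟨ ∑K-cong (λ x → ^-distrib-* z x m) ⟨
    ∑K (λ x → (z * x) ^ m)      ≈⟨ ∑K-reindex (^-congˡ m) *-congˡ (*-cancelˡ z≉0) ⟩
    ∑K (_^ m)                   ≈⟨ *-identityˡ _ ⟨
    1# * ∑K (_^ m)              ∎)) zᵐ≉1

  -- Every nonzero element contributes 1 and zero contributes 0, so the sum is n - 1 copies of 1,
  -- which is -1 because n copies vanish.
  ∑K-^-trivial : ∀ m .{{_ : NonZero m}} → (∀ x → x ≉ 0# → x ^ m ≈ 1#) → ∑K (_^ m) ≉ 0#
  ∑K-^-trivial m all-1 s≈0 = 1≉0 (begin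
    1#                                ≈⟨ +-identityˡ 1# ⟨
    0# + 1#                           ≈⟨ +-congʳ s≈0 ⟨
    ∑K (_^ m) + 1#                    ≈⟨ nonzero-count n enum enum-injective (index 0#) (enum-index 0#) ⟩
    n · 1#                            ≈⟨ order·1≈0 ⟩
    0#                                ∎)
    where
    nonzero-count : ∀ n (f : Fin n → Carrier) → Injective _≡_ _≈_ f → ∀ i₀ → f i₀ ≈ 0# →
                    sum (λ i → f i ^ m) + 1# ≈ n · 1#
    nonzero-count (suc n) f f-inj i₀ fi₀≈0 = begin
      sum (λ i → f i ^ m) + 1#   ≈⟨ +-congʳ (sum-remove {i = i₀} (λ i → f i ^ m)) ⟩
      f i₀ ^ m + sum (λ j → f (punchIn i₀ j) ^ m) + 1#
        ≈⟨ +-congʳ (+-cong (trans (^-congˡ m fi₀≈0) (0^ m)) (sum-cong-≋ λ j → all-1 _ λ fj≈0 →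
             Fin.punchInᵢ≢i i₀ j (f-inj (trans fj≈0 (sym fi₀≈0))))) ⟩
      0# + sum {n} (λ _ → 1#) + 1#   ≈⟨ +-congʳ (trans (+-identityˡ _) (sum-replicate n)) ⟩
      n · 1# + 1#                    ≈⟨ +-comm _ _ ⟩
      1# + n · 1#                    ∎

-- Characteristic 2: equational reasoning and roots of polynomials

-- Booleans as solver coefficients make normalisation work modulo 2: x + x cancels, and signs
-- disappear.
𝔽₂ : RawRing _ _
𝔽₂ = record { Carrier = Bool ; _≈_ = _≡_ ; _+_ = _xor_ ; _*_ = _∧_ ; -_ = id ; 0# = false ; 1# = true }

module Characteristic2 {c e} (K : Field c e) (_≟_ : Decidable (Field._≈_ K))
                       (1+1≈0 : Field._≈_ K (Field._+_ K (Field.1# K) (Field.1# K)) (Field.0# K)) where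
  open FieldProperties K _≟_
  open import Algebra.Properties.Ring ring using (-0#≈0#)
  open SetoidReasoning setoid

  private
    -1≈1 : - 1# ≈ 1#
    -1≈1 = begin
      - 1#                ≈⟨ +-identityʳ _ ⟨
      - 1# + 0#           ≈⟨ +-congˡ 1+1≈0 ⟨
      - 1# + (1# + 1#)    ≈⟨ +-assoc _ _ _ ⟨
      - 1# + 1# + 1#      ≈⟨ +-congʳ (-‿inverseˡ 1#) ⟩
      0# + 1#             ≈⟨ +-identityˡ 1# ⟩
      1#                  ∎

    ⟦_⟧𝔽₂ : Bool → Carrier
    ⟦ false ⟧𝔽₂ = 0#
    ⟦ true  ⟧𝔽₂ = 1#

    morphism : 𝔽₂ -Raw-AlmostCommutative⟶ fromCommutativeRing commutativeRing
    morphism = record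
      { ⟦_⟧ = ⟦_⟧𝔽₂
      ; +-homo = λ { false y → sym (+-identityˡ _) ; true false → sym (+-identityʳ _) ; true true → sym 1+1≈0 }
      ; *-homo = λ { false y → sym (zeroˡ _) ; true y → sym (*-identityˡ _) }
      ; -‿homo = λ { false → sym -0#≈0# ; true → sym -1≈1 }
      ; 0-homo = refl
      ; 1-homo = refl
      }

    coeff-≟ : WeaklyDecidable (Induced-equivalence morphism)
    coeff-≟ false false = just refl
    coeff-≟ true  true  = just refl
    coeff-≟ _     _     = nothing

  open RingSolver 𝔽₂ (fromCommutativeRing commutativeRing) morphism coeff-≟ public
    using (solve; _:=_; _:+_; _:*_; con; Polynomial)

  :0 :1 : ∀ {i} → Polynomial i
  :0 = con false
  :1 = con true

  x+x≈0 : ∀ x → x + x ≈ 0#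
  x+x≈0 = solve 1 (λ x → x :+ x := :0) refl

  ≈⇒+≈0 : ∀ {x y} → x ≈ y → x + y ≈ 0#
  ≈⇒+≈0 {x} {y} x≈y = trans (+-congʳ x≈y) (x+x≈0 y)

  +≈0⇒≈ : ∀ {x y} → x + y ≈ 0# → x ≈ y
  +≈0⇒≈ {x} {y} eq = begin
    x          ≈⟨ solve 2 (λ x y → x := x :+ y :+ y) refl x y ⟩
    x + y + y  ≈⟨ +-congʳ eq ⟩
    0# + y     ≈⟨ +-identityˡ y ⟩
    y          ∎

  -- Horner evaluation of d low-order coefficients. `evalMonic` adds an implicit leading term of
  -- degree d and `evalBelow` does not, so being monic is built into the representation.
  evalMonic evalBelow : ∀ {d} → Vec Carrier d → Carrier → Carrier
  evalMonic []       x = 1#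
  evalMonic (c ∷ cs) x = c + x * evalMonic cs x
  evalBelow []       x = 0#
  evalBelow (c ∷ cs) x = c + x * evalBelow cs x

  evalMonic≈^+evalBelow : ∀ {d} (cs : Vec Carrier d) x → evalMonic cs x ≈ x ^ d + evalBelow cs x
  evalMonic≈^+evalBelow []       x = sym (+-identityʳ 1#)
  evalMonic≈^+evalBelow {suc d} (c ∷ cs) x = trans (+-congˡ (*-congˡ (evalMonic≈^+evalBelow cs x)))
    (solve 4 (λ c x p b → c :+ x :* (p :+ b) := x :* p :+ (c :+ x :* b)) refl c x (x ^ d) (evalBelow cs x))

  -- Synthetic division by X + r: the coefficients of the quotient are the Horner values at r of the
  -- successive tails.
  quotient : ∀ {d} → Vec Carrier (suc d) → Carrier → Vec Carrier d
  quotient         (c ∷ [])         r = []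
  quotient {suc _} (c ∷ cs@(_ ∷ _)) r = evalMonic cs r ∷ quotient cs r

  quotient-correct : ∀ {d} (cs : Vec Carrier (suc d)) r x →
                     evalMonic cs x ≈ evalMonic cs r + (x + r) * evalMonic (quotient cs r) x
  quotient-correct (c ∷ []) r x =
    solve 3 (λ c r x → c :+ x :* :1 := c :+ r :* :1 :+ (x :+ r) :* :1) refl c r x
  quotient-correct (c ∷ cs@(_ ∷ _)) r x = trans (+-congˡ (*-congˡ (quotient-correct cs r x)))
    (solve 5 (λ c r x g h → c :+ x :* (g :+ (x :+ r) :* h) := c :+ r :* g :+ (x :+ r) :* (g :+ x :* h)) refl
      c r x (evalMonic cs r) (evalMonic (quotient cs r) x))

  -- Dividing by X + r for a root r lowers the degree and keeps all other points as roots; at degree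
  -- 0 the value is 1.
  few-roots : ∀ {d} (cs : Vec Carrier d) (points : Fin (suc d) → Carrier) → Injective _≡_ _≈_ points →
              ¬ (∀ i → evalMonic cs (points i) ≈ 0#)
  few-roots []         points inj all = 1≉0 (all zero)
  few-roots cs@(_ ∷ _) points inj all = few-roots (quotient cs r) (points ∘ suc) (Fin.suc-injective ∘ inj) λ i →
    no-zero-divisorʳ (λ eq → Fin.0≢1+n (≡.sym (inj (+≈0⇒≈ eq)))) (begin
      (points (suc i) + r) * evalMonic (quotient cs r) (points (suc i))  ≈⟨ +-identityˡ _ ⟨
      0# + (points (suc i) + r) * evalMonic (quotient cs r) (points (suc i))  ≈⟨ +-congʳ (all zero) ⟨
      evalMonic cs r + (points (suc i) + r) * evalMonic (quotient cs r) (points (suc i)) ≈⟨ quotient-correct cs r _ ⟨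
      evalMonic cs (points (suc i)) ≈⟨ all (suc i) ⟩
      0# ∎)
    where r = points zero

  -- Polynomial functions are considered up to pointwise equality, so that sums such as the trace
  -- count without being given as coefficient lists.
  PolynomialBelow : ℕ → (Carrier → Carrier) → Set (c ⊔ e)
  PolynomialBelow d F = ∃[ cs ] ∀ x → evalBelow {d} cs x ≈ F x

  below-0 : ∀ d → PolynomialBelow d (λ _ → 0#)
  below-0 zero    = [] , λ _ → refl
  below-0 (suc d) = 0# ∷ proj₁ (below-0 d) , λ x →
    trans (+-identityˡ _) (trans (*-congˡ (proj₂ (below-0 d) x)) (zeroʳ x))

  below-+ : ∀ {d F G} → PolynomialBelow d F → PolynomialBelow d G → PolynomialBelow d (λ x → F x + G x)
  below-+ (as , as≈) (bs , bs≈) = zipWith _+_ as bs , λ x → trans (eval-zip as bs x) (+-cong (as≈ x) (bs≈ x))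
    where
    eval-zip : ∀ {d} (as bs : Vec Carrier d) x → evalBelow (zipWith _+_ as bs) x ≈ evalBelow as x + evalBelow bs x
    eval-zip []       []       x = sym (+-identityˡ 0#)
    eval-zip (a ∷ as) (b ∷ bs) x = trans (+-congˡ (*-congˡ (eval-zip as bs x)))
      (solve 5 (λ a b x p q → a :+ b :+ x :* (p :+ q) := a :+ x :* p :+ (b :+ x :* q)) refl a b x _ _)

  below-^ : ∀ {j d} → j ℕ.< d → PolynomialBelow d (_^ j)
  below-^ {zero}  {suc d} _ = 1# ∷ proj₁ (below-0 d) , λ x →
    trans (+-congˡ (trans (*-congˡ (proj₂ (below-0 d) x)) (zeroʳ x))) (+-identityʳ 1#)
  below-^ {suc j} {suc d} (ℕ.s≤s j<d) = 0# ∷ proj₁ (below-^ j<d) , λ x →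
    trans (+-identityˡ _) (*-congˡ (proj₂ (below-^ j<d) x))

  below-sum : ∀ {d i} {F : Fin i → Carrier → Carrier} → (∀ j → PolynomialBelow d (F j)) →
              PolynomialBelow d (λ x → ∑[ j < i ] F j x)
  below-sum {i = zero}  _  = below-0 _
  below-sum {i = suc i} Fs = below-+ (Fs zero) (below-sum (Fs ∘ suc))

  ¬monic-vanishes : ∀ {d n F} → PolynomialBelow d F → d ℕ.< n →
                    (points : Fin n → Carrier) → Injective _≡_ _≈_ points →
                    ¬ (∀ i → points i ^ d + F (points i) ≈ 0#)
  ¬monic-vanishes (cs , cs≈) d<n points inj all =
    few-roots cs (points ∘ inj≤) (Fin.inject≤-injective d<n d<n _ _ ∘ inj) λ i →
      trans (evalMonic≈^+evalBelow cs _) (trans (+-congˡ (cs≈ _)) (all (inj≤ i)))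
    where inj≤ = λ i → inject≤ i d<n

  -- Iterates of the Frobenius map and their fixed points

  infix 8 _²
  _² : Carrier → Carrier
  x ² = x * x

  -- Conjugation over 𝔽_q and the Q-th power are both iterates of squaring; one family covers them
  -- and lets their exponents be compared.
  Fr : ℕ → Carrier → Carrier
  Fr i x = x ^ (2 ℕ.^ i)

  Fr-cong : ∀ i {x y} → x ≈ y → Fr i x ≈ Fr i y
  Fr-cong i = ^-congˡ (2 ℕ.^ i)

  Fr-suc : ∀ i x → Fr (suc i) x ≈ Fr i (x ²)
  Fr-suc i x = trans (sym (^-assocʳ x 2 (2 ℕ.^ i))) (Fr-cong i (*-congˡ (*-identityʳ x)))

  Fr-+ : ∀ i x y → Fr i (x + y) ≈ Fr i x + Fr i y
  Fr-+ zero    x y = trans (*-identityʳ _) (+-cong (sym (*-identityʳ x)) (sym (*-identityʳ y)))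
  Fr-+ (suc i) x y = begin
    Fr (suc i) (x + y)           ≈⟨ Fr-suc i _ ⟩
    Fr i ((x + y) ²)             ≈⟨ Fr-cong i (solve 2 (λ x y → (x :+ y) :* (x :+ y) := x :* x :+ y :* y) refl x y) ⟩
    Fr i (x ² + y ²)             ≈⟨ Fr-+ i _ _ ⟩
    Fr i (x ²) + Fr i (y ²)      ≈⟨ +-cong (Fr-suc i x) (Fr-suc i y) ⟨
    Fr (suc i) x + Fr (suc i) y  ∎

  Fr-* : ∀ i x y → Fr i (x * y) ≈ Fr i x * Fr i y
  Fr-* i x y = ^-distrib-* x y (2 ℕ.^ i)

  Fr-∘ : ∀ i j x → Fr i (Fr j x) ≈ Fr (i ℕ.+ j) x
  Fr-∘ i j x = trans (^-assocʳ x (2 ℕ.^ j) (2 ℕ.^ i))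
    (^-congʳ x (≡.trans (ℕ.*-comm (2 ℕ.^ j) _) (≡.sym (ℕ.^-distribˡ-+-* 2 i j))))

  Fr-comm : ∀ i j x → Fr i (Fr j x) ≈ Fr j (Fr i x)
  Fr-comm i j x = trans (Fr-∘ i j x) (trans (^-congʳ x (≡.cong (2 ℕ.^_) (ℕ.+-comm i j))) (sym (Fr-∘ j i x)))

  Fr-1 : ∀ i → Fr i 1# ≈ 1#
  Fr-1 i = 1^ (2 ℕ.^ i)

  Fr-0 : ∀ i → Fr i 0# ≈ 0#
  Fr-0 i = 0^ (2 ℕ.^ i) {{ℕ.m^n≢0 2 i}}

  Fr-≉0 : ∀ i {x} → x ≉ 0# → Fr i x ≉ 0#
  Fr-≉0 i = ^-≉0 (2 ℕ.^ i)

  Fr-injective : ∀ i {x y} → Fr i x ≈ Fr i y → x ≈ y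
  Fr-injective i {x} {y} eq = +≈0⇒≈ (^-≈0 (2 ℕ.^ i) (trans (Fr-+ i x y) (≈⇒+≈0 eq)))

  ²-injective : ∀ {x y} → x ² ≈ y ² → x ≈ y
  ²-injective {x} {y} eq = Fr-injective 1 (trans (*-congˡ (*-identityʳ x)) (trans eq (sym (*-congˡ (*-identityʳ y)))))

  Fr-⁻¹ : ∀ i {x} → x ≉ 0# → Fr i (x ⁻¹) * Fr i x ≈ 1#
  Fr-⁻¹ i {x} x≉0 = trans (sym (Fr-* i (x ⁻¹) x)) (trans (Fr-cong i (*-inverseˡ x≉0)) (Fr-1 i))

  idempotent⇒0∨1 : ∀ {x} → x ² ≈ x → x ≈ 0# ⊎ x ≈ 1#
  idempotent⇒0∨1 {x} eq with zero-product (trans (solve 1 (λ x → x :* (x :+ :1) := x :* x :+ x) refl x) (≈⇒+≈0 eq))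
  ... | inj₁ x≈0   = inj₁ x≈0
  ... | inj₂ x+1≈0 = inj₂ (+≈0⇒≈ x+1≈0)

  0∨1⇒idempotent : ∀ {x} → x ≈ 0# ⊎ x ≈ 1# → x ² ≈ x
  0∨1⇒idempotent (inj₁ x≈0) = trans (*-cong x≈0 x≈0) (trans (zeroʳ 0#) (sym x≈0))
  0∨1⇒idempotent (inj₂ x≈1) = trans (*-cong x≈1 x≈1) (trans (*-identityʳ 1#) (sym x≈1))

  Fixed : ℕ → Carrier → Set e
  Fixed i x = Fr i x ≈ x

  fixed-1⇒idempotent : ∀ {x} → Fixed 1 x → x ² ≈ x
  fixed-1⇒idempotent fix = trans (sym (*-congˡ (*-identityʳ _))) fix

  idempotent⇒fixed : ∀ i {x} → x ² ≈ x → Fixed i x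
  idempotent⇒fixed zero    eq = *-identityʳ _
  idempotent⇒fixed (suc i) eq = trans (Fr-suc i _) (trans (Fr-cong i eq) (idempotent⇒fixed i eq))

  fixed-+ : ∀ i j {x} → Fixed i x → Fixed j x → Fixed (i ℕ.+ j) x
  fixed-+ i j fixᵢ fixⱼ = trans (sym (Fr-∘ i j _)) (trans (Fr-cong i fixⱼ) fixᵢ)

  fixed-*-multiple : ∀ i j {x} → Fixed j x → Fixed (i ℕ.* j) x
  fixed-*-multiple zero    j fix = *-identityʳ _
  fixed-*-multiple (suc i) j fix = fixed-+ j (i ℕ.* j) fix (fixed-*-multiple i j fix)

  fixed-cancel : ∀ d j {x} → Fixed j x → Fixed (d ℕ.+ j) x → Fixed d x
  fixed-cancel d j fixⱼ fix = trans (Fr-cong d (sym fixⱼ)) (trans (Fr-∘ d j _) fix)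

  -- Bézout in ℕ writes the gcd as a multiple of i minus a multiple of j, or the reverse;
  -- `fixed-cancel` performs the subtraction.
  fixed-gcd : ∀ i j {x} → Fixed i x → Fixed j x → Fixed (gcd i j) x
  fixed-gcd i j {x} fixᵢ fixⱼ with Bézout.identity (gcd-GCD i j)
  ... | Bézout.+- y z eq = fixed-cancel (gcd i j) (z ℕ.* j) (fixed-*-multiple z j fixⱼ)
    (≡.subst (λ l → Fixed l x) (≡.sym eq) (fixed-*-multiple y i fixᵢ))
  ... | Bézout.-+ y z eq = fixed-cancel (gcd i j) (y ℕ.* i) (fixed-*-multiple y i fixᵢ)
    (≡.subst (λ l → Fixed l x) (≡.sym eq) (fixed-*-multiple z j fixⱼ))

  -- The trace polynomial

  open FieldNotions K public using (Tr)
  open Summation semiring using (sum-cong-≋)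

  Tr-cong : ∀ i {x y} → x ≈ y → Tr i x ≈ Tr i y
  Tr-cong i x≈y = sum-cong-≋ {i} (λ j → ^-congˡ (2 ℕ.^ toℕ j) x≈y)

  Tr-suc : ∀ i x → Tr (suc i) x ≈ x + Tr i (x ²)
  Tr-suc i x = +-cong (*-identityʳ x) (sum-cong-≋ {i} λ j → Fr-suc (toℕ j) x)

  Tr-+ : ∀ i x y → Tr i (x + y) ≈ Tr i x + Tr i y
  Tr-+ zero    x y = sym (+-identityʳ 0#)
  Tr-+ (suc i) x y = begin
    Tr (suc i) (x + y)           ≈⟨ Tr-suc i _ ⟩
    x + y + Tr i ((x + y) ²)
      ≈⟨ +-congˡ (Tr-cong i (solve 2 (λ x y → (x :+ y) :* (x :+ y) := x :* x :+ y :* y) refl x y)) ⟩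
    x + y + Tr i (x ² + y ²)     ≈⟨ +-congˡ (Tr-+ i _ _) ⟩
    x + y + (Tr i (x ²) + Tr i (y ²))
      ≈⟨ solve 4 (λ x y s t → x :+ y :+ (s :+ t) := x :+ s :+ (y :+ t)) refl x y _ _ ⟩
    x + Tr i (x ²) + (y + Tr i (y ²))  ≈⟨ +-cong (Tr-suc i x) (Tr-suc i y) ⟨
    Tr (suc i) x + Tr (suc i) y  ∎

  Tr-Fr : ∀ i j x → Tr i (Fr j x) ≈ Fr j (Tr i x)
  Tr-Fr zero    j x = sym (Fr-0 j)
  Tr-Fr (suc i) j x = begin
    Tr (suc i) (Fr j x)          ≈⟨ Tr-suc i _ ⟩
    Fr j x + Tr i (Fr j x ²)     ≈⟨ +-congˡ (Tr-cong i (Fr-* j x x)) ⟨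
    Fr j x + Tr i (Fr j (x ²))   ≈⟨ +-congˡ (Tr-Fr i j (x ²)) ⟩
    Fr j x + Fr j (Tr i (x ²))   ≈⟨ Fr-+ j _ _ ⟨
    Fr j (x + Tr i (x ²))        ≈⟨ Fr-cong j (Tr-suc i x) ⟨
    Fr j (Tr (suc i) x)          ∎

  -- Telescoping: x + x² is the Artin-Schreier map, and consecutive terms of the sum cancel.
  Tr-℘ : ∀ i x → Tr i (x + x ²) ≈ x + Fr i x
  Tr-℘ zero    x = sym (trans (+-congˡ (*-identityʳ x)) (x+x≈0 x))
  Tr-℘ (suc i) x = begin
    Tr (suc i) (x + x ²)                ≈⟨ Tr-suc i _ ⟩
    x + x ² + Tr i ((x + x ²) ²)
      ≈⟨ +-congˡ (Tr-cong i (solve 1 (λ x → (x :+ x :* x) :* (x :+ x :* x) := x :* x :+ x :* x :* (x :* x)) refl x)) ⟩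
    x + x ² + Tr i (x ² + (x ²) ²)      ≈⟨ +-congˡ (Tr-℘ i (x ²)) ⟩
    x + x ² + (x ² + Fr i (x ²))        ≈⟨ solve 2 (λ x y → x :+ x :* x :+ (x :* x :+ y) := x :+ y) refl x _ ⟩
    x + Fr i (x ²)                      ≈⟨ +-congˡ (Fr-suc i x) ⟨
    x + Fr (suc i) x                    ∎

  Tr-² : ∀ i x → Tr i (x ²) ≈ Tr i x + (x + Fr i x)
  Tr-² i x = trans (solve 2 (λ s t → t := s :+ (s :+ t)) refl (Tr i x) _)
    (+-congˡ (trans (sym (Tr-+ i x (x ²))) (Tr-℘ i x)))

  ²-Tr : ∀ i x → Tr i x ² ≈ Tr i (x ²)
  ²-Tr i x = begin
    Tr i x ²         ≈⟨ *-congˡ (*-identityʳ _) ⟨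
    Fr 1 (Tr i x)    ≈⟨ Tr-Fr i 1 x ⟨
    Tr i (Fr 1 x)    ≈⟨ Tr-cong i (*-congˡ (*-identityʳ x)) ⟩
    Tr i (x ²)       ∎

  Tr-last : ∀ i x → Tr (suc i) x ≈ Tr i x + Fr i x
  Tr-last i x = trans (Tr-suc i x) (trans (+-congˡ (Tr-² i x))
    (solve 3 (λ x s t → x :+ (s :+ (x :+ t)) := s :+ t) refl x _ _))

  Tr-split : ∀ i j x → Tr (i ℕ.+ j) x ≈ Tr i x + Tr j (Fr i x)
  Tr-split zero    j x = sym (trans (+-identityˡ _) (Tr-cong j (*-identityʳ x)))
  Tr-split (suc i) j x = begin
    Tr (suc (i ℕ.+ j)) x                       ≈⟨ Tr-suc (i ℕ.+ j) x ⟩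
    x + Tr (i ℕ.+ j) (x ²)                     ≈⟨ +-congˡ (Tr-split i j (x ²)) ⟩
    x + (Tr i (x ²) + Tr j (Fr i (x ²)))       ≈⟨ +-assoc _ _ _ ⟨
    x + Tr i (x ²) + Tr j (Fr i (x ²))         ≈⟨ +-cong (Tr-suc i x) (Tr-cong j (Fr-suc i x)) ⟨
    Tr (suc i) x + Tr j (Fr (suc i) x)         ∎

  -- The terms of the sum repeat with period i and cancel in pairs. This is why x² + x = c with c in
  -- 𝔽_q is always solvable in 𝔽_{q²}.
  Tr-double : ∀ i {x} → Fixed i x → Tr (i ℕ.+ i) x ≈ 0#
  Tr-double i fix = trans (Tr-split i i _) (trans (+-congˡ (Tr-cong i fix)) (x+x≈0 _))

  Tr-odd : ∀ j {x} → x ² ≈ x → Tr (suc (j ℕ.+ j)) x ≈ x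
  Tr-odd j {x} idem = begin
    Tr (suc (j ℕ.+ j)) x     ≈⟨ Tr-suc (j ℕ.+ j) x ⟩
    x + Tr (j ℕ.+ j) (x ²)   ≈⟨ +-congˡ (Tr-cong (j ℕ.+ j) idem) ⟩
    x + Tr (j ℕ.+ j) x       ≈⟨ +-congˡ (Tr-double j (idempotent⇒fixed j idem)) ⟩
    x + 0#                   ≈⟨ +-identityʳ x ⟩
    x                        ∎

-- Fields of order 2^m and the Artin-Schreier equation

module BinaryField {c e} (K : Field c e) {m} .{{_ : NonZero m}} (order : HasOrder (Field.setoid K) (2 ℕ.^ m)) where
  open FiniteFieldProperties K order public
  open SetoidReasoning setoid

  private
    2^·1 : ∀ i → (2 ℕ.^ i) · 1# ≈ (2 · 1#) ^ i
    2^·1 zero    = +-identityʳ 1#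
    2^·1 (suc i) = trans (×1-homo-* 2 (2 ℕ.^ i)) (*-congˡ (2^·1 i))

    -- The order 2^m annihilates 1, which says (1 + 1)^m = 0.
    1+1≈0 : 1# + 1# ≈ 0#
    1+1≈0 = trans (sym (+-congˡ (+-identityʳ 1#))) (^-≈0 m (trans (sym (2^·1 m)) order·1≈0))

  open Characteristic2 K ≈-dec 1+1≈0 public

  fixed-order : ∀ x → Fixed m x
  fixed-order = ^order

  ∃-nonroot : ∀ {d F} → F Preserves _≈_ ⟶ _≈_ → PolynomialBelow d F → d ℕ.< 2 ℕ.^ m → ∃[ x ] x ^ d + F x ≉ 0#
  ∃-nonroot {d} F-cong F-below d< = ∃-≉0 (λ eq → +-cong (^-congˡ d eq) (F-cong eq))
    λ all → ¬monic-vanishes F-below d< _ enum-injective (all ∘ _)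

  -- The polynomial X^(d+1) + X has degree below the order of K, so some z is not a root. As 0 is a
  -- root, z is nonzero and z^d differs from 1.
  ∃-^≉1 : ∀ {d} .{{_ : NonZero d}} → suc d ℕ.< 2 ℕ.^ m → ∃[ z ] z ≉ 0# × z ^ d ≉ 1#
  ∃-^≉1 {d@(suc _)} d+1< = z , z≉0 , λ zᵈ≈1 → nonroot (≈⇒+≈0 (trans (*-congˡ zᵈ≈1) refl))
    where
    witness : ∃[ x ] x ^ suc d + x ^ 1 ≉ 0#
    witness = ∃-nonroot (^-congˡ 1) (below-^ (ℕ.s≤s (ℕ.s≤s ℕ.z≤n))) d+1<
    z = proj₁ witness
    nonroot = proj₂ witness
    z≉0 : z ≉ 0#
    z≉0 z≈0 = nonroot (≈⇒+≈0 (trans (^-congˡ (suc d) z≈0) (trans (0^ (suc d)) (trans (sym (0^ 1)) (^-congˡ 1 (sym z≈0))))))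

  -- The trace polynomial has degree 2^(m-1), below the order of K, so it is not identically zero;
  -- its values are idempotent, so a nonzero one is 1.
  ∃-Tr≈1 : ∃[ θ ] Tr m θ ≈ 1#
  ∃-Tr≈1 = θ , [ (λ eq → contradiction (trans (Tr-m θ) eq) (proj₂ witness)) , id ]′ (idempotent⇒0∨1 idem)
    where
    m′ = ℕ.pred m
    Tr-m : ∀ x → x ^ (2 ℕ.^ m′) + Tr m′ x ≈ Tr m x
    Tr-m x = trans (+-comm _ _) (trans (sym (Tr-last m′ x)) (reflexive (≡.cong (λ i → Tr i x) (ℕ.suc-pred m))))
    witness = ∃-nonroot (Tr-cong m′)
      (below-sum {i = m′} {F = λ j → _^ (2 ℕ.^ toℕ j)} λ j → below-^ (ℕ.^-monoʳ-< 2 (ℕ.s≤s (ℕ.s≤s ℕ.z≤n)) (Fin.toℕ<n j)))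
      (ℕ.^-monoʳ-< 2 (ℕ.s≤s (ℕ.s≤s ℕ.z≤n)) (ℕ.≤-reflexive (ℕ.suc-pred m)))
    θ = proj₁ witness
    idem : Tr m θ ² ≈ Tr m θ
    idem = begin
      Tr m θ ²                    ≈⟨ ²-Tr m θ ⟩
      Tr m (θ ²)                  ≈⟨ Tr-² m θ ⟩
      Tr m θ + (θ + Fr m θ)       ≈⟨ +-congˡ (+-congˡ (fixed-order θ)) ⟩
      Tr m θ + (θ + θ)            ≈⟨ solve 2 (λ t x → t :+ (x :+ x) := t) refl _ θ ⟩
      Tr m θ                      ∎

  -- Additive Hilbert 90: with Tr θ = 1, the solution is Σ_{i<m} (Σ_{j<i} c^(2^j)) θ^(2^i).
  artin-schreier : ∀ {c} → Tr m c ≈ 0# → ∃[ y ] y ² + y ≈ c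
  artin-schreier {c} Tr-c≈0 = y m , (begin
    y m ² + y m                     ≈⟨ +-identityʳ _ ⟨
    y m ² + y m + 0#                ≈⟨ +-congˡ (trans (*-congʳ Tr-c≈0) (zeroˡ _)) ⟨
    y m ² + y m + Tr m c * Fr m θ   ≈⟨ y-step m ⟩
    c * Tr m (θ ²)                  ≈⟨ *-congˡ (trans (sym (²-Tr m θ)) (trans (*-cong Trθ≈1 Trθ≈1) (*-identityʳ 1#))) ⟩
    c * 1#                          ≈⟨ *-identityʳ c ⟩
    c                               ∎)
    where
    θ = proj₁ ∃-Tr≈1
    Trθ≈1 = proj₂ ∃-Tr≈1
    y : ℕ → Carrier
    y zero    = 0#
    y (suc i) = y i + Tr i c * Fr i θ

    Fr-square : ∀ i x → Fr (suc i) x ≈ Fr i x ²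
    Fr-square i x = trans (Fr-suc i x) (Fr-* i x x)

    -- Invariant of the partial sums. The boundary term `Tr i c * Fr i θ` disappears at i = m
    -- because the trace of c is zero.
    y-step : ∀ i → y i ² + y i + Tr i c * Fr i θ ≈ c * Tr i (θ ²)
    y-step zero    = trans (solve 1 (λ x → :0 :* :0 :+ :0 :+ :0 :* x := :0) refl _) (sym (zeroʳ c))
    y-step (suc i) = begin
      (y i + C * F) ² + (y i + C * F) + Tr (suc i) c * Fr (suc i) θ
        ≈⟨ +-congˡ (*-cong (trans (Tr-suc i c) (+-congˡ (sym (²-Tr i c)))) (Fr-square i θ)) ⟩
      (y i + C * F) ² + (y i + C * F) + (c + C ²) * F ²
        ≈⟨ solve 4 (λ y C F c → (y :+ C :* F) :* (y :+ C :* F) :+ (y :+ C :* F) :+ (c :+ C :* C) :* (F :* F)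
             := y :* y :+ y :+ C :* F :+ c :* (F :* F)) refl (y i) C F c ⟩
      y i ² + y i + C * F + c * F ²           ≈⟨ +-congʳ (y-step i) ⟩
      c * Tr i (θ ²) + c * F ²                ≈⟨ distribˡ c _ _ ⟨
      c * (Tr i (θ ²) + F ²)                  ≈⟨ *-congˡ (+-congˡ (Fr-* i θ θ)) ⟨
      c * (Tr i (θ ²) + Fr i (θ ²))           ≈⟨ *-congˡ (Tr-last i (θ ²)) ⟨
      c * Tr (suc i) (θ ²)                    ∎
      where
      C = Tr i c
      F = Fr i θ

  Fr-surjective : ∀ i x → ∃[ y ] Fr i y ≈ x
  Fr-surjective i x = let y , hit = proj₂ (injective⇒bijective (Fr-cong i) (Fr-injective i)) x in y , hit refl

-- Divisibility by q + 1

-- As an odd number, 1 + 2^k is coprime to 2, so factors 2 can be stripped until it would have to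
-- divide 1.
1+2^k∤2^ℓ : ∀ k ℓ .{{_ : NonZero k}} → ¬ suc (2 ℕ.^ k) ∣ 2 ℕ.^ ℓ
1+2^k∤2^ℓ k zero    div =
  contradiction (ℕ.suc-injective (ℕ.∣1⇒≡1 div)) (ℕ.≢-nonZero⁻¹ (2 ℕ.^ k) {{ℕ.m^n≢0 2 k}})
1+2^k∤2^ℓ k@(suc k-1) (suc ℓ) div = 1+2^k∤2^ℓ k ℓ (Coprimality.coprime-divisor coprime div)
  where
  coprime : Coprimality.Coprime (suc (2 ℕ.^ k)) 2
  coprime {d} (d∣1+q , d∣2) = ℕ.∣1⇒≡1 (ℕ.∣m+n∣m⇒∣n (≡.subst (d ∣_) (ℕ.+-comm 1 (2 ℕ.^ k)) d∣1+q)
    (ℕ.∣-trans d∣2 (ℕ.m∣m*n (2 ℕ.^ k-1))))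

-- Among the q + 1 consecutive integers from Q to Q + q exactly one is a multiple of q + 1, and it
-- is not Q. The others, times q - 1, are the exponents met in Hermite's criterion.
multiple-in-window : ∀ q Q → ¬ suc q ∣ Q →
  ∃[ r ] r ℕ.< q × suc q ∣ suc Q ℕ.+ r × (∀ {s} → s ℕ.< q → suc q ∣ suc Q ℕ.+ s → s ≡ r)
multiple-in-window q Q ∤Q = r , r<q , divides-r , unique
  where
  ρ = Q % suc q
  r = q ℕ.∸ ρ
  ρ≤q : ρ ℕ.≤ q
  ρ≤q = ℕ.s≤s⁻¹ (m%n<n Q (suc q))
  r<q : r ℕ.< q
  r<q = ℕ.∸-monoʳ-< (ℕ.n≢0⇒n>0 (∤Q ∘ ℕ.m%n≡0⇒n∣m Q (suc q))) ρ≤q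
  divides-r : suc q ∣ suc Q ℕ.+ r
  divides-r = divides (suc (Q ℕ./ suc q)) (begin
    suc Q ℕ.+ r                                  ≡⟨ ≡.cong (λ x → suc x ℕ.+ r) (m≡m%n+[m/n]*n Q (suc q)) ⟩
    suc (ρ ℕ.+ Q ℕ./ suc q ℕ.* suc q) ℕ.+ r      ≡⟨ shuffle ρ (Q ℕ./ suc q ℕ.* suc q) r ⟩
    suc (ρ ℕ.+ r) ℕ.+ Q ℕ./ suc q ℕ.* suc q      ≡⟨ ≡.cong (λ x → suc x ℕ.+ Q ℕ./ suc q ℕ.* suc q) (ℕ.m+[n∸m]≡n ρ≤q) ⟩
    suc q ℕ.+ Q ℕ./ suc q ℕ.* suc q              ∎)
    where
    open ≡.≡-Reasoning
    shuffle : ∀ a b c → suc (a ℕ.+ b) ℕ.+ c ≡ suc (a ℕ.+ c) ℕ.+ b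
    shuffle = solve-∀
  distinct : ∀ {s t} → s ℕ.< t → t ℕ.< q → suc q ∣ suc Q ℕ.+ s → ¬ suc q ∣ suc Q ℕ.+ t
  distinct {s} {t} s<t t<q ∣s ∣t = ℕ.>⇒∤ {{ℕ.>-nonZero (ℕ.m<n⇒0<n∸m s<t)}}
    (ℕ.s≤s (ℕ.≤-trans (ℕ.m∸n≤m t s) (ℕ.<⇒≤ t<q)))
    (ℕ.∣m+n∣m⇒∣n
      (≡.subst (suc q ∣_) (≡.trans (≡.cong (suc Q ℕ.+_) (≡.sym (ℕ.m+[n∸m]≡n (ℕ.<⇒≤ s<t)))) (≡.sym (ℕ.+-assoc (suc Q) s _))) ∣t) ∣s)
  unique : ∀ {s} → s ℕ.< q → suc q ∣ suc Q ℕ.+ s → s ≡ r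
  unique {s} s<q ∣s with ℕ.<-cmp s r
  ... | tri< s<r _ _ = contradiction divides-r (distinct s<r r<q ∣s)
  ... | tri≈ _ s≡r _ = s≡r
  ... | tri> _ _ r<s = contradiction ∣s (distinct r<s s<q divides-r)

-- With n = q - 1 this keeps the exponent (q-1) s, for s at most q, within the degree bound of
-- `∃-^≉1`.
1+n*s<[1+n]² : ∀ n {s} .{{_ : NonZero n}} → s ℕ.≤ suc n → suc (n ℕ.* s) ℕ.< suc n ℕ.* suc n
1+n*s<[1+n]² n {s} s≤1+n = begin
  2 ℕ.+ n ℕ.* s           ≤⟨ ℕ.+-monoʳ-≤ 2 (ℕ.*-monoʳ-≤ n s≤1+n) ⟩
  2 ℕ.+ n ℕ.* suc n       ≤⟨ ℕ.+-monoˡ-≤ (n ℕ.* suc n) (ℕ.s≤s (ℕ.>-nonZero⁻¹ n)) ⟩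
  suc n ℕ.+ n ℕ.* suc n   ∎
  where open ℕ.≤-Reasoning

-- The quadratic extension and Hermite's criterion

module QuadraticExtension {c e} (K : Field c e) {k} .{{_ : NonZero k}} .{{_ : NonZero (2 ℕ.* k)}}
                          (order : HasOrder (Field.setoid K) (2 ℕ.^ (2 ℕ.* k))) where
  open BinaryField K {m = 2 ℕ.* k} order public
  open SetoidReasoning setoid

  q q-1 : ℕ
  q = 2 ℕ.^ k
  q-1 = q ℕ.∸ 1

  1<q : 1 ℕ.< q
  1<q = ℕ.^-monoʳ-< 2 (ℕ.s≤s (ℕ.s≤s ℕ.z≤n)) (ℕ.>-nonZero⁻¹ k)

  q≡ : q ≡ suc q-1
  q≡ = ≡.sym (ℕ.m+[n∸m]≡n (ℕ.<⇒≤ 1<q))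

  instance
    q-1-nonZero : NonZero q-1
    q-1-nonZero = ℕ.>-nonZero (ℕ.m<n⇒0<n∸m 1<q)

  conj : Carrier → Carrier
  conj = Fr k

  conj-conj : ∀ x → conj (conj x) ≈ x
  conj-conj x = trans (Fr-∘ k k x) (trans (^-congʳ x (≡.cong (λ i → 2 ℕ.^ (k ℕ.+ i)) (≡.sym (ℕ.+-identityʳ k)))) (fixed-order x))

  conj≈*^[q-1] : ∀ x → conj x ≈ x * x ^ q-1
  conj≈*^[q-1] x = ^-congʳ x q≡

  q·q≡ : 2 ℕ.^ (2 ℕ.* k) ≡ q ℕ.* q
  q·q≡ = ≡.trans (≡.cong (λ i → 2 ℕ.^ (k ℕ.+ i)) (ℕ.+-identityʳ k)) (ℕ.^-distribˡ-+-* 2 k k)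

  [x^[q-1]]^[q+1]≈1 : ∀ {x} → x ≉ 0# → (x ^ q-1) ^ suc q ≈ 1#
  [x^[q-1]]^[q+1]≈1 {x} x≉0 = *-cancelˡ (Fr-≉0 k x≉0) (begin
    conj x * (x ^ q-1) ^ suc q
      ≈⟨ solve 3 (λ c z w → c :* (z :* w) := z :* (c :* w)) refl (conj x) (x ^ q-1) ((x ^ q-1) ^ q) ⟩
    x ^ q-1 * (conj x * conj (x ^ q-1)) ≈⟨ *-congˡ (Fr-* k x (x ^ q-1)) ⟨
    x ^ q-1 * conj (x * x ^ q-1)        ≈⟨ *-congˡ (Fr-cong k (conj≈*^[q-1] x)) ⟨
    x ^ q-1 * conj (conj x)             ≈⟨ *-congˡ (conj-conj x) ⟩
    x ^ q-1 * x                         ≈⟨ *-comm _ x ⟩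
    x * x ^ q-1                         ≈⟨ conj≈*^[q-1] x ⟨
    conj x                              ≈⟨ *-identityʳ _ ⟨
    conj x * 1#                         ∎)

  ^-%-q+1 : ∀ {x} → x ≉ 0# → ∀ s → (x ^ q-1) ^ s ≈ (x ^ q-1) ^ (s % suc q)
  ^-%-q+1 {x} x≉0 s = begin
    u ^ s                              ≡⟨ ≡.cong (u ^_) (m≡m%n+[m/n]*n s (suc q)) ⟩
    u ^ (s % suc q ℕ.+ t ℕ.* suc q)    ≈⟨ ^-homo-* u (s % suc q) _ ⟩
    u ^ (s % suc q) * u ^ (t ℕ.* suc q)
      ≈⟨ *-congˡ (trans (^-congʳ u (ℕ.*-comm t (suc q))) (trans (sym (^-assocʳ u (suc q) t)) (trans (^-congˡ t ([x^[q-1]]^[q+1]≈1 x≉0)) (1^ t)))) ⟩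
    u ^ (s % suc q) * 1#               ≈⟨ *-identityʳ _ ⟩
    u ^ (s % suc q)                    ∎
    where
    u = x ^ q-1
    t = s ℕ./ suc q

  ∑K-multiple : ∀ s .{{_ : NonZero s}} → suc q ∣ s → ∑K (_^ (q-1 ℕ.* s)) ≉ 0#
  ∑K-multiple s (divides t eq) = ∑K-^-trivial (q-1 ℕ.* s) {{ℕ.m*n≢0 q-1 s}} λ x x≉0 → begin
    x ^ (q-1 ℕ.* s)              ≈⟨ ^-assocʳ x q-1 s ⟨
    (x ^ q-1) ^ s                ≡⟨ ≡.cong ((x ^ q-1) ^_) (≡.trans eq (ℕ.*-comm t (suc q))) ⟩
    (x ^ q-1) ^ (suc q ℕ.* t)    ≈⟨ ^-assocʳ _ (suc q) t ⟨
    ((x ^ q-1) ^ suc q) ^ t      ≈⟨ ^-congˡ t ([x^[q-1]]^[q+1]≈1 x≉0) ⟩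
    1# ^ t                       ≈⟨ 1^ t ⟩
    1#                           ∎

  -- Since x^(q-1) has order dividing q + 1, s may be reduced to a nonzero remainder of at most q.
  -- The exponent is then small enough for some z with z^((q-1) s) different from 1.
  ∑K-nonmultiple : ∀ s → ¬ suc q ∣ s → ∑K (_^ (q-1 ℕ.* s)) ≈ 0#
  ∑K-nonmultiple s ∤s = ∑K-^-vanishes (q-1 ℕ.* s) z≉0 λ eq → z-nontrivial (begin
    z ^ (q-1 ℕ.* s₀)   ≈⟨ ^-assocʳ z q-1 s₀ ⟨
    (z ^ q-1) ^ s₀     ≈⟨ ^-%-q+1 z≉0 s ⟨
    (z ^ q-1) ^ s      ≈⟨ ^-assocʳ z q-1 s ⟩
    z ^ (q-1 ℕ.* s)    ≈⟨ eq ⟩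
    1#                 ∎)
    where
    s₀ = s % suc q
    instance
      s₀-nonZero : NonZero s₀
      s₀-nonZero = ℕ.≢-nonZero (∤s ∘ ℕ.m%n≡0⇒n∣m s (suc q))
    bound : suc (q-1 ℕ.* s₀) ℕ.< 2 ℕ.^ (2 ℕ.* k)
    bound = ≡.subst (suc (q-1 ℕ.* s₀) ℕ.<_) (≡.sym (≡.trans q·q≡ (≡.cong (λ n → n ℕ.* n) q≡)))
      (1+n*s<[1+n]² q-1 (≡.subst (s₀ ℕ.≤_) q≡ (ℕ.s≤s⁻¹ (m%n<n s (suc q)))))
    witness = ∃-^≉1 {{ℕ.m*n≢0 q-1 s₀}} bound
    z = proj₁ witness
    z≉0 = proj₁ (proj₂ witness)
    z-nontrivial = proj₂ (proj₂ witness)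

  -- The homogeneous form of (A^n - B^n) / (A - B), defined also for A = B.
  geometric : ℕ → Carrier → Carrier → Carrier
  geometric n A B = ∑[ j < n ] (A ^ toℕ j * B ^ (n ℕ.∸ suc (toℕ j)))

  geometric-suc : ∀ n A B → geometric (suc n) A B ≈ B ^ n + A * geometric n A B
  geometric-suc n A B = +-cong (*-identityˡ _) (trans
    (sum-cong-≋ {n} λ j → *-assoc A (A ^ toℕ j) _)
    (sym (*-distribˡ-sum {n} A λ j → A ^ toℕ j * B ^ (n ℕ.∸ suc (toℕ j)))))

  -- The division-free form of (A^(2n) - B^(2n)) / (A - B) = (A + B) (A^(2n) - B^(2n)) / (A² - B²),
  -- valid because A - B = A + B.
  geometric-double : ∀ n A B → geometric (n ℕ.+ n) A B ≈ (A + B) * geometric n (A ²) (B ²)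
  geometric-double zero    A B = sym (zeroʳ _)
  geometric-double (suc n) A B = begin
    geometric (suc n ℕ.+ suc n) A B                  ≡⟨ ≡.cong (λ i → geometric (suc i) A B) (ℕ.+-suc n n) ⟩
    geometric (suc (suc (n ℕ.+ n))) A B              ≈⟨ geometric-suc (suc (n ℕ.+ n)) A B ⟩
    B * B ^ (n ℕ.+ n) + A * geometric (suc (n ℕ.+ n)) A B
      ≈⟨ +-cong (*-congˡ even-power) (*-congˡ (trans (geometric-suc (n ℕ.+ n) A B) (+-cong even-power (*-congˡ (geometric-double n A B))))) ⟩
    B * P + A * (P + A * ((A + B) * G))
      ≈⟨ solve 4 (λ A B P G → B :* P :+ A :* (P :+ A :* ((A :+ B) :* G)) := (A :+ B) :* (P :+ A :* A :* G)) refl A B P G ⟩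
    (A + B) * (P + A ² * G)                          ≈⟨ *-congˡ (geometric-suc n (A ²) (B ²)) ⟨
    (A + B) * geometric (suc n) (A ²) (B ²)          ∎
    where
    P = (B ²) ^ n
    G = geometric n (A ²) (B ²)
    even-power : B ^ (n ℕ.+ n) ≈ P
    even-power = trans (^-homo-* B n n) (sym (^-distrib-* B B n))

  -- All binomial coefficients of 2^i - 1 are odd. The induction uses 2^(i+1) - 1 = 1 + 2 (2^i - 1),
  -- which matches the doubling of the geometric sum.
  ^[2^i∸1]≈geometric : ∀ i A B → (A + B) ^ (2 ℕ.^ i ℕ.∸ 1) ≈ geometric (2 ℕ.^ i) A B
  ^[2^i∸1]≈geometric zero    A B = solve 0 (:1 := :1 :* :1 :+ :0) refl
  ^[2^i∸1]≈geometric (suc i) A B = begin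
    x ^ (2 ℕ.^ suc i ℕ.∸ 1)                ≡⟨ ≡.cong (x ^_) exponent ⟩
    x * x ^ (d ℕ.+ d)                      ≈⟨ *-congˡ (trans (^-homo-* x d d) (sym (^-distrib-* x x d))) ⟩
    x * (x ²) ^ d
      ≈⟨ *-congˡ (^-congˡ d (solve 2 (λ A B → (A :+ B) :* (A :+ B) := A :* A :+ B :* B) refl A B)) ⟩
    x * (A ² + B ²) ^ d                    ≈⟨ *-congˡ (^[2^i∸1]≈geometric i (A ²) (B ²)) ⟩
    x * geometric (2 ℕ.^ i) (A ²) (B ²)    ≈⟨ geometric-double (2 ℕ.^ i) A B ⟨
    geometric (2 ℕ.^ i ℕ.+ 2 ℕ.^ i) A B
      ≡⟨ ≡.cong (λ j → geometric j A B) (≡.cong (2 ℕ.^ i ℕ.+_) (ℕ.+-identityʳ (2 ℕ.^ i))) ⟨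
    geometric (2 ℕ.^ suc i) A B            ∎
    where
    x = A + B
    d = 2 ℕ.^ i ℕ.∸ 1
    exponent : 2 ℕ.^ suc i ℕ.∸ 1 ≡ suc (d ℕ.+ d)
    exponent with 2 ℕ.^ i | ℕ.m^n>0 2 i
    ... | suc n | _ = ≡.trans (ℕ.+-suc n (n ℕ.+ 0)) (≡.cong (λ j → suc (n ℕ.+ j)) (ℕ.+-identityʳ n))

  module _ (Q : ℕ) (∤Q : ¬ suc q ∣ Q) (α β : Carrier) where
    private
      ψ : Carrier → Carrier
      ψ Y = Y ^ Q * (α * Y + β * conj Y)

      r : Fin q → ℕ
      r j = q ℕ.∸ suc (toℕ j)

      coefficient : Fin q → Carrier
      coefficient j = α ^ toℕ j * β ^ r j

      exponent : Fin q → ℕ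
      exponent j = q-1 ℕ.* (suc Q ℕ.+ r j)

      r<q : ∀ j → r j ℕ.< q
      r<q j = ℕ.∸-monoʳ-< (ℕ.s≤s ℕ.z≤n) (Fin.toℕ<n j)

      j+r : ∀ j → toℕ j ℕ.+ r j ≡ q-1
      j+r j = ℕ.suc-injective (≡.trans (ℕ.m+[n∸m]≡n (Fin.toℕ<n j)) q≡)

      -- With j + r = q - 1, the exponent j + q r equals (q-1) (1 + r), so q - 1 factors out of
      -- every exponent.
      exponent≡ : ∀ j → Q ℕ.* q-1 ℕ.+ (toℕ j ℕ.+ q ℕ.* r j) ≡ exponent j
      exponent≡ j = ≡.trans (≡.cong₂ (λ n p → Q ℕ.* n ℕ.+ (toℕ j ℕ.+ p ℕ.* r j)) n≡ (≡.trans q≡ (≡.cong suc n≡)))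
        (≡.trans (identity Q (toℕ j) (r j)) (≡.cong (ℕ._* (suc Q ℕ.+ r j)) (≡.sym n≡)))
        where
        n≡ = ≡.sym (j+r j)
        identity : ∀ Q j r → Q ℕ.* (j ℕ.+ r) ℕ.+ (j ℕ.+ suc (j ℕ.+ r) ℕ.* r) ≡ (j ℕ.+ r) ℕ.* (suc Q ℕ.+ r)
        identity = solve-∀

    ψ^[q-1] : ∀ Y → ψ Y ^ q-1 ≈ ∑[ j < q ] (coefficient j * Y ^ exponent j)
    ψ^[q-1] Y = begin
      ψ Y ^ q-1                                             ≈⟨ ^-distrib-* (Y ^ Q) _ q-1 ⟩
      (Y ^ Q) ^ q-1 * (α * Y + β * conj Y) ^ q-1
        ≈⟨ *-cong (^-assocʳ Y Q q-1) (^[2^i∸1]≈geometric k (α * Y) (β * conj Y)) ⟩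
      Y ^ (Q ℕ.* q-1) * geometric q (α * Y) (β * conj Y)
        ≈⟨ *-distribˡ-sum {q} (Y ^ (Q ℕ.* q-1)) (λ j → (α * Y) ^ toℕ j * (β * conj Y) ^ r j) ⟩
      ∑[ j < q ] (Y ^ (Q ℕ.* q-1) * ((α * Y) ^ toℕ j * (β * conj Y) ^ r j)) ≈⟨ sum-cong-≋ {q} term ⟩
      ∑[ j < q ] (coefficient j * Y ^ exponent j)           ∎
      where
      term : ∀ j → Y ^ (Q ℕ.* q-1) * ((α * Y) ^ toℕ j * (β * conj Y) ^ r j) ≈ coefficient j * Y ^ exponent j
      term j = begin
        Y ^ (Q ℕ.* q-1) * ((α * Y) ^ i * (β * conj Y) ^ r j)
          ≈⟨ *-congˡ (*-cong (^-distrib-* α Y i) (trans (^-distrib-* β (conj Y) (r j)) (*-congˡ (^-assocʳ Y q (r j))))) ⟩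
        Y ^ (Q ℕ.* q-1) * (α ^ i * Y ^ i * (β ^ r j * Y ^ (q ℕ.* r j)))
          ≈⟨ solve 5 (λ x a y b z → x :* (a :* y :* (b :* z)) := a :* b :* (x :* (y :* z))) refl _ _ _ _ _ ⟩
        coefficient j * (Y ^ (Q ℕ.* q-1) * (Y ^ i * Y ^ (q ℕ.* r j)))
          ≈⟨ *-congˡ (trans (*-congˡ (sym (^-homo-* Y i _))) (sym (^-homo-* Y (Q ℕ.* q-1) _))) ⟩
        coefficient j * Y ^ (Q ℕ.* q-1 ℕ.+ (i ℕ.+ q ℕ.* r j))
          ≡⟨ ≡.cong (λ n → coefficient j * Y ^ n) (exponent≡ j) ⟩
        coefficient j * Y ^ exponent j ∎
        where i = toℕ j

    sum-single : ∀ {n} (t : Fin n → Carrier) i₀ → (∀ i → i ≢ i₀ → t i ≈ 0#) → sum t ≈ t i₀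
    sum-single {suc n} t i₀ others = begin
      sum t                            ≈⟨ sum-remove {i = i₀} t ⟩
      t i₀ + sum (t ∘ punchIn i₀)
        ≈⟨ +-congˡ (trans (sum-cong-≋ (λ i → others _ (Fin.punchInᵢ≢i i₀ i))) (sum-replicate-zero n)) ⟩
      t i₀ + 0#                        ≈⟨ +-identityʳ _ ⟩
      t i₀                             ∎

    -- Summed over K, every monomial of the expansion vanishes except the one whose exponent is
    -- (q-1) s with q + 1 dividing s. Its coefficient is a product of a power of α and a power of β,
    -- so one of them is zero.
    power-sum⇒αβ≈0 : ∑K (λ Y → ψ Y ^ q-1) ≈ 0# → α ≈ 0# ⊎ β ≈ 0#
    power-sum⇒αβ≈0 sum≈0 = Sum.map (^-≈0 (toℕ j₀)) (^-≈0 (r j₀)) (zero-product (begin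
        coefficient j₀                            ≈⟨ *-cancelʳ (∑K-multiple (suc Q ℕ.+ r j₀) divisible) (begin
          coefficient j₀ * ∑K (_^ exponent j₀)      ≈⟨ sum-single (λ j → coefficient j * ∑K (_^ exponent j)) j₀ other-terms ⟨
          ∑[ j < q ] (coefficient j * ∑K (_^ exponent j))
            ≈⟨ sum-cong-≋ {q} (λ j → *-distribˡ-sum (coefficient j) (λ i → enum i ^ exponent j)) ⟩
          ∑[ j < q ] ∑K (λ Y → coefficient j * Y ^ exponent j) ≈⟨ ∑-comm {q} (λ j i → coefficient j * enum i ^ exponent j) ⟩
          ∑K (λ Y → ∑[ j < q ] (coefficient j * Y ^ exponent j)) ≈⟨ ∑K-cong ψ^[q-1] ⟨
          ∑K (λ Y → ψ Y ^ q-1)                      ≈⟨ sum≈0 ⟩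
          0#                                        ≈⟨ zeroˡ _ ⟨
          0# * ∑K (_^ exponent j₀)                  ∎) ⟩
        0#                                        ∎))
      where
      window = multiple-in-window q Q ∤Q
      r₀<q = proj₁ (proj₂ window)
      -- `opposite`, because the exponent `r` of β decreases from q - 1 to 0 as j increases.
      j₀ : Fin q
      j₀ = opposite (fromℕ< r₀<q)
      r-j₀ : r j₀ ≡ proj₁ window
      r-j₀ = ≡.trans (≡.sym (Fin.opposite-prop j₀)) (≡.trans (≡.cong toℕ (Fin.opposite-involutive (fromℕ< r₀<q))) (Fin.toℕ-fromℕ< r₀<q))
      divisible : suc q ∣ suc Q ℕ.+ r j₀
      divisible = ≡.subst (λ i → suc q ∣ suc Q ℕ.+ i) (≡.sym r-j₀) (proj₁ (proj₂ (proj₂ window)))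
      other-terms : ∀ j → j ≢ j₀ → coefficient j * ∑K (_^ exponent j) ≈ 0#
      other-terms j j≢j₀ = trans (*-congˡ (∑K-nonmultiple (suc Q ℕ.+ r j) λ ∣r → j≢j₀ (Fin.toℕ-injective
        (ℕ.+-cancelʳ-≡ (r j) _ _ (≡.trans (j+r j) (≡.trans (≡.sym (j+r j₀)) (≡.cong (toℕ j₀ ℕ.+_)
          (≡.trans r-j₀ (≡.sym (proj₂ (proj₂ (proj₂ window)) (r<q j) ∣r)))))))))) (zeroʳ _)

-- Arithmetic of the exponents ℓ and u

even⊎odd : ∀ n → ∃[ j ] (n ≡ j ℕ.+ j ⊎ n ≡ suc (j ℕ.+ j))
even⊎odd zero    = 0 , inj₁ ≡.refl
even⊎odd (suc n) with even⊎odd n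
... | j , inj₁ even = j , inj₂ (≡.cong suc even)
... | j , inj₂ odd  = suc j , inj₁ (≡.trans (≡.cong suc odd) (≡.cong suc (≡.sym (ℕ.+-suc j j))))

coprime-to-even⇒odd : ∀ k ℓ → gcd (2 ℕ.* k) ℓ ≡ 1 → ∃[ j ] ℓ ≡ suc (j ℕ.+ j)
coprime-to-even⇒odd k ℓ coprime with even⊎odd ℓ
... | j , inj₂ odd  = j , odd
... | j , inj₁ even = contradiction (ℕ.∣1⇒≡1 (≡.subst (2 ∣_) coprime (gcd-greatest (ℕ.m∣m*n k) 2∣ℓ))) λ ()
  where
  2∣ℓ : 2 ∣ ℓ
  2∣ℓ = divides j (≡.trans even (≡.trans (≡.cong (j ℕ.+_) (≡.sym (ℕ.+-identityʳ j))) (ℕ.*-comm 2 j)))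

suc-^ : ∀ p n → ∃[ t ] suc p ℕ.^ n ≡ suc (p ℕ.* t)
suc-^ p zero    = 0 , ≡.cong suc (≡.sym (ℕ.*-zeroʳ p))
suc-^ p (suc n) with suc-^ p n
... | t , eq = suc p ℕ.* t ℕ.+ 1 , ≡.trans (≡.cong (suc p ℕ.*_) eq) (identity p t)
  where
  identity : ∀ p t → suc p ℕ.* suc (p ℕ.* t) ≡ suc (p ℕ.* (suc p ℕ.* t ℕ.+ 1))
  identity = solve-∀

2^∸1 : ∀ ℓ → suc (2 ℕ.^ ℓ ℕ.∸ 1) ≡ 2 ℕ.^ ℓ
2^∸1 ℓ = ℕ.m+[n∸m]≡n (ℕ.m^n>0 2 ℓ)

-- The only property of u that is used: W times the u-th power of W^(Q-1) is W^(Q^(k+1)).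
suc[[Q-1]*u]≡Q^[k+1] : ∀ k ℓ .{{_ : NonZero ℓ}} →
  suc ((2 ℕ.^ ℓ ℕ.∸ 1) ℕ.* exponent-u k ℓ) ≡ (2 ℕ.^ ℓ) ℕ.^ (k ℕ.+ 1)
suc[[Q-1]*u]≡Q^[k+1] k ℓ =
  ≡.trans (≡.cong suc (m*[n/m]≡n {{2^ℓ∸1≢0 ℓ}} (divides t Q^∸1≡)))
    (ℕ.m+[n∸m]≡n (ℕ.m^n>0 (2 ℕ.^ ℓ) {{ℕ.m^n≢0 2 ℓ}} (k ℕ.+ 1)))
  where
  p = 2 ℕ.^ ℓ ℕ.∸ 1
  t = proj₁ (suc-^ p (k ℕ.+ 1))
  Q^∸1≡ : (2 ℕ.^ ℓ) ℕ.^ (k ℕ.+ 1) ℕ.∸ 1 ≡ t ℕ.* p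
  Q^∸1≡ = ≡.trans (≡.cong (λ n → n ℕ.^ (k ℕ.+ 1) ℕ.∸ 1) (≡.sym (2^∸1 ℓ)))
    (≡.trans (≡.cong (ℕ._∸ 1) (proj₂ (suc-^ p (k ℕ.+ 1)))) (ℕ.*-comm p t))

-- The substitution X = W^(Q-1) and the action on 𝔽_q-lines

module CoprimeFrobenius {c e} (K : Field c e) (k ℓ : ℕ) .{{_ : NonZero k}} .{{_ : NonZero ℓ}}
                        .{{_ : NonZero (2 ℕ.* k)}}
                        (order : HasOrder (Field.setoid K) (2 ℕ.^ (2 ℕ.* k)))
                        (coprime : gcd (2 ℕ.* k) ℓ ≡ 1) where
  open QuadraticExtension K {k = k} order public
  open SetoidReasoning setoid

  Q Q-1 : ℕ
  Q = 2 ℕ.^ ℓ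
  Q-1 = Q ℕ.∸ 1

  σ : Carrier → Carrier
  σ = Fr ℓ

  ℓ-odd : ∃[ j ] ℓ ≡ suc (j ℕ.+ j)
  ℓ-odd = coprime-to-even⇒odd k ℓ coprime

  σ-fixed⇒idempotent : ∀ {x} → σ x ≈ x → x ² ≈ x
  σ-fixed⇒idempotent {x} fix =
    fixed-1⇒idempotent (≡.subst (λ i → Fixed i x) coprime (fixed-gcd (2 ℕ.* k) ℓ (fixed-order x) fix))

  -- Doubling both exponents keeps the coprimality usable: gcd(4k, 2ℓ) = 2, so such an x lies in 𝔽₄.
  σσ-fixed⇒fixed-2 : ∀ {x} → σ (σ x) ≈ x → Fixed 2 x
  σσ-fixed⇒fixed-2 {x} fix = ≡.subst (λ i → Fixed i x)
    (≡.trans (≡.sym (c*gcd[m,n]≡gcd[cm,cn] 2 (2 ℕ.* k) ℓ)) (≡.cong (2 ℕ.*_) coprime))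
    (fixed-gcd (2 ℕ.* (2 ℕ.* k)) (2 ℕ.* ℓ) (fixed-*-multiple 2 (2 ℕ.* k) (fixed-order x))
      (trans (sym (Fr-∘ ℓ (ℓ ℕ.+ 0) x)) (trans (Fr-cong ℓ (^-congʳ x (≡.cong (2 ℕ.^_) (ℕ.+-identityʳ ℓ)))) fix)))

  conj-σ : ∀ x → conj (σ x) ≈ σ (conj x)
  conj-σ = Fr-comm k ℓ

  -- As ℓ is odd, ℓ k is congruent to k modulo 2k, and 2k Frobenius steps are the identity.
  ^Q^k≈conj : ∀ x → x ^ (Q ℕ.^ k) ≈ conj x
  ^Q^k≈conj x = begin
    x ^ (Q ℕ.^ k)                    ≡⟨ ≡.cong (x ^_) (≡.trans (ℕ.^-*-assoc 2 ℓ k) (≡.cong (2 ℕ.^_) ℓk≡)) ⟩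
    Fr (k ℕ.+ j ℕ.* (2 ℕ.* k)) x     ≈⟨ Fr-∘ k _ x ⟨
    conj (Fr (j ℕ.* (2 ℕ.* k)) x)    ≈⟨ Fr-cong k (fixed-*-multiple j (2 ℕ.* k) (fixed-order x)) ⟩
    conj x                           ∎
    where
    j = proj₁ ℓ-odd
    identity : ∀ j k → suc (j ℕ.+ j) ℕ.* k ≡ k ℕ.+ j ℕ.* (2 ℕ.* k)
    identity = solve-∀
    ℓk≡ : ℓ ℕ.* k ≡ k ℕ.+ j ℕ.* (2 ℕ.* k)
    ℓk≡ = ≡.trans (≡.cong (ℕ._* k) (proj₂ ℓ-odd)) (identity j k)

  ψ : Carrier → Carrier
  ψ W = W ^ Q-1

  W*ψW≈σW : ∀ W → W * ψ W ≈ σ W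
  W*ψW≈σW W = ^-congʳ W (2^∸1 ℓ)

  ψ-cong : ∀ {V W} → V ≈ W → ψ V ≈ ψ W
  ψ-cong = ^-congˡ Q-1

  instance
    Q-1-nonZero : NonZero Q-1
    Q-1-nonZero = 2^ℓ∸1≢0 ℓ

  -- The quotient V / W is fixed by σ, hence lies in 𝔽₂; being nonzero it is 1.
  σ-ratio : ∀ {V W} → V ≉ 0# → W ≉ 0# → σ V * W ≈ V * σ W → V ≈ W
  σ-ratio {V} {W} V≉0 W≉0 eq = [ (λ x≈0 → contradiction x≈0 x≉0) , x≈1⇒ ]′ (idempotent⇒0∨1 (σ-fixed⇒idempotent σx≈x))
    where
    x = W ⁻¹ * V
    x≉0 = *-≉0 (⁻¹-≉0 W≉0) V≉0
    Wx≈V : W * x ≈ V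
    Wx≈V = cancel-⁻¹ʳ V W≉0
    σx≈x : σ x ≈ x
    σx≈x = *-cancelˡ (*-≉0 W≉0 (Fr-≉0 ℓ W≉0)) (begin
      W * σ W * σ x    ≈⟨ *-assoc W _ _ ⟩
      W * (σ W * σ x)  ≈⟨ *-congˡ (Fr-* ℓ W x) ⟨
      W * σ (W * x)    ≈⟨ *-congˡ (Fr-cong ℓ Wx≈V) ⟩
      W * σ V          ≈⟨ trans (*-comm W _) eq ⟩
      V * σ W          ≈⟨ *-congʳ Wx≈V ⟨
      W * x * σ W      ≈⟨ solve 3 (λ w x s → w :* x :* s := w :* s :* x) refl W x (σ W) ⟩
      W * σ W * x      ∎)
    x≈1⇒ : x ≈ 1# → V ≈ W
    x≈1⇒ x≈1 = trans (sym Wx≈V) (trans (*-congˡ x≈1) (*-identityʳ W))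

  ψ-injective : Injective _≈_ _≈_ ψ
  ψ-injective {V} {W} eq with ≈-dec V 0# | ≈-dec W 0#
  ... | yes V≈0 | _ = trans V≈0 (sym (^-≈0 Q-1 (trans (sym eq) (trans (ψ-cong V≈0) (0^ Q-1)))))
  ... | no  V≉0 | yes W≈0 = contradiction (^-≈0 Q-1 (trans eq (trans (ψ-cong W≈0) (0^ Q-1)))) V≉0
  ... | no  V≉0 | no  W≉0 = σ-ratio V≉0 W≉0 (begin
    σ V * W          ≈⟨ *-congʳ (W*ψW≈σW V) ⟨
    V * ψ V * W      ≈⟨ *-congʳ (*-congˡ eq) ⟩
    V * ψ W * W      ≈⟨ solve 3 (λ v p w → v :* p :* w := v :* (w :* p)) refl V (ψ W) W ⟩
    V * (W * ψ W)    ≈⟨ *-congˡ (W*ψW≈σW W) ⟩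
    V * σ W          ∎)

  ψ-surjective : ∀ X → ∃[ W ] ψ W ≈ X
  ψ-surjective X = let W , hit = proj₂ (injective⇒bijective ψ-cong ψ-injective) X in W , hit refl

  u : ℕ
  u = exponent-u k ℓ

  instance
    u-nonZero : NonZero u
    u-nonZero = ℕ.≢-nonZero λ u≡0 → ℕ.<-irrefl ≡.refl (≡.subst (1 ℕ.<_)
      (≡.trans (≡.sym (suc[[Q-1]*u]≡Q^[k+1] k ℓ)) (≡.cong suc (≡.trans (≡.cong (Q-1 ℕ.*_) u≡0) (ℕ.*-zeroʳ Q-1))))
      (ℕ.^-monoʳ-< Q (ℕ.^-monoʳ-< 2 (ℕ.s≤s (ℕ.s≤s ℕ.z≤n)) (ℕ.>-nonZero⁻¹ ℓ)) (ℕ.m≤n+m 1 k)))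

  W*ψW^u≈σW̄ : ∀ W → W * ψ W ^ u ≈ σ (conj W)
  W*ψW^u≈σW̄ W = begin
    W * ψ W ^ u              ≈⟨ *-congˡ (^-assocʳ W Q-1 u) ⟩
    W ^ suc (Q-1 ℕ.* u)
      ≡⟨ ≡.cong (W ^_) (≡.trans (suc[[Q-1]*u]≡Q^[k+1] k ℓ) (≡.trans (ℕ.^-distribˡ-+-* Q k 1) (≡.cong (Q ℕ.^ k ℕ.*_) (ℕ.*-identityʳ Q)))) ⟩
    W ^ (Q ℕ.^ k ℕ.* Q)      ≈⟨ ^-assocʳ W (Q ℕ.^ k) Q ⟨
    (W ^ (Q ℕ.^ k)) ^ Q      ≈⟨ Fr-cong ℓ (^Q^k≈conj W) ⟩
    σ (conj W)               ∎

  N : Carrier → Carrier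
  N W = W * conj W

  N-≉0 : ∀ {W} → W ≉ 0# → N W ≉ 0#
  N-≉0 W≉0 = *-≉0 W≉0 (Fr-≉0 k W≉0)

  conj-N : ∀ W → conj (N W) ≈ N W
  conj-N W = trans (Fr-* k W (conj W)) (trans (*-congˡ (conj-conj W)) (*-comm _ _))

  module Quadrinomial (a b : Carrier) where
    f : Carrier → Carrier
    f X = X + b * X ^ q + a * X ^ u

    P : Carrier → Carrier
    P W = σ W * conj W + b * (W * σ (conj W)) + a * (σ (conj W) * conj W)

    f-cong : ∀ {X Y} → X ≈ Y → f X ≈ f Y
    f-cong eq = +-cong (+-cong eq (*-congˡ (Fr-cong k eq))) (*-congˡ (^-congˡ u eq))

    P-cong : ∀ {V W} → V ≈ W → P V ≈ P W
    P-cong eq = +-cong (+-cong (*-cong (Fr-cong ℓ eq) eq̄) (*-congˡ (*-cong eq (Fr-cong ℓ eq̄)))) (*-congˡ (*-cong (Fr-cong ℓ eq̄) eq̄))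
      where eq̄ = Fr-cong k eq

    f-0 : f 0# ≈ 0#
    f-0 = trans (+-cong (+-congˡ (*-congˡ (Fr-0 k))) (*-congˡ (0^ u)))
      (solve 2 (λ b a → :0 :+ b :* :0 :+ a :* :0 := :0) refl b a)

    f∘ψ*N≈P : ∀ W → f (ψ W) * N W ≈ P W
    f∘ψ*N≈P W = begin
      f X * (W * W̄)
        ≈⟨ solve 7 (λ X Y Z b a W V → (X :+ b :* Y :+ a :* Z) :* (W :* V)
             := W :* X :* V :+ b :* (W :* (V :* Y)) :+ a :* (W :* Z :* V)) refl X (X ^ q) (X ^ u) b a W W̄ ⟩
      W * X * W̄ + b * (W * (W̄ * conj X)) + a * (W * X ^ u * W̄)
        ≈⟨ +-cong (+-cong (*-congʳ (W*ψW≈σW W)) (*-congˡ (*-congˡ conj-part))) (*-congˡ (*-congʳ (W*ψW^u≈σW̄ W))) ⟩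
      P W ∎
      where
      X = ψ W
      W̄ = conj W
      conj-part : W̄ * conj X ≈ σ W̄
      conj-part = trans (sym (Fr-* k W X)) (trans (Fr-cong k (W*ψW≈σW W)) (conj-σ W))

    conj-P : conj b ≈ b → ∀ W → conj (P W) ≈ σ (conj W) * W + b * (conj W * σ W) + conj a * (σ W * W)
    conj-P b-real W = begin
      conj (P W)
        ≈⟨ trans (Fr-+ k _ _) (+-cong (trans (Fr-+ k _ _) (+-cong (Fr-* k _ _)
             (trans (Fr-* k _ _) (*-cong b-real (Fr-* k _ _))))) (trans (Fr-* k _ _) (*-congˡ (Fr-* k _ _)))) ⟩
      conj (σ W) * conj (conj W) + b * (conj W * conj (σ (conj W))) + conj a * (conj (σ (conj W)) * conj (conj W))
        ≈⟨ +-cong (+-cong (*-cong (conj-σ W) (conj-conj W)) (*-congˡ (*-congˡ σ̄)))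
             (*-congˡ (*-cong σ̄ (conj-conj W))) ⟩
      σ (conj W) * W + b * (conj W * σ W) + conj a * (σ W * W) ∎
      where
      σ̄ : conj (σ (conj W)) ≈ σ W
      σ̄ = trans (conj-σ (conj W)) (Fr-cong ℓ (conj-conj W))

    -- Together with `N-homogeneous`: a real scalar ν multiplies f (ψ W) by ν^(Q-1), and this power
    -- map is injective. So along an 𝔽_q-line f is controlled by its value at one point.
    P-homogeneous : ∀ {ν} W → conj ν ≈ ν → P (ν * W) ≈ σ ν * ν * P W
    P-homogeneous {ν} W ν-real = trans
      (+-cong (+-cong (*-cong σνW νW̄) (*-congˡ (*-congˡ σνW̄))) (*-congˡ (*-cong σνW̄ νW̄)))
      (solve 8 (λ s n S W T V b a → s :* S :* (n :* V) :+ b :* (n :* W :* (s :* T)) :+ a :* (s :* T :* (n :* V))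
         := s :* n :* (S :* V :+ b :* (W :* T) :+ a :* (T :* V))) refl (σ ν) ν (σ W) W (σ (conj W)) (conj W) b a)
      where
      νW̄ : conj (ν * W) ≈ ν * conj W
      νW̄ = trans (Fr-* k ν W) (*-congʳ ν-real)
      σνW = Fr-* ℓ ν W
      σνW̄ = trans (Fr-cong ℓ νW̄) (Fr-* ℓ ν (conj W))

    N-homogeneous : ∀ {ν} W → conj ν ≈ ν → N (ν * W) ≈ ν * ν * N W
    N-homogeneous {ν} W ν-real = trans (*-congˡ (trans (Fr-* k ν W) (*-congʳ ν-real)))
      (solve 3 (λ n W V → n :* W :* (n :* V) := n :* n :* (W :* V)) refl ν W (conj W))

    module Injective⇒ (f-inj : Injective _≈_ _≈_ f) where
      P-≉0 : ∀ {W} → W ≉ 0# → P W ≉ 0#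
      P-≉0 {W} W≉0 PW≈0 = ^-≉0 Q-1 W≉0 (f-inj (trans
        (no-zero-divisorʳ (N-≉0 W≉0) (trans (*-comm _ _) (trans (f∘ψ*N≈P W) PW≈0))) (sym f-0)))

      -- The hypothesis puts P V and P W on one 𝔽_q-line. Hence ρ = f (ψ W) / f (ψ V) is real, ρ =
      -- ν^(Q-1) with ν real, and homogeneity yields f (ψ (ν V)) = f (ψ W), so W = ν V.
      P-projectively-injective : ∀ {V W} → V ≉ 0# → W ≉ 0# → P V * conj (P W) ≈ conj (P V) * P W →
                                 V * conj W ≈ conj V * W
      P-projectively-injective {V} {W} V≉0 W≉0 eq = begin
        V * conj W           ≈⟨ *-congˡ (Fr-cong k νV≈W) ⟨
        V * conj (ν * V)     ≈⟨ *-congˡ (trans (Fr-* k ν V) (*-congʳ ν-real)) ⟩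
        V * (ν * conj V)     ≈⟨ solve 3 (λ v n w → v :* (n :* w) := w :* (n :* v)) refl V ν (conj V) ⟩
        conj V * (ν * V)     ≈⟨ *-congˡ νV≈W ⟩
        conj V * W           ∎
        where
        num = N V * P W
        den = N W * P V
        num≉0 = *-≉0 (N-≉0 V≉0) (P-≉0 W≉0)
        den≉0 = *-≉0 (N-≉0 W≉0) (P-≉0 V≉0)
        ρ = den ⁻¹ * num
        den*ρ : den * ρ ≈ num
        den*ρ = cancel-⁻¹ʳ num den≉0
        ρ-real : conj ρ ≈ ρ
        ρ-real = *-cancelˡ (*-≉0 den≉0 (Fr-≉0 k den≉0)) (begin
          den * conj den * conj ρ            ≈⟨ trans (*-assoc _ _ _) (*-congˡ (sym (Fr-* k den ρ))) ⟩
          den * conj (den * ρ)               ≈⟨ *-congˡ (Fr-cong k den*ρ) ⟩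
          den * conj num                     ≈⟨ *-congˡ (trans (Fr-* k (N V) (P W)) (*-congʳ (conj-N V))) ⟩
          N W * P V * (N V * conj (P W))
            ≈⟨ solve 4 (λ x y z w → x :* y :* (z :* w) := x :* z :* (y :* w)) refl (N W) (P V) (N V) _ ⟩
          N W * N V * (P V * conj (P W))     ≈⟨ *-congˡ eq ⟩
          N W * N V * (conj (P V) * P W)
            ≈⟨ solve 4 (λ x z y w → x :* z :* (y :* w) := x :* y :* (z :* w)) refl (N W) (N V) _ (P W) ⟩
          N W * conj (P V) * num             ≈⟨ *-congʳ (trans (Fr-* k (N W) (P V)) (*-congʳ (conj-N W))) ⟨
          conj den * num                     ≈⟨ *-congˡ den*ρ ⟨
          conj den * (den * ρ)               ≈⟨ solve 3 (λ x y z → x :* (y :* z) := y :* x :* z) refl (conj den) den ρ ⟩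
          den * conj den * ρ                 ∎)
        ν = proj₁ (ψ-surjective ρ)
        ψν≈ρ = proj₂ (ψ-surjective ρ)
        ν≉0 : ν ≉ 0#
        ν≉0 ν≈0 = *-≉0 (⁻¹-≉0 den≉0) num≉0 (trans (sym ψν≈ρ) (trans (ψ-cong ν≈0) (0^ Q-1)))
        ν-real : conj ν ≈ ν
        ν-real = ψ-injective (trans (trans (^-assocʳ ν q Q-1) (trans (^-congʳ ν (ℕ.*-comm q Q-1)) (sym (^-assocʳ ν Q-1 q))))
          (trans (Fr-cong k ψν≈ρ) (trans ρ-real (sym ψν≈ρ))))
        F = f (ψ (ν * V))
        F*NV : F * N V ≈ ρ * P V
        F*NV = *-cancelˡ (*-≉0 ν≉0 ν≉0) (begin
          ν * ν * (F * N V)           ≈⟨ solve 3 (λ n F m → n :* n :* (F :* m) := F :* (n :* n :* m)) refl ν F (N V) ⟩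
          F * (ν * ν * N V)           ≈⟨ *-congˡ (N-homogeneous V ν-real) ⟨
          F * N (ν * V)               ≈⟨ f∘ψ*N≈P (ν * V) ⟩
          P (ν * V)                   ≈⟨ P-homogeneous V ν-real ⟩
          σ ν * ν * P V               ≈⟨ *-congʳ (*-congʳ (trans (*-congˡ (sym ψν≈ρ)) (W*ψW≈σW ν))) ⟨
          ν * ρ * ν * P V             ≈⟨ solve 3 (λ n r p → n :* r :* n :* p := n :* n :* (r :* p)) refl ν ρ (P V) ⟩
          ν * ν * (ρ * P V)           ∎)
        νV≈W : ν * V ≈ W
        νV≈W = ψ-injective (f-inj (*-cancelʳ (N-≉0 W≉0) (*-cancelʳ (*-≉0 (N-≉0 V≉0) (P-≉0 V≉0)) (begin
          F * N W * (N V * P V)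
            ≈⟨ solve 4 (λ F m n p → F :* m :* (n :* p) := F :* n :* (m :* p)) refl F (N W) (N V) (P V) ⟩
          F * N V * den               ≈⟨ *-congʳ F*NV ⟩
          ρ * P V * den               ≈⟨ solve 3 (λ r p d → r :* p :* d := d :* r :* p) refl ρ (P V) den ⟩
          den * ρ * P V               ≈⟨ *-congʳ den*ρ ⟩
          N V * P W * P V             ≈⟨ solve 3 (λ n w p → n :* w :* p := w :* (n :* p)) refl (N V) (P W) (P V) ⟩
          P W * (N V * P V)           ≈⟨ *-congʳ (f∘ψ*N≈P W) ⟨
          f (ψ W) * N W * (N V * P V) ∎))))

    -- Equality of f at ψ V and ψ W is exactly `P V * N W ≈ P W * N V`. The second hypothesis then
    -- gives W = ν V with ν real, and homogeneity forces σ ν = ν, so ν = 1.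
    permutes : (∀ {W} → W ≉ 0# → P W ≉ 0#) →
               (∀ {V W} → V ≉ 0# → W ≉ 0# → P V * N W ≈ P W * N V → V * conj W ≈ conj V * W) →
               Bijective _≈_ _≈_ f
    permutes P-≉0 P-inj = injective⇒bijective f-cong λ {X} {Y} fX≈fY →
      let V , ψV≈X = ψ-surjective X
          W , ψW≈Y = ψ-surjective Y
      in trans (sym ψV≈X) (trans (ψ-cong (same V W (trans (f-cong ψV≈X) (trans fX≈fY (f-cong (sym ψW≈Y)))))) ψW≈Y)
      where
      f∘ψ-≉0 : ∀ {W} → W ≉ 0# → f (ψ W) ≉ 0#
      f∘ψ-≉0 {W} W≉0 eq = P-≉0 W≉0 (trans (sym (f∘ψ*N≈P W)) (trans (*-congʳ eq) (zeroˡ _)))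

      f∘ψ-≈0 : ∀ {W} → W ≈ 0# → f (ψ W) ≈ 0#
      f∘ψ-≈0 W≈0 = trans (f-cong (trans (ψ-cong W≈0) (0^ Q-1))) f-0

      same : ∀ V W → f (ψ V) ≈ f (ψ W) → V ≈ W
      same V W eq with ≈-dec V 0# | ≈-dec W 0#
      ... | yes V≈0 | yes W≈0 = trans V≈0 (sym W≈0)
      ... | yes V≈0 | no  W≉0 = contradiction (trans (sym eq) (f∘ψ-≈0 V≈0)) (f∘ψ-≉0 W≉0)
      ... | no  V≉0 | yes W≈0 = contradiction (trans eq (f∘ψ-≈0 W≈0)) (f∘ψ-≉0 V≉0)
      ... | no  V≉0 | no  W≉0 = ν≈1⇒ ([ (λ ν≈0 → contradiction ν≈0 ν≉0) , id ]′ (idempotent⇒0∨1 (σ-fixed⇒idempotent σν≈ν)))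
        where
        ν = V ⁻¹ * W
        ν≉0 = *-≉0 (⁻¹-≉0 V≉0) W≉0
        Vν≈W : V * ν ≈ W
        Vν≈W = cancel-⁻¹ʳ W V≉0
        PV*NW : P V * N W ≈ P W * N V
        PV*NW = begin
          P V * N W              ≈⟨ *-congʳ (f∘ψ*N≈P V) ⟨
          f (ψ V) * N V * N W    ≈⟨ *-congʳ (*-congʳ eq) ⟩
          f (ψ W) * N V * N W    ≈⟨ solve 3 (λ x y z → x :* y :* z := x :* z :* y) refl _ (N V) (N W) ⟩
          f (ψ W) * N W * N V    ≈⟨ *-congʳ (f∘ψ*N≈P W) ⟩
          P W * N V              ∎
        ν-real : conj ν ≈ ν
        ν-real = *-cancelˡ (N-≉0 V≉0) (begin
          V * conj V * conj ν    ≈⟨ *-assoc V _ _ ⟩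
          V * (conj V * conj ν)  ≈⟨ *-congˡ (trans (sym (Fr-* k V ν)) (Fr-cong k Vν≈W)) ⟩
          V * conj W             ≈⟨ P-inj V≉0 W≉0 PV*NW ⟩
          conj V * W             ≈⟨ *-congˡ Vν≈W ⟨
          conj V * (V * ν)       ≈⟨ solve 3 (λ x y z → x :* (y :* z) := y :* x :* z) refl (conj V) V ν ⟩
          V * conj V * ν         ∎)
        νV≈W : ν * V ≈ W
        νV≈W = trans (*-comm ν V) Vν≈W
        σν≈ν : σ ν ≈ ν
        σν≈ν = *-cancelˡ (*-≉0 ν≉0 (*-≉0 (P-≉0 V≉0) (N-≉0 V≉0))) (begin
          ν * (P V * N V) * σ ν   ≈⟨ solve 4 (λ n p m s → n :* (p :* m) :* s := s :* n :* p :* m) refl ν (P V) (N V) (σ ν) ⟩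
          σ ν * ν * P V * N V     ≈⟨ *-congʳ (P-homogeneous V ν-real) ⟨
          P (ν * V) * N V         ≈⟨ *-congʳ (P-cong νV≈W) ⟩
          P W * N V               ≈⟨ PV*NW ⟨
          P V * N W               ≈⟨ *-congˡ (*-cong νV≈W (Fr-cong k νV≈W)) ⟨
          P V * N (ν * V)         ≈⟨ *-congˡ (N-homogeneous V ν-real) ⟩
          P V * (ν * ν * N V)     ≈⟨ solve 3 (λ n p m → p :* (n :* n :* m) := n :* (p :* m) :* n) refl ν (P V) (N V) ⟩
          ν * (P V * N V) * ν     ∎)
        ν≈1⇒ : ν ≈ 1# → V ≈ W
        ν≈1⇒ ν≈1 = trans (sym (*-identityʳ V)) (trans (*-congˡ (sym ν≈1)) Vν≈W)

-- Necessity: a permutation forces a in 𝔽_q and produces λ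

module PermutesForcesShape {c e} (K : Field c e) (k ℓ : ℕ) .{{_ : NonZero k}} .{{_ : NonZero ℓ}}
         .{{_ : NonZero (2 ℕ.* k)}} (order : HasOrder (Field.setoid K) (2 ℕ.^ (2 ℕ.* k)))
         (coprime : gcd (2 ℕ.* k) ℓ ≡ 1) where
  open CoprimeFrobenius K k ℓ order coprime
  open SetoidReasoning setoid

  sqrt : ∀ x → ∃[ y ] y ² ≈ x
  sqrt x = let y , y^2≈x = Fr-surjective 1 x in y , trans (sym (*-congˡ (*-identityʳ y))) y^2≈x

  -- Hilbert 90 made explicit by characteristic 2: the square root W of t also has norm 1, so t W̄ =
  -- W² W̄ = W.
  unit-norm-quotient : ∀ {t} → N t ≈ 1# → ∃[ W ] W ≉ 0# × W ≈ t * conj W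
  unit-norm-quotient {t} Nt≈1 = W , W≉0 , sym (begin
    t * conj W           ≈⟨ *-congʳ W²≈t ⟨
    W * W * conj W       ≈⟨ *-assoc W W _ ⟩
    W * N W              ≈⟨ *-congˡ NW≈1 ⟩
    W * 1#               ≈⟨ *-identityʳ W ⟩
    W                    ∎)
    where
    W = proj₁ (sqrt t)
    W²≈t = proj₂ (sqrt t)
    NW≈1 : N W ≈ 1#
    NW≈1 = ²-injective (begin
      N W * N W                    ≈⟨ solve 2 (λ w v → w :* v :* (w :* v) := w :* w :* (v :* v)) refl W (conj W) ⟩
      W * W * (conj W * conj W)    ≈⟨ *-cong W²≈t (trans (sym (Fr-* k W W)) (Fr-cong k W²≈t)) ⟩
      N t                          ≈⟨ Nt≈1 ⟩
      1#                           ≈⟨ *-identityʳ 1# ⟨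
      1# * 1#                      ∎)
    W≉0 : W ≉ 0#
    W≉0 = factor-≉0ˡ (≉0-resp (sym NW≈1) 1≉0)

  conj-invariant⇒Tr≈0 : ∀ {x} → conj x ≈ x → Tr (2 ℕ.* k) x ≈ 0#
  conj-invariant⇒Tr≈0 {x} fix = trans (reflexive (≡.cong (λ i → Tr (k ℕ.+ i) x) (ℕ.+-identityʳ k))) (Tr-double k fix)

  real^[q-1]≈1 : ∀ {x} → x ≉ 0# → conj x ≈ x → x ^ q-1 ≈ 1#
  real^[q-1]≈1 {x} x≉0 fix = *-cancelˡ x≉0 (trans (sym (conj≈*^[q-1] x)) (trans fix (sym (*-identityʳ x))))

  module _ (a b : Carrier) (a≉0 : a ≉ 0#) (b≉0 : b ≉ 0#) (b-real : conj b ≈ b) where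
    open Quadrinomial a b

    ā m : Carrier
    ā = conj a
    m = b ² + 1# + a * ā

    ā≉0 : ā ≉ 0#
    ā≉0 = Fr-≉0 k a≉0

    m-real : conj m ≈ m
    m-real = begin
      conj (b ² + 1# + a * ā)              ≈⟨ trans (Fr-+ k _ _) (+-congʳ (Fr-+ k _ _)) ⟩
      conj (b ²) + conj 1# + conj (a * ā)
        ≈⟨ +-cong (+-cong (trans (Fr-* k b b) (*-cong b-real b-real)) (Fr-1 k)) (conj-N a) ⟩
      m                                    ∎

    module Root (t : Carrier) (root : ā * (σ t * σ t) + m * σ t + a ≈ 0#) (f-inj : Injective _≈_ _≈_ f) where
      open Injective⇒ f-inj

      T S d : Carrier
      T = σ t
      S = b ² + 1# + ā * T
      d = ā * T + 1#

      -- For any T the two sides differ by the quadratic at T times W̄ W̄^Q, so the root equation is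
      -- what makes the combination a product.
      factorisation : ∀ W → b * conj (P W) + d * P W ≈ σ (W + t * conj W) * (b * ā * W + S * conj W)
      factorisation W = begin
        b * conj (P W) + d * P W
          ≈⟨ +-congʳ (*-congˡ (conj-P b-real W)) ⟩
        b * (σ V * W + b * (V * σ W) + ā * (σ W * W)) + d * P W
          ≈⟨ solve 8 (λ W V X Y b a A T →
               b :* (Y :* W :+ b :* (V :* X) :+ A :* (X :* W)) :+ (A :* T :+ :1) :* (X :* V :+ b :* (W :* Y) :+ a :* (Y :* V))
               := (X :+ T :* Y) :* (b :* A :* W :+ (b :* b :+ :1 :+ A :* T) :* V)
                  :+ (A :* (T :* T) :+ (b :* b :+ :1 :+ a :* A) :* T :+ a) :* (V :* Y)) refl W V (σ W) (σ V) b a ā T ⟩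
        (σ W + T * σ V) * (b * ā * W + S * V) + (ā * (T * T) + m * T + a) * (V * σ V)
          ≈⟨ +-cong (*-congʳ (trans (Fr-+ ℓ _ _) (+-congˡ (Fr-* ℓ t V)))) (sym (trans (*-congʳ root) (zeroˡ _))) ⟨
        σ (W + t * V) * (b * ā * W + S * V) + 0#
          ≈⟨ +-identityʳ _ ⟩
        σ (W + t * V) * (b * ā * W + S * V) ∎
        where V = conj W

      -- For s = S / (b ā) also N s = 1, so each factor vanishes on an 𝔽_q-line. On both lines b P̄
      -- = d P, so P sends them to the same line, and projective injectivity gives s = t.
      split : N T ≈ 1# → S ≈ b * ā * t
      split NT≈1 = begin
        S               ≈⟨ *-identityʳ S ⟨
        S * 1#          ≈⟨ *-congˡ (*-inverseʳ (b * ā) bā≉0) ⟨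
        S * (b * ā * (b * ā) ⁻¹) ≈⟨ solve 3 (λ s x i → s :* (x :* i) := x :* (s :* i)) refl S (b * ā) _ ⟩
        b * ā * s       ≈⟨ *-congˡ s≈t ⟩
        b * ā * t       ∎
        where
        bā≉0 = *-≉0 b≉0 ā≉0
        s = S * (b * ā) ⁻¹
        bās≈S : b * ā * s ≈ S
        bās≈S = trans (*-congˡ (*-comm S _)) (cancel-⁻¹ʳ S bā≉0)
        Nt≈1 : N t ≈ 1#
        Nt≈1 = Fr-injective ℓ (trans (Fr-* ℓ t (conj t)) (trans (*-congˡ (sym (conj-σ t))) (trans NT≈1 (sym (Fr-1 ℓ)))))
        T̄ = conj T
        conj-S : conj S ≈ b ² + 1# + a * T̄
        conj-S = trans (Fr-+ k _ _) (+-cong (trans (Fr-+ k _ _) (+-cong (trans (Fr-* k b b) (*-cong b-real b-real)) (Fr-1 k)))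
          (trans (Fr-* k ā T) (*-congʳ (conj-conj a))))
        -- This holds only modulo two relations; the solver identity writes the difference as a
        -- combination of the quadratic at T and N T + 1.
        NS : N S ≈ b * b * (a * ā)
        NS = trans (*-congˡ conj-S) (+≈0⇒≈ (begin
          S * (b ² + 1# + a * T̄) + b * b * (a * ā)
            ≈⟨ solve 5 (λ b a A T U → (b :* b :+ :1 :+ A :* T) :* (b :* b :+ :1 :+ a :* U) :+ b :* b :* (a :* A)
                 := (b :* b :+ :1) :* (U :* (A :* (T :* T) :+ (b :* b :+ :1 :+ a :* A) :* T :+ a))
                    :+ (T :* U :+ :1) :* ((b :* b :+ :1) :* (A :* T :+ (b :* b :+ :1 :+ a :* A)) :+ a :* A)) refl b a ā T T̄ ⟩
          (b ² + 1#) * (T̄ * (ā * (T * T) + m * T + a)) + (T * T̄ + 1#) * ((b ² + 1#) * (ā * T + m) + a * ā)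
            ≈⟨ +-cong (*-congˡ (*-congˡ root)) (*-congʳ (≈⇒+≈0 NT≈1)) ⟩
          (b ² + 1#) * (T̄ * 0#) + 0# * ((b ² + 1#) * (ā * T + m) + a * ā)
            ≈⟨ solve 3 (λ x y z → x :* (y :* :0) :+ :0 :* z := :0) refl _ _ _ ⟩
          0# ∎))
        Ns≈1 : N s ≈ 1#
        Ns≈1 = *-cancelˡ (*-≉0 (*-≉0 b≉0 b≉0) (*-≉0 a≉0 ā≉0)) (begin
          b * b * (a * ā) * N s
            ≈⟨ solve 5 (λ b a A s v → b :* b :* (a :* A) :* (s :* v) := b :* A :* s :* (b :* a :* v)) refl b a ā s (conj s) ⟩
          b * ā * s * (b * a * conj s)
            ≈⟨ *-congˡ (*-congʳ (*-cong b-real (conj-conj a))) ⟨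
          b * ā * s * (conj b * conj ā * conj s)
            ≈⟨ *-congˡ (trans (Fr-* k (b * ā) s) (*-congʳ (Fr-* k b ā))) ⟨
          b * ā * s * conj (b * ā * s)   ≈⟨ *-cong bās≈S (Fr-cong k bās≈S) ⟩
          N S                            ≈⟨ NS ⟩
          b * b * (a * ā)                ≈⟨ *-identityʳ _ ⟨
          b * b * (a * ā) * 1#           ∎)
        tᵂ = unit-norm-quotient Nt≈1
        sᵂ = unit-norm-quotient Ns≈1
        V = proj₁ tᵂ
        W = proj₁ sᵂ
        V≉0 = proj₁ (proj₂ tᵂ)
        W≉0 = proj₁ (proj₂ sᵂ)
        V≈tV̄ = proj₂ (proj₂ tᵂ)
        W≈sW̄ = proj₂ (proj₂ sᵂ)
        V-collapses : b * conj (P V) ≈ d * P V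
        V-collapses = +≈0⇒≈ (trans (factorisation V) (trans (*-congʳ (trans (Fr-cong ℓ (≈⇒+≈0 V≈tV̄)) (Fr-0 ℓ))) (zeroˡ _)))
        W-collapses : b * conj (P W) ≈ d * P W
        W-collapses = +≈0⇒≈ (trans (factorisation W) (trans (*-congˡ (≈⇒+≈0 (begin
          b * ā * W                 ≈⟨ *-congˡ W≈sW̄ ⟩
          b * ā * (s * conj W)      ≈⟨ *-assoc _ s _ ⟨
          b * ā * s * conj W        ≈⟨ *-congʳ bās≈S ⟩
          S * conj W                ∎))) (zeroʳ _)))
        s≈t : s ≈ t
        s≈t = sym (*-cancelʳ (*-≉0 (Fr-≉0 k V≉0) (Fr-≉0 k W≉0)) (begin
          t * (conj V * conj W)   ≈⟨ *-assoc t _ _ ⟨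
          t * conj V * conj W     ≈⟨ *-congʳ V≈tV̄ ⟨
          V * conj W              ≈⟨ P-projectively-injective V≉0 W≉0 (*-cancelˡ b≉0 (begin
            b * (P V * conj (P W))  ≈⟨ solve 3 (λ b x y → b :* (x :* y) := x :* (b :* y)) refl b (P V) _ ⟩
            P V * (b * conj (P W))  ≈⟨ *-congˡ W-collapses ⟩
            P V * (d * P W)         ≈⟨ solve 3 (λ x d y → x :* (d :* y) := d :* x :* y) refl (P V) d (P W) ⟩
            d * P V * P W           ≈⟨ *-congʳ V-collapses ⟨
            b * conj (P V) * P W    ≈⟨ *-assoc b _ _ ⟩
            b * (conj (P V) * P W)  ∎)) ⟩
          conj V * W              ≈⟨ *-congˡ W≈sW̄ ⟩
          conj V * (s * conj W)   ≈⟨ solve 3 (λ v s w → v :* (s :* w) := s :* (v :* w)) refl (conj V) s (conj W) ⟩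
          s * (conj V * conj W)   ∎))

      -- In the coordinate Y the factored form is δ N(W) L (f (ψ W)), and the real factor δ N(W) is
      -- invisible to (q-1)-th powers. Since Y, ψ, f and L are injective, the power sum of E equals
      -- the sum of X^(q-1), which is zero.
      nonsplit : N T ≉ 1# → S * conj t ≈ b * ā ⊎ S ≈ b * ā * t
      nonsplit NT≉1 = Sum.map (λ eq → sym (+≈0⇒≈ eq)) +≈0⇒≈
        (power-sum⇒αβ≈0 Q (1+2^k∤2^ℓ k ℓ) α β (begin
          ∑K (λ Y → E Y ^ q-1)               ≈⟨ ∑K-reindex (λ eq → ^-congˡ q-1 (E-cong eq)) Y-cong Y-injective ⟨
          ∑K (λ W → E (Y W) ^ q-1)           ≈⟨ ∑K-cong E^[q-1] ⟩
          ∑K (λ W → L (f (ψ W)) ^ q-1)       ≈⟨ ∑K-reindex (λ eq → ^-congˡ q-1 (L-cong (f-cong eq))) ψ-cong ψ-injective ⟩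
          ∑K (λ X → L (f X) ^ q-1)           ≈⟨ ∑K-reindex (^-congˡ q-1) (L-cong ∘ f-cong) (f-inj ∘ L-injective) ⟩
          ∑K (_^ q-1)                        ≡⟨ ≡.cong (λ i → ∑K (_^ i)) (≡.sym (ℕ.*-identityʳ q-1)) ⟩
          ∑K (_^ (q-1 ℕ.* 1))
            ≈⟨ ∑K-nonmultiple 1 (λ q+1∣1 → contradiction (ℕ.suc-injective (ℕ.∣1⇒≡1 q+1∣1)) (ℕ.m<n⇒n≢0 1<q)) ⟩
          0#                                 ∎))
        where
        -- From δ W = Y + t Ȳ and δ W̄ = Ȳ + t̄ Y: these are δ times the coefficients of the second
        -- factor with respect to Y and Ȳ.
        α = b * ā + S * conj t
        β = S + b * ā * t
        δ = 1# + N t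
        E L Y : Carrier → Carrier
        E y = y ^ Q * (α * y + β * conj y)
        L x = b * conj x + d * x
        Y W = W + t * conj W

        E-cong : ∀ {x y} → x ≈ y → E x ≈ E y
        E-cong eq = *-cong (Fr-cong ℓ eq) (+-cong (*-congˡ eq) (*-congˡ (Fr-cong k eq)))
        L-cong : ∀ {x y} → x ≈ y → L x ≈ L y
        L-cong eq = +-cong (*-congˡ (Fr-cong k eq)) (*-congˡ eq)
        Y-cong : ∀ {x y} → x ≈ y → Y x ≈ Y y
        Y-cong eq = +-cong eq (*-congˡ (Fr-cong k eq))

        NT≈σNt : N T ≈ σ (N t)
        NT≈σNt = trans (*-congˡ (conj-σ t)) (sym (Fr-* ℓ t (conj t)))
        Nt≉1 : N t ≉ 1#
        Nt≉1 Nt≈1 = NT≉1 (trans NT≈σNt (trans (Fr-cong ℓ Nt≈1) (Fr-1 ℓ)))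
        δ≉0 : δ ≉ 0#
        δ≉0 δ≈0 = Nt≉1 (sym (+≈0⇒≈ δ≈0))
        δ-real : conj δ ≈ δ
        δ-real = trans (Fr-+ k 1# (N t)) (+-cong (Fr-1 k) (conj-N t))

        Y-injective : Injective _≈_ _≈_ Y
        Y-injective {V} {W} eq = +≈0⇒≈ (no-zero-divisorʳ δ≉0 (begin
          δ * z                  ≈⟨ solve 3 (λ t u z → (:1 :+ t :* u) :* z := z :+ t :* (u :* z)) refl t (conj t) z ⟩
          z + t * (conj t * z)
            ≈⟨ ≈⇒+≈0 (trans z≈tz̄ (*-congˡ (trans (Fr-cong k z≈tz̄) (trans (Fr-* k t _) (*-congˡ (conj-conj z)))))) ⟩
          0#                     ∎))
          where
          z = V + W
          z≈tz̄ : z ≈ t * conj z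
          z≈tz̄ = +≈0⇒≈ (begin
            V + W + t * conj (V + W)           ≈⟨ +-congˡ (*-congˡ (Fr-+ k V W)) ⟩
            V + W + t * (conj V + conj W)
              ≈⟨ solve 5 (λ v w t x y → v :+ w :+ t :* (x :+ y) := v :+ t :* x :+ (w :+ t :* y)) refl V W t _ _ ⟩
            Y V + Y W                          ≈⟨ ≈⇒+≈0 eq ⟩
            0#                                 ∎)

        d[a+T]≈Tb² : d * (a + T) ≈ T * b ²
        d[a+T]≈Tb² = +≈0⇒≈ (trans (solve 4 (λ a A T b → (A :* T :+ :1) :* (a :+ T) :+ T :* (b :* b)
          := A :* (T :* T) :+ (b :* b :+ :1 :+ a :* A) :* T :+ a) refl a ā T b) root)

        -- A nonzero kernel forces b² = d d̄. With the root equation in the form d (a + T) = T b²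
        -- this gives a + T = T d̄, that is N T = 1.
        L-injective : Injective _≈_ _≈_ L
        L-injective {x} {y} eq with ≈-dec (x + y) 0#
        ... | yes z≈0 = +≈0⇒≈ z≈0
        ... | no  z≉0 = contradiction NT≈1 NT≉1
          where
          z = x + y
          bz̄≈dz : b * conj z ≈ d * z
          bz̄≈dz = +≈0⇒≈ (begin
            b * conj z + d * z                     ≈⟨ +-congʳ (*-congˡ (Fr-+ k x y)) ⟩
            b * (conj x + conj y) + d * (x + y)
              ≈⟨ solve 6 (λ b u v d x y → b :* (u :+ v) :+ d :* (x :+ y) := b :* u :+ d :* x :+ (b :* v :+ d :* y)) refl b _ _ d x y ⟩
            L x + L y                              ≈⟨ ≈⇒+≈0 eq ⟩
            0#                                     ∎)
          bz≈d̄z̄ : b * z ≈ conj d * conj z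
          bz≈d̄z̄ = trans (*-cong (sym b-real) (sym (conj-conj z))) (trans (sym (Fr-* k b (conj z))) (trans (Fr-cong k bz̄≈dz) (Fr-* k d z)))
          b²≈dd̄ : b ² ≈ d * conj d
          b²≈dd̄ = *-cancelʳ z≉0 (begin
            b * b * z                    ≈⟨ *-assoc b b z ⟩
            b * (b * z)                  ≈⟨ *-congˡ bz≈d̄z̄ ⟩
            b * (conj d * conj z)        ≈⟨ solve 3 (λ b e z → b :* (e :* z) := e :* (b :* z)) refl b (conj d) (conj z) ⟩
            conj d * (b * conj z)        ≈⟨ *-congˡ bz̄≈dz ⟩
            conj d * (d * z)             ≈⟨ solve 3 (λ e d z → e :* (d :* z) := d :* e :* z) refl (conj d) d z ⟩
            d * conj d * z               ∎)
          d≉0 : d ≉ 0#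
          d≉0 = factor-≉0ˡ (≉0-resp b²≈dd̄ (*-≉0 b≉0 b≉0))
          a+T≈ : a + T ≈ T * (a * conj T + 1#)
          a+T≈ = *-cancelˡ d≉0 (begin
            d * (a + T)                     ≈⟨ d[a+T]≈Tb² ⟩
            T * b ²                         ≈⟨ *-congˡ b²≈dd̄ ⟩
            T * (d * conj d)                ≈⟨ solve 3 (λ T d e → T :* (d :* e) := d :* (T :* e)) refl T d _ ⟩
            d * (T * conj d)
              ≈⟨ *-congˡ (*-congˡ (trans (Fr-+ k _ _) (+-cong (trans (Fr-* k ā T) (*-congʳ (conj-conj a))) (Fr-1 k)))) ⟩
            d * (T * (a * conj T + 1#))     ∎)
          NT≈1 : N T ≈ 1#
          NT≈1 = *-cancelˡ a≉0 (+≈0⇒≈ (trans (solve 3 (λ a T U → a :* (T :* U) :+ a :* :1 := a :+ T :+ T :* (a :* U :+ :1)) refl a T (conj T)) (≈⇒+≈0 a+T≈)))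

        L-scale : ∀ x W → L (x * N W) ≈ L x * N W
        L-scale x W = trans (+-congʳ (*-congˡ (trans (Fr-* k x (N W)) (*-congˡ (conj-N W)))))
          (solve 5 (λ b u n d x → b :* (u :* n) :+ d :* (x :* n) := (b :* u :+ d :* x) :* n) refl b (conj x) (N W) d x)

        E∘Y : ∀ W → E (Y W) ≈ δ * N W * L (f (ψ W))
        E∘Y W = begin
          σ y * (α * y + β * conj y)
            ≈⟨ *-congˡ (+-congˡ (*-congˡ (trans (Fr-+ k _ _) (+-congˡ (trans (Fr-* k t _) (*-congˡ (conj-conj W))))))) ⟩
          σ y * (α * (W + t * V) + β * (V + conj t * W))
            ≈⟨ solve 7 (λ X c S t u W V → X :* ((c :+ S :* u) :* (W :+ t :* V) :+ (S :+ c :* t) :* (V :+ u :* W))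
                 := (:1 :+ t :* u) :* (X :* (c :* W :+ S :* V))) refl (σ y) (b * ā) S t (conj t) W V ⟩
          δ * (σ y * (b * ā * W + S * V))        ≈⟨ *-congˡ (factorisation W) ⟨
          δ * L (P W)                            ≈⟨ *-congˡ (L-cong (f∘ψ*N≈P W)) ⟨
          δ * L (f (ψ W) * N W)                  ≈⟨ *-congˡ (L-scale (f (ψ W)) W) ⟩
          δ * (L (f (ψ W)) * N W)                ≈⟨ solve 3 (λ d x n → d :* (x :* n) := d :* n :* x) refl δ _ (N W) ⟩
          δ * N W * L (f (ψ W))                  ∎
          where
          y = Y W
          V = conj W

        E^[q-1] : ∀ W → E (Y W) ^ q-1 ≈ L (f (ψ W)) ^ q-1
        E^[q-1] W with ≈-dec W 0#
        ... | yes W≈0 = trans (^-congˡ q-1 E≈0) (^-congˡ q-1 (sym L≈0))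
          where
          E≈0 : E (Y W) ≈ 0#
          E≈0 = trans (E∘Y W) (trans (*-congʳ (trans (*-congˡ (trans (*-congʳ W≈0) (zeroˡ _))) (zeroʳ δ))) (zeroˡ _))
          L≈0 : L (f (ψ W)) ≈ 0#
          L≈0 = trans (L-cong (trans (f-cong (trans (ψ-cong W≈0) (0^ Q-1))) f-0))
            (trans (+-cong (trans (*-congˡ (Fr-0 k)) (zeroʳ b)) (zeroʳ d)) (+-identityʳ 0#))
        ... | no W≉0 = begin
          E (Y W) ^ q-1                                  ≈⟨ ^-congˡ q-1 (E∘Y W) ⟩
          (δ * N W * L (f (ψ W))) ^ q-1                  ≈⟨ ^-distrib-* _ _ q-1 ⟩
          (δ * N W) ^ q-1 * L (f (ψ W)) ^ q-1
            ≈⟨ *-congʳ (real^[q-1]≈1 (*-≉0 δ≉0 (N-≉0 W≉0)) (trans (Fr-* k δ (N W)) (*-cong δ-real (conj-N W)))) ⟩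
          1# * L (f (ψ W)) ^ q-1                         ≈⟨ *-identityˡ _ ⟩
          L (f (ψ W)) ^ q-1                              ∎

    -- If m = 0, the quadratic has a double root with T² = a / ā, so N T = 1. Then `split` makes P
    -- vanish on the line W = t W̄, contrary to injectivity of f.
    m≉0 : Injective _≈_ _≈_ f → m ≉ 0#
    m≉0 f-inj m≈0 = P-≉0 W≉0 (no-zero-divisorʳ ā≉0 (begin
      ā * P W
        ≈⟨ *-congˡ (+-congʳ (+-cong (*-congʳ (trans (Fr-cong ℓ W≈tW̄) (Fr-* ℓ t (conj W)))) (*-congˡ (*-congʳ W≈tW̄)))) ⟩
      ā * (T * σ V * V + b * (t * V * σ V) + a * (σ V * V))
        ≈⟨ solve 7 (λ A T X V b t a → A :* (T :* X :* V :+ b :* (t :* V :* X) :+ a :* (X :* V))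
             := (A :* T :+ b :* A :* t :+ a :* A) :* (X :* V)) refl ā T (σ V) V b t a ⟩
      (ā * T + b * ā * t + a * ā) * (σ V * V)
        ≈⟨ *-congʳ (+-congʳ (+-congˡ (split NT≈1))) ⟨
      (ā * T + S + a * ā) * (σ V * V)
        ≈⟨ *-congʳ (solve 3 (λ x b y → x :+ (b :* b :+ :1 :+ x) :+ y := b :* b :+ :1 :+ y) refl (ā * T) b (a * ā)) ⟩
      m * (σ V * V)           ≈⟨ trans (*-congʳ m≈0) (zeroˡ _) ⟩
      0#                      ∎))
      where
      open Injective⇒ f-inj
      T₀ t : Carrier
      T₀ = proj₁ (sqrt (ā ⁻¹ * a))
      t = proj₁ (Fr-surjective ℓ T₀)
      σt≈T₀ = proj₂ (Fr-surjective ℓ T₀)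
      āT²≈a : ā * (σ t * σ t) ≈ a
      āT²≈a = trans (*-congˡ (trans (*-cong σt≈T₀ σt≈T₀) (proj₂ (sqrt (ā ⁻¹ * a))))) (cancel-⁻¹ʳ a ā≉0)
      root : ā * (σ t * σ t) + m * σ t + a ≈ 0#
      root = trans (+-congʳ (+-cong āT²≈a (trans (*-congʳ m≈0) (zeroˡ _)))) (trans (+-congʳ (+-identityʳ a)) (x+x≈0 a))
      open Root t root f-inj
      NT≈1 : N T ≈ 1#
      NT≈1 = ²-injective (*-cancelˡ (*-≉0 ā≉0 a≉0) (begin
        ā * a * (T * conj T * (T * conj T))
          ≈⟨ solve 4 (λ A a T U → A :* a :* (T :* U :* (T :* U)) := A :* (T :* T) :* (a :* (U :* U))) refl ā a T (conj T) ⟩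
        ā * (T * T) * (a * (conj T * conj T))
          ≈⟨ *-cong āT²≈a (*-cong (sym (conj-conj a)) (sym (Fr-* k T T))) ⟩
        a * (conj ā * conj (T * T))      ≈⟨ *-congˡ (trans (sym (Fr-* k ā (T * T))) (Fr-cong k āT²≈a)) ⟩
        a * ā                            ≈⟨ solve 2 (λ a A → a :* A := A :* a :* (:1 :* :1)) refl a ā ⟩
        ā * a * (1# * 1#)                ∎))
      witness = unit-norm-quotient (Fr-injective ℓ (trans (Fr-* ℓ t (conj t)) (trans (*-congˡ (sym (conj-σ t))) (trans NT≈1 (sym (Fr-1 ℓ))))))
      W = proj₁ witness
      V = conj W
      W≉0 = proj₁ (proj₂ witness)
      W≈tW̄ = proj₂ (proj₂ witness)

    module _ (f-inj : Injective _≈_ _≈_ f) where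
      private
        m≢0 = m≉0 f-inj
        -- The substitution T = g y turns the quadratic into y² + y = c₀ with c₀ = a ā / m². As c₀
        -- lies in 𝔽_q, both roots lie in 𝔽_{q²}.
        i g c₀ : Carrier
        i = m ⁻¹
        g = m * ā ⁻¹
        c₀ = a * ā * (i * i)

        m²c₀ : m * m * c₀ ≈ a * ā
        m²c₀ = begin
          m * m * (a * ā * (i * i))
            ≈⟨ solve 3 (λ m x i → m :* m :* (x :* (i :* i)) := m :* i :* (m :* i) :* x) refl m (a * ā) i ⟩
          m * i * (m * i) * (a * ā)     ≈⟨ *-congʳ (*-cong (*-inverseʳ m m≢0) (*-inverseʳ m m≢0)) ⟩
          1# * 1# * (a * ā)             ≈⟨ solve 1 (λ x → :1 :* :1 :* x := x) refl (a * ā) ⟩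
          a * ā                         ∎

        c₀-real : conj c₀ ≈ c₀
        c₀-real = *-cancelˡ (*-≉0 m≢0 m≢0) (begin
          m * m * conj c₀               ≈⟨ *-congʳ (*-cong m-real m-real) ⟨
          conj m * conj m * conj c₀     ≈⟨ trans (Fr-* k _ _) (*-congʳ (Fr-* k m m)) ⟨
          conj (m * m * c₀)             ≈⟨ Fr-cong k m²c₀ ⟩
          conj (N a)                    ≈⟨ conj-N a ⟩
          a * ā                         ≈⟨ m²c₀ ⟨
          m * m * c₀                    ∎)

        āg : ā * g ≈ m
        āg = trans (*-congˡ (*-comm m _)) (cancel-⁻¹ʳ m ā≉0)

        aḡ : a * conj g ≈ m
        aḡ = begin
          a * conj g            ≈⟨ *-congʳ (conj-conj a) ⟨
          conj ā * conj g       ≈⟨ Fr-* k ā g ⟨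
          conj (ā * g)          ≈⟨ Fr-cong k āg ⟩
          conj m                ≈⟨ m-real ⟩
          m                     ∎

        solution = artin-schreier (conj-invariant⇒Tr≈0 c₀-real)
        y₁ y₂ : Carrier
        y₁ = proj₁ solution
        y₂ = y₁ + 1#

        y₁y₂ : y₁ * y₂ ≈ c₀
        y₁y₂ = trans (solve 1 (λ y → y :* (y :+ :1) := y :* y :+ y) refl y₁) (proj₂ solution)

        t : Carrier → Carrier
        t y = proj₁ (Fr-surjective ℓ (g * y))

        T≈ : ∀ y → σ (t y) ≈ g * y
        T≈ y = proj₂ (Fr-surjective ℓ (g * y))

        root : ∀ y → y * (y + 1#) ≈ c₀ → ā * (σ (t y) * σ (t y)) + m * σ (t y) + a ≈ 0#
        root y yy'≈c₀ = no-zero-divisorʳ ā≉0 (begin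
          ā * (ā * (T * T) + m * T + a)
            ≈⟨ solve 4 (λ A T m a → A :* (A :* (T :* T) :+ m :* T :+ a) := A :* T :* (A :* T) :+ m :* (A :* T) :+ a :* A) refl ā T m a ⟩
          ā * T * (ā * T) + m * (ā * T) + a * ā    ≈⟨ +-congʳ (+-cong (*-cong āT āT) (*-congˡ āT)) ⟩
          m * y * (m * y) + m * (m * y) + a * ā
            ≈⟨ solve 3 (λ m y x → m :* y :* (m :* y) :+ m :* (m :* y) :+ x := m :* m :* (y :* (y :+ :1)) :+ x) refl m y (a * ā) ⟩
          m * m * (y * (y + 1#)) + a * ā           ≈⟨ ≈⇒+≈0 (trans (*-congˡ yy'≈c₀) m²c₀) ⟩
          0#                                       ∎)
          where
          T = σ (t y)
          āT : ā * T ≈ m * y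
          āT = trans (*-congˡ (T≈ y)) (trans (sym (*-assoc ā g y)) (*-congʳ āg))

        module R₁ = Root (t y₁) (root y₁ y₁y₂) f-inj
        module R₂ = Root (t y₂) (root y₂ (trans (solve 1 (λ y → (y :+ :1) :* (y :+ :1 :+ :1) := y :* (y :+ :1)) refl y₁) y₁y₂)) f-inj
        open R₁ using () renaming (T to T₁; S to S₁)
        open R₂ using () renaming (T to T₂; S to S₂)
        t₁ = t y₁
        t₂ = t y₂

        conj-T : ∀ {y z} → conj y ≈ z → conj (σ (t y)) ≈ conj g * z
        conj-T {y} eq = trans (Fr-cong k (T≈ y)) (trans (Fr-* k g y) (*-congˡ eq))

        -- Serves both cases: conjugate y₁ and y₂ give N T = 1 for each root, real ones give T̄₁ T₂
        -- = 1.
        unit-product : ∀ {y z w} → conj y ≈ z → z * w ≈ c₀ → conj (σ (t y)) * σ (t w) ≈ 1#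
        unit-product {y} {z} {w} ȳ≈z zw≈c₀ = *-cancelˡ (*-≉0 a≉0 ā≉0) (begin
          a * ā * (conj (σ (t y)) * σ (t w))    ≈⟨ *-congˡ (*-cong (conj-T ȳ≈z) (T≈ w)) ⟩
          a * ā * (conj g * z * (g * w))
            ≈⟨ solve 6 (λ a A G z g w → a :* A :* (G :* z :* (g :* w)) := a :* G :* (A :* g) :* (z :* w)) refl a ā (conj g) z g w ⟩
          a * conj g * (ā * g) * (z * w)        ≈⟨ *-cong (*-cong aḡ āg) zw≈c₀ ⟩
          m * m * c₀                            ≈⟨ m²c₀ ⟩
          a * ā                                 ≈⟨ *-identityʳ _ ⟨
          a * ā * 1#                            ∎)

        y₂y₁ : y₂ * y₁ ≈ c₀
        y₂y₁ = trans (*-comm _ _) y₁y₂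

        ā[T₁+T₂] : ā * (T₁ + T₂) ≈ m
        ā[T₁+T₂] = begin
          ā * (T₁ + T₂)                    ≈⟨ *-congˡ (+-cong (T≈ y₁) (T≈ y₂)) ⟩
          ā * (g * y₁ + g * (y₁ + 1#))     ≈⟨ solve 3 (λ A g y → A :* (g :* y :+ g :* (y :+ :1)) := A :* g) refl ā g y₁ ⟩
          ā * g                            ≈⟨ āg ⟩
          m                                ∎

        āT₁T₂ : ā * (T₁ * T₂) ≈ a
        āT₁T₂ = *-cancelˡ ā≉0 (begin
          ā * (ā * (T₁ * T₂))              ≈⟨ *-congˡ (*-congˡ (*-cong (T≈ y₁) (T≈ y₂))) ⟩
          ā * (ā * (g * y₁ * (g * y₂)))
            ≈⟨ solve 4 (λ A g y z → A :* (A :* (g :* y :* (g :* z))) := A :* g :* (A :* g) :* (y :* z)) refl ā g y₁ y₂ ⟩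
          ā * g * (ā * g) * (y₁ * y₂)      ≈⟨ *-cong (*-cong āg āg) y₁y₂ ⟩
          m * m * c₀                       ≈⟨ m²c₀ ⟩
          a * ā                            ≈⟨ *-comm a ā ⟩
          ā * a                            ∎)

        T₁≉T₂ : T₁ ≉ T₂
        T₁≉T₂ eq = m≢0 (trans (sym ā[T₁+T₂]) (trans (*-congˡ (≈⇒+≈0 eq)) (zeroʳ ā)))

        S₁≉S₂ : S₁ ≉ S₂
        S₁≉S₂ eq = T₁≉T₂ (*-cancelˡ ā≉0 (+≈0⇒≈ (trans
          (solve 3 (λ x y z → x :+ y := z :+ x :+ (z :+ y)) refl (ā * T₁) (ā * T₂) (b ² + 1#)) (≈⇒+≈0 eq))))

        -- Only sum and product are needed later, and they forget which S is paired with which t, so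
        -- both pairings yield the same data.
        Matching : Set e
        Matching = S₁ + S₂ ≈ b * ā * (t₁ + t₂) × S₁ * S₂ ≈ b * ā * (b * ā) * (t₁ * t₂)

        straight : S₁ ≈ b * ā * t₁ → S₂ ≈ b * ā * t₂ → Matching
        straight eq₁ eq₂ = trans (+-cong eq₁ eq₂) (sym (distribˡ _ _ _)) , trans (*-cong eq₁ eq₂)
          (solve 3 (λ x s t → x :* s :* (x :* t) := x :* x :* (s :* t)) refl (b * ā) t₁ t₂)

        crossed : S₁ ≈ b * ā * t₂ → S₂ ≈ b * ā * t₁ → Matching
        crossed eq₁ eq₂ = trans (+-cong eq₁ eq₂) (trans (sym (distribˡ _ _ _)) (*-congˡ (+-comm t₂ t₁))) , trans (*-cong eq₁ eq₂)
          (solve 3 (λ x s t → x :* t :* (x :* s) := x :* x :* (s :* t)) refl (b * ā) t₁ t₂)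

        -- Vanishing of α at one root becomes a relation with the other root r, because s̄ r = 1.
        cross : ∀ {S s r} → conj (σ s) * σ r ≈ 1# → S * conj s ≈ b * ā → S ≈ b * ā * r
        cross {S} {s} {r} unit eq = begin
          S                     ≈⟨ *-identityʳ S ⟨
          S * 1#                ≈⟨ *-congˡ s̄r≈1 ⟨
          S * (conj s * r)      ≈⟨ *-assoc S _ r ⟨
          S * conj s * r        ≈⟨ *-congʳ eq ⟩
          b * ā * r             ∎
          where
          s̄r≈1 : conj s * r ≈ 1#
          s̄r≈1 = Fr-injective ℓ (trans (Fr-* ℓ _ _) (trans (*-congʳ (sym (conj-σ s))) (trans unit (sym (Fr-1 ℓ)))))

        matching-split : conj y₁ + y₁ ≈ 1# → Matching
        matching-split d≈1 = straight
                (R₁.split (trans (*-comm _ _) (unit-product ȳ₁≈y₂ y₂y₁)))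
                (R₂.split (trans (*-comm _ _) (unit-product ȳ₂≈y₁ y₁y₂)))
          where
          ȳ₁≈y₂ : conj y₁ ≈ y₂
          ȳ₁≈y₂ = trans (solve 2 (λ x y → x := y :+ (x :+ y)) refl (conj y₁) y₁) (+-congˡ d≈1)
          ȳ₂≈y₁ : conj y₂ ≈ y₁
          ȳ₂≈y₁ = trans (Fr-+ k y₁ 1#) (trans (+-cong ȳ₁≈y₂ (Fr-1 k)) (solve 1 (λ y → y :+ :1 :+ :1 := y) refl y₁))
        matching-nonsplit : conj y₁ + y₁ ≈ 0# → Matching
        matching-nonsplit d≈0 = combine
                (R₁.nonsplit (λ eq → T₁≉T₂ (*-cancelˡ T̄₁≉0 (trans (*-comm _ _) (trans eq (sym unit₁₂))))))
                (R₂.nonsplit (λ eq → T₁≉T₂ (sym (*-cancelˡ T̄₂≉0 (trans (*-comm _ _) (trans eq (sym unit₂₁)))))))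
          where
          ȳ₁≈y₁ : conj y₁ ≈ y₁
          ȳ₁≈y₁ = +≈0⇒≈ d≈0
          ȳ₂≈y₂ : conj y₂ ≈ y₂
          ȳ₂≈y₂ = trans (Fr-+ k y₁ 1#) (+-cong ȳ₁≈y₁ (Fr-1 k))
          unit₁₂ = unit-product ȳ₁≈y₁ y₁y₂
          unit₂₁ = unit-product ȳ₂≈y₂ y₂y₁
          T̄₁≉0 : conj T₁ ≉ 0#
          T̄₁≉0 = factor-≉0ˡ (≉0-resp (sym unit₁₂) 1≉0)
          T̄₂≉0 : conj T₂ ≉ 0#
          T̄₂≉0 = factor-≉0ˡ (≉0-resp (sym unit₂₁) 1≉0)
          -- In the mixed cases S₁ and S₂ would be the same multiple of the same t, but they differ
          -- because T₁ and T₂ do.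
          combine : S₁ * conj t₁ ≈ b * ā ⊎ S₁ ≈ b * ā * t₁ → S₂ * conj t₂ ≈ b * ā ⊎ S₂ ≈ b * ā * t₂ → Matching
          combine (inj₁ e₁) (inj₁ e₂) = crossed (cross unit₁₂ e₁) (cross unit₂₁ e₂)
          combine (inj₁ e₁) (inj₂ e₂) = contradiction (trans (cross unit₁₂ e₁) (sym e₂)) S₁≉S₂
          combine (inj₂ e₁) (inj₁ e₂) = contradiction (trans e₁ (sym (cross unit₂₁ e₂))) S₁≉S₂
          combine (inj₂ e₁) (inj₂ e₂) = straight e₁ e₂

        -- The conjugate of y₁ solves the same Artin-Schreier equation, so it is y₁ or y₁ + 1; this
        -- decides between the two cases.
        matching : Matching
        matching = [ matching-nonsplit , matching-split ]′ (idempotent⇒0∨1 {conj y₁ + y₁} (begin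
            (conj y₁ + y₁) ²
              ≈⟨ solve 2 (λ x y → (x :+ y) :* (x :+ y) := x :* (x :+ :1) :+ y :* (y :+ :1) :+ (x :+ y)) refl (conj y₁) y₁ ⟩
            conj y₁ * (conj y₁ + 1#) + y₁ * y₂ + (conj y₁ + y₁)
              ≈⟨ +-congʳ (≈⇒+≈0 (trans (*-congˡ (+-congˡ (sym (Fr-1 k)))) (trans (*-congˡ (sym (Fr-+ k y₁ 1#))) (trans (sym (Fr-* k y₁ y₂)) (trans (Fr-cong k y₁y₂) (trans c₀-real (sym y₁y₂))))))) ⟩
            0# + (conj y₁ + y₁)          ≈⟨ +-identityˡ _ ⟩
            conj y₁ + y₁                 ∎))

        S₁S₂ : S₁ * S₂ ≈ b * b * (a * ā)
        S₁S₂ = begin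
          S₁ * S₂
            ≈⟨ solve 4 (λ b A T U → (b :* b :+ :1 :+ A :* T) :* (b :* b :+ :1 :+ A :* U)
                 := (b :* b :+ :1) :* (b :* b :+ :1) :+ (b :* b :+ :1) :* (A :* (T :+ U)) :+ A :* (A :* (T :* U))) refl b ā T₁ T₂ ⟩
          (b ² + 1#) * (b ² + 1#) + (b ² + 1#) * (ā * (T₁ + T₂)) + ā * (ā * (T₁ * T₂))
            ≈⟨ +-cong (+-congˡ (*-congˡ ā[T₁+T₂])) (*-congˡ āT₁T₂) ⟩
          (b ² + 1#) * (b ² + 1#) + (b ² + 1#) * m + ā * a
            ≈⟨ solve 3 (λ b a A → (b :* b :+ :1) :* (b :* b :+ :1) :+ (b :* b :+ :1) :* (b :* b :+ :1 :+ a :* A) :+ A :* a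
                 := b :* b :* (a :* A)) refl b a ā ⟩
          b * b * (a * ā) ∎

        π : Carrier
        π = t₁ * t₂

        āπ≈a : ā * π ≈ a
        āπ≈a = *-cancelˡ (*-≉0 (*-≉0 b≉0 b≉0) ā≉0) (begin
          b * b * ā * (ā * π)
            ≈⟨ solve 3 (λ b A p → b :* b :* A :* (A :* p) := b :* A :* (b :* A) :* p) refl b ā π ⟩
          b * ā * (b * ā) * π              ≈⟨ proj₂ matching ⟨
          S₁ * S₂                          ≈⟨ S₁S₂ ⟩
          b * b * (a * ā)                  ≈⟨ solve 3 (λ b a A → b :* b :* (a :* A) := b :* b :* A :* a) refl b a ā ⟩
          b * b * ā * a                    ∎)

        -- The product T₁ T₂ of the roots is σ π, and it satisfies ā σ π = a just as π does; so σ
        -- fixes π, which is nonzero.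
        π≈1 : π ≈ 1#
        π≈1 = [ (λ π≈0 → contradiction (trans (sym āπ≈a) (trans (*-congˡ π≈0) (zeroʳ ā))) a≉0) , id ]′
          (idempotent⇒0∨1 (σ-fixed⇒idempotent (*-cancelˡ ā≉0
            (trans (*-congˡ (Fr-* ℓ t₁ t₂)) (trans āT₁T₂ (sym āπ≈a))))))

      permutes⇒a-real : conj a ≈ a
      permutes⇒a-real = trans (sym (*-identityʳ ā)) (trans (*-congˡ (sym π≈1)) āπ≈a)

      -- In S₁ + S₂ the terms b² + 1 cancel and leave ā (T₁ + T₂) = ā σ λ, while the matching gives
      -- b ā λ. The second relation is the sum of the roots of the quadratic, once a is real.
      permutes⇒λ : ∃[ lam ] σ lam ≈ b * lam × a * σ lam ≈ a ² + b ² + 1#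
      permutes⇒λ = t₁ + t₂ , *-cancelˡ ā≉0 (begin
          ā * σ (t₁ + t₂)          ≈⟨ *-congˡ (Fr-+ ℓ t₁ t₂) ⟩
          ā * (T₁ + T₂)
            ≈⟨ solve 4 (λ A T U b → A :* (T :+ U) := b :* b :+ :1 :+ A :* T :+ (b :* b :+ :1 :+ A :* U)) refl ā T₁ T₂ b ⟩
          S₁ + S₂                  ≈⟨ proj₁ matching ⟩
          b * ā * (t₁ + t₂)        ≈⟨ solve 3 (λ b A s → b :* A :* s := A :* (b :* s)) refl b ā (t₁ + t₂) ⟩
          ā * (b * (t₁ + t₂))      ∎) ,
        (begin
          a * σ (t₁ + t₂)          ≈⟨ *-cong (sym permutes⇒a-real) (Fr-+ ℓ t₁ t₂) ⟩
          ā * (T₁ + T₂)            ≈⟨ ā[T₁+T₂] ⟩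
          b ² + 1# + a * ā         ≈⟨ +-congˡ (*-congˡ permutes⇒a-real) ⟩
          b ² + 1# + a * a         ≈⟨ solve 2 (λ a b → b :* b :+ :1 :+ a :* a := a :* a :+ b :* b :+ :1) refl a b ⟩
          a ² + b ² + 1#           ∎)

-- The normal form of P and the trace condition

module NormalForm {c e} (K : Field c e) (k ℓ : ℕ) .{{_ : NonZero k}} .{{_ : NonZero ℓ}}
         .{{_ : NonZero (2 ℕ.* k)}} (order : HasOrder (Field.setoid K) (2 ℕ.^ (2 ℕ.* k)))
         (coprime : gcd (2 ℕ.* k) ℓ ≡ 1) where
  open CoprimeFrobenius K k ℓ order coprime
  open SetoidReasoning setoid

  -- Here ρ is a primitive cube root of unity, and `Tr i 1#` is the parity of i: the Frobenius
  -- exchanges ρ and ρ + 1.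
  Fr-parity : ∀ i {ρ} → ρ ² + ρ ≈ 1# → Fr i ρ ≈ ρ + Tr i 1#
  Fr-parity i {ρ} ρ²+ρ≈1 = begin
    Fr i ρ                   ≈⟨ solve 2 (λ x y → y := x :+ (x :+ y)) refl ρ (Fr i ρ) ⟩
    ρ + (ρ + Fr i ρ)         ≈⟨ +-congˡ (Tr-℘ i ρ) ⟨
    ρ + Tr i (ρ + ρ ²)       ≈⟨ +-congˡ (Tr-cong i (trans (+-comm _ _) ρ²+ρ≈1)) ⟩
    ρ + Tr i 1#              ∎

  Tr-ℓ : ∀ {x} → x ² ≈ x → Tr ℓ x ≈ x
  Tr-ℓ {x} idem = trans (reflexive (≡.cong (λ i → Tr i x) (proj₂ ℓ-odd))) (Tr-odd (proj₁ ℓ-odd) idem)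

  Tr-k-even : ∀ j {x} → k ≡ j ℕ.+ j → x ² ≈ x → Tr k x ≈ 0#
  Tr-k-even j {x} k≡ idem = trans (reflexive (≡.cong (λ i → Tr i x) k≡)) (Tr-double j (idempotent⇒fixed j idem))

  Tr-k-odd : ∀ j {x} → k ≡ suc (j ℕ.+ j) → x ² ≈ x → Tr k x ≈ x
  Tr-k-odd j {x} k≡ idem = trans (reflexive (≡.cong (λ i → Tr i x) k≡)) (Tr-odd j idem)

  j+j≡j*2 : ∀ j → j ℕ.+ j ≡ j ℕ.* 2
  j+j≡j*2 j = ≡.trans (≡.cong (j ℕ.+_) (≡.sym (ℕ.+-identityʳ j))) (ℕ.*-comm 2 j)

  module _ (a b lam ε : Carrier) (a≉0 : a ≉ 0#) (b-real : conj b ≈ b)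
           (lam≉0 : lam ≉ 0#) (lam-real : conj lam ≈ lam) (ε-idem : ε ² ≈ ε)
           (σlam≈b*lam : σ lam ≈ b * lam)
           (a≈ : a ≈ ε * σ lam + σ lam * Tr ℓ ((lam ⁻¹) ²)) where
    open Quadrinomial a b

    κ θ : Carrier
    κ = σ lam
    θ = lam ⁻¹

    θ-real : conj θ ≈ θ
    θ-real = *-cancelʳ lam≉0 (begin
      conj θ * lam         ≈⟨ *-congˡ lam-real ⟨
      conj θ * conj lam    ≈⟨ Fr-⁻¹ k lam≉0 ⟩
      1#                   ≈⟨ *-inverseˡ lam≉0 ⟨
      θ * lam              ∎)

    solution : ∃[ w ] w ² + w ≈ θ
    solution = artin-schreier (trans (reflexive (≡.cong (λ i → Tr (k ℕ.+ i) θ) (ℕ.+-identityʳ k))) (Tr-double k θ-real))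

    -- `ω` is w or w + 1, the root of x² + x = θ for which g becomes ε + w + w^Q. `d` is 0 or 1
    -- according to whether w is real.
    w v ω g d : Carrier
    w = proj₁ solution
    v = σ w
    ω = w + ε + 1#
    g = v + ω + 1#
    d = conj w + w

    w²+w : w ² + w ≈ θ
    w²+w = proj₂ solution

    θ≉0 : θ ≉ 0#
    θ≉0 = ⁻¹-≉0 lam≉0

    ω²+ω : ω ² + ω ≈ θ
    ω²+ω = begin
      ω ² + ω
        ≈⟨ solve 2 (λ w e → (w :+ e :+ :1) :* (w :+ e :+ :1) :+ (w :+ e :+ :1) := w :* w :+ w :+ (e :* e :+ e)) refl w ε ⟩
      w ² + w + (ε ² + ε)          ≈⟨ +-cong w²+w (≈⇒+≈0 ε-idem) ⟩
      θ + 0#                       ≈⟨ +-identityʳ θ ⟩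
      θ                            ∎

    κ[v²+v] : κ * (v ² + v) ≈ 1#
    κ[v²+v] = begin
      κ * (v ² + v)         ≈⟨ *-congˡ (trans (Fr-+ ℓ (w ²) w) (+-congʳ (Fr-* ℓ w w))) ⟨
      κ * σ (w ² + w)       ≈⟨ Fr-* ℓ lam _ ⟨
      σ (lam * (w ² + w))   ≈⟨ Fr-cong ℓ (trans (*-congˡ w²+w) (*-inverseʳ lam lam≉0)) ⟩
      σ 1#                  ≈⟨ Fr-1 ℓ ⟩
      1#                    ∎

    b≈ : b ≈ κ * (ω ² + ω)
    b≈ = begin
      b                     ≈⟨ *-identityʳ b ⟨
      b * 1#                ≈⟨ *-congˡ (*-inverseʳ lam lam≉0) ⟨
      b * (lam * θ)         ≈⟨ *-assoc b lam θ ⟨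
      b * lam * θ           ≈⟨ *-cong σlam≈b*lam ω²+ω ⟨
      κ * (ω ² + ω)         ∎

    a≈κg² : a ≈ κ * g ²
    a≈κg² = begin
      a                                   ≈⟨ a≈ ⟩
      ε * κ + κ * Tr ℓ (θ ²)              ≈⟨ +-cong (*-congʳ ε-idem) (*-congˡ Trθ²) ⟨
      ε ² * κ + κ * ((w + v) ²)           ≈⟨ solve 4 (λ e m w v → e :* e :* m :+ m :* ((w :+ v) :* (w :+ v))
                                               := m :* ((v :+ (w :+ e :+ :1) :+ :1) :* (v :+ (w :+ e :+ :1) :+ :1))) refl ε κ w v ⟩
      κ * g ²                             ∎
      where
      Trθ² : (w + v) ² ≈ Tr ℓ (θ ²)
      Trθ² = trans (*-cong w+v w+v) (²-Tr ℓ θ)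
        where
        w+v : w + v ≈ Tr ℓ θ
        w+v = trans (sym (Tr-℘ ℓ w)) (Tr-cong ℓ (trans (+-comm _ _) w²+w))

    -- All squares cancel among the three summands κ g², κ (ω² + ω) and κ (v² + v). Hence a / (a + b
    -- + 1) is κ g² / (κ g) = g.
    κg : a + b + 1# ≈ κ * g
    κg = begin
      a + b + 1#                                    ≈⟨ +-cong (+-cong a≈κg² b≈) (sym κ[v²+v]) ⟩
      κ * g ² + κ * (ω ² + ω) + κ * (v ² + v)
        ≈⟨ solve 3 (λ m v o → m :* ((v :+ o :+ :1) :* (v :+ o :+ :1)) :+ m :* (o :* o :+ o) :+ m :* (v :* v :+ v)
                                                         := m :* (v :+ o :+ :1)) refl κ v ω ⟩
      κ * g                                         ∎

    κg≉0 : κ * g ≉ 0#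
    κg≉0 κg≈0 = a≉0 (trans a≈κg² (trans (sym (*-assoc κ g g)) (trans (*-congʳ κg≈0) (zeroˡ g))))

    a/[a+b+1] : a / (a + b + 1#) ≈ g
    a/[a+b+1] = *-cancelˡ κg≉0 (begin
      κ * g * (a / s)         ≈⟨ *-congʳ κg ⟨
      s * (a * s ⁻¹)          ≈⟨ *-congˡ (*-comm a _) ⟩
      s * (s ⁻¹ * a)          ≈⟨ cancel-⁻¹ʳ a (≉0-resp (sym κg) κg≉0) ⟩
      a                       ≈⟨ trans a≈κg² (sym (*-assoc κ g g)) ⟩
      κ * g * g               ∎)
      where s = a + b + 1#

    d-idem : d ² ≈ d
    d-idem = +≈0⇒≈ (begin
      d ² + d
        ≈⟨ solve 2 (λ x y → (x :+ y) :* (x :+ y) :+ (x :+ y) := x :* x :+ x :+ (y :* y :+ y)) refl (conj w) w ⟩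
      conj w ² + conj w + (w ² + w)                   ≈⟨ +-congʳ (trans (Fr-+ k _ _) (+-congʳ (Fr-* k w w))) ⟨
      conj (w ² + w) + (w ² + w)                      ≈⟨ ≈⇒+≈0 (trans (Fr-cong k w²+w) (trans θ-real (sym w²+w))) ⟩
      0#                                              ∎)

    -- For z = Tr k w one has z + z² = w + w̄ = d, and the trace of w^Q is σ z. So z + σ z = Tr ℓ d,
    -- which is d because ℓ is odd.
    Tr-g : Tr k g ≈ Tr k ε + d
    Tr-g = begin
      Tr k g                       ≈⟨ Tr-cong k (solve 3 (λ v w e → v :+ (w :+ e :+ :1) :+ :1 := e :+ (w :+ v)) refl v w ε) ⟩
      Tr k (ε + (w + v))           ≈⟨ trans (Tr-+ k _ _) (+-congˡ (Tr-+ k w v)) ⟩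
      Tr k ε + (z + Tr k v)        ≈⟨ +-congˡ (+-congˡ (Tr-Fr k ℓ w)) ⟩
      Tr k ε + (z + σ z)           ≈⟨ +-congˡ (Tr-℘ ℓ z) ⟨
      Tr k ε + Tr ℓ (z + z ²)      ≈⟨ +-congˡ (Tr-cong ℓ z+z²) ⟩
      Tr k ε + Tr ℓ d              ≈⟨ +-congˡ (Tr-ℓ d-idem) ⟩
      Tr k ε + d                   ∎
      where
      z = Tr k w
      z+z² : z + z ² ≈ d
      z+z² = trans (+-congˡ (²-Tr k w)) (trans (sym (Tr-+ k w (w ²))) (trans (Tr-℘ k w) (+-comm w _)))

    Tr[a/[a+b+1]] : Tr k (a / (a + b + 1#)) ≈ Tr k ε + d
    Tr[a/[a+b+1]] = trans (Tr-cong k a/[a+b+1]) Tr-g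

    d≈0⇒w-real : d ≈ 0# → conj w ≈ w
    d≈0⇒w-real = +≈0⇒≈

    d≈1⇒w̄≈w+1 : d ≈ 1# → conj w ≈ w + 1#
    d≈1⇒w̄≈w+1 d≈1 = trans (solve 2 (λ x y → x := y :+ (x :+ y)) refl (conj w) w) (+-congˡ d≈1)

    a-real : conj a ≈ a
    a-real = begin
      conj a                      ≈⟨ Fr-cong k a≈ ⟩
      conj (ε * κ + κ * τ)        ≈⟨ trans (Fr-+ k _ _) (+-cong (Fr-* k ε κ) (Fr-* k κ τ)) ⟩
      conj ε * conj κ + conj κ * conj τ ≈⟨ +-cong (*-cong (idempotent⇒fixed k ε-idem) κ-real) (*-cong κ-real τ-real) ⟩
      ε * κ + κ * τ               ≈⟨ a≈ ⟨
      a                           ∎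
      where
      τ = Tr ℓ (θ ²)
      κ-real : conj κ ≈ κ
      κ-real = trans (conj-σ lam) (Fr-cong ℓ lam-real)
      τ-real : conj τ ≈ τ
      τ-real = trans (sym (Tr-Fr ℓ k _)) (Tr-cong ℓ (trans (Fr-* k θ θ) (*-cong θ-real θ-real)))

    -- Coefficients x and x + 1 sum to 1, and replacing x by x + 1 exchanges W and V. This symmetry
    -- carries the swap of w and w + 1 over to the coordinates y₁ and y₂.
    form : Carrier → Carrier → Carrier → Carrier
    form x W V = x * W + (x + 1#) * V

    form-cong : ∀ {x y W W′ V V′} → x ≈ y → W ≈ W′ → V ≈ V′ → form x W V ≈ form y W′ V′
    form-cong x≈y W≈ V≈ = +-cong (*-cong x≈y W≈) (*-cong (+-congʳ x≈y) V≈)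

    Fr-form : ∀ i x W V → Fr i (form x W V) ≈ form (Fr i x) (Fr i W) (Fr i V)
    Fr-form i x W V = trans (Fr-+ i _ _) (+-cong (Fr-* i x W) (trans (Fr-* i _ V) (*-congʳ (trans (Fr-+ i x 1#) (+-congˡ (Fr-1 i))))))

    y₁ y₂ l₁ l₂ E₁ E₂ : Carrier → Carrier
    y₁ W = form w W (conj W)
    y₂ W = form w (conj W) W
    l₁ W = form ω W (conj W)
    l₂ W = form ω (conj W) W
    E₁ W = σ (y₁ W) * l₁ W
    E₂ W = σ (y₂ W) * l₂ W

    -- 1 = κ (v² + v), b = κ (ω² + ω) and a = κ (v + ω + 1)² make the coefficients of P match.
    P≈ : ∀ W → P W ≈ κ * ((v + 1#) * (ω + 1#) * E₁ W + v * ω * E₂ W)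
    P≈ W = begin
      σ W * V + b * (W * σ V) + a * (σ V * V)
        ≈⟨ +-cong (+-cong (trans (sym (*-identityˡ _)) (*-congʳ (sym κ[v²+v]))) (*-congʳ b≈)) (*-congʳ a≈κg²) ⟩
      κ * (v ² + v) * (σ W * V) + κ * (ω ² + ω) * (W * σ V) + κ * g ² * (σ V * V)
        ≈⟨ solve 7 (λ W V X Y m v o → m :* (v :* v :+ v) :* (X :* V) :+ m :* (o :* o :+ o) :* (W :* Y)
               :+ m :* ((v :+ o :+ :1) :* (v :+ o :+ :1)) :* (Y :* V)
             := m :* ((v :+ :1) :* (o :+ :1) :* ((v :* X :+ (v :+ :1) :* Y) :* (o :* W :+ (o :+ :1) :* V))
               :+ v :* o :* ((v :* Y :+ (v :+ :1) :* X) :* (o :* V :+ (o :+ :1) :* W)))) refl W V (σ W) (σ V) κ v ω ⟩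
      κ * ((v + 1#) * (ω + 1#) * (form v (σ W) (σ V) * l₁ W) + v * ω * (form v (σ V) (σ W) * l₂ W))
        ≈⟨ *-congˡ (+-cong (*-congˡ (*-congʳ (Fr-form ℓ w W V))) (*-congˡ (*-congʳ (Fr-form ℓ w V W)))) ⟨
      κ * ((v + 1#) * (ω + 1#) * E₁ W + v * ω * E₂ W) ∎
      where V = conj W

    P̄≈ : ∀ W → conj (P W) ≈ κ * ((v + 1#) * (ω + 1#) * E₂ W + v * ω * E₁ W)
    P̄≈ W = begin
      conj (P W)                                  ≈⟨ conj-P b-real W ⟩
      σ V * W + b * (V * σ W) + conj a * (σ W * W)
        ≈⟨ +-cong (+-cong (*-congˡ (conj-conj W)) (*-congˡ (*-congˡ σW))) (*-cong (sym a-real) (*-cong σW (conj-conj W))) ⟨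
      σ V * conj V + b * (V * σ (conj V)) + a * (σ (conj V) * conj V)
        ≈⟨ P≈ V ⟩
      κ * ((v + 1#) * (ω + 1#) * (σ (form w V (conj V)) * form ω V (conj V)) + v * ω * (σ (form w (conj V) V) * form ω (conj V) V))
        ≈⟨ *-congˡ (+-cong (*-congˡ (*-cong (Fr-cong ℓ (form-cong refl refl (conj-conj W))) (form-cong refl refl (conj-conj W))))
             (*-congˡ (*-cong (Fr-cong ℓ (form-cong refl (conj-conj W) refl)) (form-cong refl (conj-conj W) refl)))) ⟩
      κ * ((v + 1#) * (ω + 1#) * E₂ W + v * ω * E₁ W) ∎
      where
      V = conj W
      σW : σ (conj V) ≈ σ W
      σW = Fr-cong ℓ (conj-conj W)

    -- The matrix expressing P and P̄ through E₁ and E₂ has rows (p, r) and (r, p), scaled by κ,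
    -- with p + r = g. Applying the unscaled matrix again multiplies by g², and κ g² = a.
    aE₁ : ∀ W → a * E₁ W ≈ (v + 1#) * (ω + 1#) * P W + v * ω * conj (P W)
    aE₁ W = sym (begin
      (v + 1#) * (ω + 1#) * P W + v * ω * conj (P W)
        ≈⟨ +-cong (*-congˡ (P≈ W)) (*-congˡ (P̄≈ W)) ⟩
      (v + 1#) * (ω + 1#) * (κ * ((v + 1#) * (ω + 1#) * E₁ W + v * ω * E₂ W)) + v * ω * (κ * ((v + 1#) * (ω + 1#) * E₂ W + v * ω * E₁ W))
        ≈⟨ solve 5 (λ v o m x y → (v :+ :1) :* (o :+ :1) :* (m :* ((v :+ :1) :* (o :+ :1) :* x :+ v :* o :* y))
               :+ v :* o :* (m :* ((v :+ :1) :* (o :+ :1) :* y :+ v :* o :* x))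
             := m :* ((v :+ o :+ :1) :* (v :+ o :+ :1)) :* x) refl v ω κ (E₁ W) (E₂ W) ⟩
      κ * g ² * E₁ W                              ≈⟨ *-congʳ a≈κg² ⟨
      a * E₁ W                                    ∎)

    aE₂ : ∀ W → a * E₂ W ≈ (v + 1#) * (ω + 1#) * conj (P W) + v * ω * P W
    aE₂ W = sym (begin
      (v + 1#) * (ω + 1#) * conj (P W) + v * ω * P W
        ≈⟨ +-cong (*-congˡ (P̄≈ W)) (*-congˡ (P≈ W)) ⟩
      (v + 1#) * (ω + 1#) * (κ * ((v + 1#) * (ω + 1#) * E₂ W + v * ω * E₁ W)) + v * ω * (κ * ((v + 1#) * (ω + 1#) * E₁ W + v * ω * E₂ W))
        ≈⟨ solve 5 (λ v o m x y → (v :+ :1) :* (o :+ :1) :* (m :* ((v :+ :1) :* (o :+ :1) :* x :+ v :* o :* y))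
               :+ v :* o :* (m :* ((v :+ :1) :* (o :+ :1) :* y :+ v :* o :* x))
             := m :* ((v :+ o :+ :1) :* (v :+ o :+ :1)) :* x) refl v ω κ (E₂ W) (E₁ W) ⟩
      κ * g ² * E₂ W                              ≈⟨ *-congʳ a≈κg² ⟨
      a * E₂ W                                    ∎)

    -- The change of coordinates is an involution, since w² + (w + 1)² = 1 and the mixed terms
    -- cancel.
    recover : ∀ W → W ≈ form w (y₁ W) (y₂ W)
    recover W = solve 3 (λ w W V → W := w :* (w :* W :+ (w :+ :1) :* V) :+ (w :+ :1) :* (w :* V :+ (w :+ :1) :* W)) refl w W (conj W)

    y₁≈0∧y₂≈0⇒≈0 : ∀ {W} → y₁ W ≈ 0# → y₂ W ≈ 0# → W ≈ 0#
    y₁≈0∧y₂≈0⇒≈0 {W} y₁≈0 y₂≈0 = trans (recover W) (trans (form-cong refl y₁≈0 y₂≈0)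
      (solve 1 (λ w → w :* :0 :+ (w :+ :1) :* :0 := :0) refl w))

    σ*-zero : ∀ {x y} → σ x * y ≈ 0# → x ≈ 0# ⊎ y ≈ 0#
    σ*-zero eq = Sum.map₁ (^-≈0 Q) (zero-product eq)

    σ*-self-zero : ∀ {x} → σ x * x ≈ 0# → x ≈ 0#
    σ*-self-zero eq = [ id , id ]′ (σ*-zero eq)

    module _ (ε≈1 : ε ≈ 1#) where
      ω≈w : ω ≈ w
      ω≈w = trans (+-congʳ (+-congˡ ε≈1)) (solve 1 (λ w → w :+ :1 :+ :1 := w) refl w)

      E₁-straight : ∀ W → E₁ W ≈ σ (y₁ W) * y₁ W
      E₁-straight W = *-congˡ (form-cong ω≈w refl refl)

      E₂-straight : ∀ W → E₂ W ≈ σ (y₂ W) * y₂ W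
      E₂-straight W = *-congˡ (form-cong ω≈w refl refl)

    module _ (ε≈0 : ε ≈ 0#) where
      ω≈w+1 : ω ≈ w + 1#
      ω≈w+1 = +-congʳ (trans (+-congˡ ε≈0) (+-identityʳ w))

      form-swap : ∀ W V → form ω W V ≈ form w V W
      form-swap W V = trans (form-cong ω≈w+1 refl refl)
        (solve 3 (λ w W V → (w :+ :1) :* W :+ (w :+ :1 :+ :1) :* V := w :* V :+ (w :+ :1) :* W) refl w W V)

      E₁-crossed : ∀ W → E₁ W ≈ σ (y₁ W) * y₂ W
      E₁-crossed W = *-congˡ (form-swap W (conj W))

      E₂-crossed : ∀ W → E₂ W ≈ σ (y₂ W) * y₁ W
      E₂-crossed W = *-congˡ (form-swap (conj W) W)

    module _ (d≈0 : d ≈ 0#) where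
      ȳ₁≈y₂ : ∀ W → conj (y₁ W) ≈ y₂ W
      ȳ₁≈y₂ W = trans (Fr-form k w W (conj W)) (form-cong (d≈0⇒w-real d≈0) refl (conj-conj W))

      ȳ₂≈y₁ : ∀ W → conj (y₂ W) ≈ y₁ W
      ȳ₂≈y₁ W = trans (Fr-form k w (conj W) W) (form-cong (d≈0⇒w-real d≈0) (conj-conj W) refl)

    module _ (d≈1 : d ≈ 1#) where
      form-flip : ∀ {x W V} → x ≈ w + 1# → form x W V ≈ form w V W
      form-flip {_} {W} {V} x≈w+1 = trans (form-cong x≈w+1 refl refl)
        (solve 3 (λ w W V → (w :+ :1) :* W :+ (w :+ :1 :+ :1) :* V := w :* V :+ (w :+ :1) :* W) refl w W V)

      ȳ₁≈y₁ : ∀ W → conj (y₁ W) ≈ y₁ W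
      ȳ₁≈y₁ W = trans (Fr-form k w W (conj W)) (trans (form-flip (d≈1⇒w̄≈w+1 d≈1)) (form-cong refl (conj-conj W) refl))

      ȳ₂≈y₂ : ∀ W → conj (y₂ W) ≈ y₂ W
      ȳ₂≈y₂ W = trans (Fr-form k w (conj W) W) (trans (form-flip (d≈1⇒w̄≈w+1 d≈1)) (form-cong refl refl (conj-conj W)))

    -- The cases in which k ε + d is zero. For ε = 0 the map y^(Q-1) needs a line without real zeros
    -- of y₁ and y₂, that is d = 0. For ε = 1 the obstruction to y^(Q+1) is a cube root of unity
    -- among the ratios: these have norm 1 when d = 0, which is harmless for even k, and lie in 𝔽_q
    -- when d = 1, which is harmless for odd k.
    data Favourable : Set e where
      crossed : ε ≈ 0# → d ≈ 0# → Favourable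
      even    : ε ≈ 1# → d ≈ 0# → ∀ j → k ≡ j ℕ.+ j → Favourable
      odd     : ε ≈ 1# → d ≈ 1# → ∀ j → k ≡ suc (j ℕ.+ j) → Favourable

    vanishing⇒favourable : Tr k ε + d ≈ 0# → Favourable
    vanishing⇒favourable Tr≈0 = cases (idempotent⇒0∨1 ε-idem) (even⊎odd k)
      where
      d≈Trε : d ≈ Tr k ε
      d≈Trε = sym (+≈0⇒≈ Tr≈0)
      cases : ε ≈ 0# ⊎ ε ≈ 1# → ∃[ j ] (k ≡ j ℕ.+ j ⊎ k ≡ suc (j ℕ.+ j)) → Favourable
      cases (inj₁ ε≈0) (j , inj₁ k≡) = crossed ε≈0 (trans d≈Trε (Tr-k-even j k≡ ε-idem))
      cases (inj₁ ε≈0) (j , inj₂ k≡) = crossed ε≈0 (trans d≈Trε (trans (Tr-k-odd j k≡ ε-idem) ε≈0))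
      cases (inj₂ ε≈1) (j , inj₁ k≡) = even ε≈1 (trans d≈Trε (Tr-k-even j k≡ ε-idem)) j k≡
      cases (inj₂ ε≈1) (j , inj₂ k≡) = odd ε≈1 (trans d≈Trε (trans (Tr-k-odd j k≡ ε-idem) ε≈1)) j k≡

    favourable⇒P-≉0 : Favourable → ∀ {W} → W ≉ 0# → P W ≉ 0#
    favourable⇒P-≉0 fav {W} W≉0 PW≈0 = W≉0 (y₁≈0∧y₂≈0⇒≈0 (proj₁ (both fav)) (proj₂ (both fav)))
      where
      P̄W≈0 : conj (P W) ≈ 0#
      P̄W≈0 = trans (Fr-cong k PW≈0) (Fr-0 k)
      vanish : ∀ {x p r} → p ≈ 0# → r ≈ 0# → a * x ≈ (v + 1#) * (ω + 1#) * p + v * ω * r → x ≈ 0#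
      vanish p≈0 r≈0 eq = no-zero-divisorʳ a≉0 (trans eq (trans (+-cong (*-congˡ p≈0) (*-congˡ r≈0))
        (trans (+-cong (zeroʳ _) (zeroʳ _)) (+-identityʳ 0#))))
      E₁≈0 : E₁ W ≈ 0#
      E₁≈0 = vanish PW≈0 P̄W≈0 (aE₁ W)
      E₂≈0 : E₂ W ≈ 0#
      E₂≈0 = vanish P̄W≈0 PW≈0 (aE₂ W)
      straight : ε ≈ 1# → y₁ W ≈ 0# × y₂ W ≈ 0#
      straight ε≈1 = σ*-self-zero (trans (sym (E₁-straight ε≈1 W)) E₁≈0) , σ*-self-zero (trans (sym (E₂-straight ε≈1 W)) E₂≈0)
      both : Favourable → y₁ W ≈ 0# × y₂ W ≈ 0#
      both (even ε≈1 _ _ _) = straight ε≈1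
      both (odd  ε≈1 _ _ _) = straight ε≈1
      both (crossed ε≈0 d≈0) =
        [ (λ y₁≈0 → y₁≈0 , trans (sym (ȳ₁≈y₂ d≈0 W)) (trans (Fr-cong k y₁≈0) (Fr-0 k)))
        , (λ y₂≈0 → trans (sym (ȳ₂≈y₁ d≈0 W)) (trans (Fr-cong k y₂≈0) (Fr-0 k)) , y₂≈0)
        ]′ (σ*-zero (trans (sym (E₁-crossed ε≈0 W)) E₁≈0))

    module _ {V W} (V≉0 : V ≉ 0#) (W≉0 : W ≉ 0#) (proportional : P V * N W ≈ P W * N V) where
      private
        -- A / B compares the affine coordinate y₁ / y₂ of V with that of W. A = B means that V and
        -- W lie on one 𝔽_q-line.
        A B : Carrier
        A = y₁ V * y₂ W
        B = y₁ W * y₂ V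

      A+B : A + B ≈ V * conj W + conj V * W
      A+B = solve 5 (λ w V V′ W W′ → (w :* V :+ (w :+ :1) :* V′) :* (w :* W′ :+ (w :+ :1) :* W)
                                  :+ (w :* W :+ (w :+ :1) :* W′) :* (w :* V′ :+ (w :+ :1) :* V)
                                  := V :* W′ :+ V′ :* W) refl w V (conj V) W (conj W)

      conj-proportional : conj (P V) * N W ≈ conj (P W) * N V
      conj-proportional = trans (*-congˡ (sym (conj-N W))) (trans (sym (Fr-* k (P V) (N W)))
        (trans (Fr-cong k proportional) (trans (Fr-* k (P W) (N V)) (*-congˡ (conj-N V)))))

      combine-proportional : ∀ {p p′ r r′ x x′ α β} → a * x ≈ α * p + β * r → a * x′ ≈ α * p′ + β * r′ →
                             p * N W ≈ p′ * N V → r * N W ≈ r′ * N V → x * N W ≈ x′ * N V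
      combine-proportional {p} {p′} {r} {r′} {x} {x′} {α} {β} ax ax′ pN rN = *-cancelˡ a≉0 (begin
        a * (x * N W)                            ≈⟨ *-assoc a x _ ⟨
        a * x * N W                              ≈⟨ *-congʳ ax ⟩
        (α * p + β * r) * N W
          ≈⟨ solve 5 (λ α p β r n → (α :* p :+ β :* r) :* n := α :* (p :* n) :+ β :* (r :* n)) refl α p β r (N W) ⟩
        α * (p * N W) + β * (r * N W)            ≈⟨ +-cong (*-congˡ pN) (*-congˡ rN) ⟩
        α * (p′ * N V) + β * (r′ * N V)
          ≈⟨ solve 5 (λ α p β r n → (α :* p :+ β :* r) :* n := α :* (p :* n) :+ β :* (r :* n)) refl α p′ β r′ (N V) ⟨
        (α * p′ + β * r′) * N V                  ≈⟨ *-congʳ ax′ ⟨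
        a * x′ * N V                             ≈⟨ *-assoc a x′ _ ⟩
        a * (x′ * N V)                           ∎)

      E₁E₂ : E₁ V * E₂ W ≈ E₁ W * E₂ V
      E₁E₂ = *-cancelʳ (*-≉0 (N-≉0 W≉0) (N-≉0 V≉0)) (begin
        E₁ V * E₂ W * (N W * N V)
          ≈⟨ solve 4 (λ x y m n → x :* y :* (m :* n) := x :* m :* (y :* n)) refl (E₁ V) (E₂ W) (N W) (N V) ⟩
        E₁ V * N W * (E₂ W * N V)      ≈⟨ *-cong (combine-proportional (aE₁ V) (aE₁ W) proportional conj-proportional)
                                            (sym (combine-proportional (aE₂ V) (aE₂ W) conj-proportional proportional)) ⟩
        E₁ W * N V * (E₂ V * N W)
          ≈⟨ solve 4 (λ x y m n → x :* y :* (m :* n) := x :* n :* (y :* m)) refl (E₁ W) (E₂ V) (N W) (N V) ⟨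
        E₁ W * E₂ V * (N W * N V)      ∎)

      conj-A≈B : d ≈ 0# → conj A ≈ B
      conj-A≈B d≈0 = trans (Fr-* k (y₁ V) (y₂ W)) (trans (*-cong (ȳ₁≈y₂ d≈0 V) (ȳ₂≈y₁ d≈0 W)) (*-comm _ _))

      conj-B≈A : d ≈ 0# → conj B ≈ A
      conj-B≈A d≈0 = trans (Fr-* k (y₁ W) (y₂ V)) (trans (*-cong (ȳ₁≈y₂ d≈0 W) (ȳ₂≈y₁ d≈0 V)) (*-comm _ _))

      -- Here E₁ / E₂ is (y₁ / y₂)^(Q-1), so equal values give σ A * B = A * σ B. Conjugation
      -- exchanges A and B, so they vanish together.
      crossed-equal : ε ≈ 0# → d ≈ 0# → A ≈ B
      crossed-equal ε≈0 d≈0 = go (≈-dec A 0#) (≈-dec B 0#)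
        where
        go : Dec (A ≈ 0#) → Dec (B ≈ 0#) → A ≈ B
        go (yes A≈0) _ = trans A≈0 (sym (trans (sym (conj-A≈B d≈0)) (trans (Fr-cong k A≈0) (Fr-0 k))))
        go (no _) (yes B≈0) = trans (trans (sym (conj-B≈A d≈0)) (trans (Fr-cong k B≈0) (Fr-0 k))) (sym B≈0)
        go (no A≉0) (no B≉0) = σ-ratio A≉0 B≉0 (begin
          σ A * B                                    ≈⟨ *-congʳ (Fr-* ℓ (y₁ V) (y₂ W)) ⟩
          σ (y₁ V) * σ (y₂ W) * (y₁ W * y₂ V)
            ≈⟨ solve 4 (λ x y z u → x :* y :* (z :* u) := x :* u :* (y :* z)) refl _ _ _ _ ⟩
          σ (y₁ V) * y₂ V * (σ (y₂ W) * y₁ W)        ≈⟨ *-cong (E₁-crossed ε≈0 V) (E₂-crossed ε≈0 W) ⟨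
          E₁ V * E₂ W                                ≈⟨ E₁E₂ ⟩
          E₁ W * E₂ V                                ≈⟨ *-cong (E₁-crossed ε≈0 W) (E₂-crossed ε≈0 V) ⟩
          σ (y₁ W) * y₂ W * (σ (y₂ V) * y₁ V)
            ≈⟨ solve 4 (λ x y z u → x :* y :* (z :* u) := u :* y :* (x :* z)) refl _ _ _ _ ⟩
          A * (σ (y₁ W) * σ (y₂ V))                  ≈⟨ *-congˡ (Fr-* ℓ (y₁ W) (y₂ V)) ⟨
          A * σ B                                    ∎)

      -- Here E₁ / E₂ is (y₁ / y₂)^(Q+1), so x = A / B satisfies x^(Q+1) = 1. Then σ σ x = x, which
      -- places x in 𝔽₄; excluding the nontrivial values is left to the caller.
      straight-equal : ε ≈ 1# → (∀ {x} → B ≉ 0# → x ≉ 0# → x * B ≈ A → Fixed 2 x → x ≈ 1#) → A ≈ B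
      straight-equal ε≈1 fixed-2⇒1 = go (≈-dec A 0#) (≈-dec B 0#)
        where
        σAA≈σBB : σ A * A ≈ σ B * B
        σAA≈σBB = begin
          σ A * A                                    ≈⟨ *-congʳ (Fr-* ℓ (y₁ V) (y₂ W)) ⟩
          σ (y₁ V) * σ (y₂ W) * (y₁ V * y₂ W)
            ≈⟨ solve 4 (λ x y z u → x :* y :* (z :* u) := x :* z :* (y :* u)) refl _ _ _ _ ⟩
          σ (y₁ V) * y₁ V * (σ (y₂ W) * y₂ W)        ≈⟨ *-cong (E₁-straight ε≈1 V) (E₂-straight ε≈1 W) ⟨
          E₁ V * E₂ W                                ≈⟨ E₁E₂ ⟩
          E₁ W * E₂ V                                ≈⟨ *-cong (E₁-straight ε≈1 W) (E₂-straight ε≈1 V) ⟩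
          σ (y₁ W) * y₁ W * (σ (y₂ V) * y₂ V)
            ≈⟨ solve 4 (λ x y z u → x :* y :* (z :* u) := x :* z :* (y :* u)) refl _ _ _ _ ⟩
          σ (y₁ W) * σ (y₂ V) * (y₁ W * y₂ V)        ≈⟨ *-congʳ (Fr-* ℓ (y₁ W) (y₂ V)) ⟨
          σ B * B                                    ∎
        go : Dec (A ≈ 0#) → Dec (B ≈ 0#) → A ≈ B
        go (yes A≈0) _ = trans A≈0 (sym (σ*-self-zero (trans (sym σAA≈σBB) (trans (*-congˡ A≈0) (zeroʳ _)))))
        go (no _) (yes B≈0) = trans (σ*-self-zero (trans σAA≈σBB (trans (*-congˡ B≈0) (zeroʳ _)))) (sym B≈0)
        go (no A≉0) (no B≉0) = trans (sym xB≈A) (trans (*-congʳ (fixed-2⇒1 B≉0 x≉0 xB≈A (σσ-fixed⇒fixed-2 σσx≈x))) (*-identityˡ B))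
          where
          x = B ⁻¹ * A
          x≉0 = *-≉0 (⁻¹-≉0 B≉0) A≉0
          xB≈A : x * B ≈ A
          xB≈A = trans (*-comm x B) (cancel-⁻¹ʳ A B≉0)
          σx*x≈1 : σ x * x ≈ 1#
          σx*x≈1 = *-cancelʳ (*-≉0 (Fr-≉0 ℓ B≉0) B≉0) (begin
            σ x * x * (σ B * B)        ≈⟨ solve 4 (λ s x t b → s :* x :* (t :* b) := s :* t :* (x :* b)) refl _ x _ B ⟩
            σ x * σ B * (x * B)        ≈⟨ *-cong (trans (sym (Fr-* ℓ x B)) (Fr-cong ℓ xB≈A)) xB≈A ⟩
            σ A * A                    ≈⟨ σAA≈σBB ⟩
            σ B * B                    ≈⟨ *-identityˡ _ ⟨
            1# * (σ B * B)             ∎)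
          σσx≈x : σ (σ x) ≈ x
          σσx≈x = *-cancelʳ (Fr-≉0 ℓ x≉0) (begin
            σ (σ x) * σ x              ≈⟨ Fr-* ℓ (σ x) x ⟨
            σ (σ x * x)                ≈⟨ trans (Fr-cong ℓ σx*x≈1) (Fr-1 ℓ) ⟩
            1#                         ≈⟨ trans (*-comm x _) σx*x≈1 ⟨
            x * σ x                    ∎)

      favourable⇒A≈B : Favourable → A ≈ B
      favourable⇒A≈B (crossed ε≈0 d≈0) = crossed-equal ε≈0 d≈0
      favourable⇒A≈B (even ε≈1 d≈0 j k≡j+j) = straight-equal ε≈1 x≈1
        where
        -- Conjugation exchanges A and B, so x x̄ = 1. For even k, 𝔽₄ lies in 𝔽_q, so x is real and
        -- x² = 1.
        x≈1 : ∀ {x} → B ≉ 0# → x ≉ 0# → x * B ≈ A → Fixed 2 x → x ≈ 1#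
        x≈1 {x} B≉0 _ xB≈A fix₂ = ²-injective (*-cancelʳ B≉0 (begin
          x * x * B            ≈⟨ *-assoc x x B ⟩
          x * (x * B)          ≈⟨ *-cong (sym x-real) xB≈A ⟩
          conj x * A           ≈⟨ *-congˡ (conj-B≈A d≈0) ⟨
          conj x * conj B      ≈⟨ Fr-* k x B ⟨
          conj (x * B)         ≈⟨ Fr-cong k xB≈A ⟩
          conj A               ≈⟨ conj-A≈B d≈0 ⟩
          B                    ≈⟨ solve 1 (λ b → b := :1 :* :1 :* b) refl B ⟩
          1# * 1# * B          ∎))
          where
          x-real : conj x ≈ x
          x-real = ≡.subst (λ i → Fixed i x) (≡.sym (≡.trans k≡j+j (j+j≡j*2 j))) (fixed-*-multiple j 2 fix₂)
      favourable⇒A≈B (odd ε≈1 d≈1 j k≡1+j+j) = straight-equal ε≈1 x≈1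
        where
        -- A and B are real, so x lies in both 𝔽₄ and 𝔽_q, which meet in 𝔽₂ for odd k.
        x≈1 : ∀ {x} → B ≉ 0# → x ≉ 0# → x * B ≈ A → Fixed 2 x → x ≈ 1#
        x≈1 {x} B≉0 x≉0 xB≈A fix₂ = [ (λ x≈0 → contradiction x≈0 x≉0) , id ]′
          (idempotent⇒0∨1 (fixed-1⇒idempotent (fixed-cancel 1 (j ℕ.* 2) (fixed-*-multiple j 2 fix₂)
            (≡.subst (λ i → Fixed i x) (≡.trans k≡1+j+j (≡.cong suc (j+j≡j*2 j))) x-real))))
          where
          x-real : conj x ≈ x
          x-real = *-cancelʳ B≉0 (begin
            conj x * B           ≈⟨ *-congˡ (trans (Fr-* k (y₁ W) (y₂ V)) (*-cong (ȳ₁≈y₁ d≈1 W) (ȳ₂≈y₂ d≈1 V))) ⟨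
            conj x * conj B      ≈⟨ Fr-* k x B ⟨
            conj (x * B)         ≈⟨ Fr-cong k xB≈A ⟩
            conj A               ≈⟨ trans (Fr-* k (y₁ V) (y₂ W)) (*-cong (ȳ₁≈y₁ d≈1 V) (ȳ₂≈y₂ d≈1 W)) ⟩
            A                    ≈⟨ xB≈A ⟨
            x * B                ∎)

    vanishing⇒permutes : Tr k (a / (a + b + 1#)) ≈ 0# → Bijective _≈_ _≈_ f
    vanishing⇒permutes Tr≈0 = permutes (favourable⇒P-≉0 fav) λ V≉0 W≉0 proportional →
      +≈0⇒≈ (trans (sym (A+B V≉0 W≉0 proportional)) (≈⇒+≈0 (favourable⇒A≈B V≉0 W≉0 proportional fav)))
      where
      fav : Favourable
      fav = vanishing⇒favourable (trans (sym Tr[a/[a+b+1]]) Tr≈0)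

    cube-root : ∃[ ρ ] ρ ² + ρ ≈ 1#
    cube-root = artin-schreier (trans (reflexive (≡.cong (λ i → Tr (k ℕ.+ i) 1#) (ℕ.+-identityʳ k))) (Tr-double k (Fr-1 k)))

    module _ (f-inj : Injective _≈_ _≈_ f) where
      open Injective⇒ f-inj

      -- When w̄ = w + 1, the element w + 1 is a zero of y₁. For ε = 0 both E₁ and E₂ contain the
      -- factor y₁ or its σ-image, so P vanishes there.
      ¬crossed-split : ε ≈ 0# → ¬ d ≈ 1#
      ¬crossed-split ε≈0 d≈1 = P-≉0 w+1≉0 (begin
        P (w + 1#)
          ≈⟨ P≈ (w + 1#) ⟩
        κ * ((v + 1#) * (ω + 1#) * E₁ (w + 1#) + v * ω * E₂ (w + 1#))
          ≈⟨ *-congˡ (+-cong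
               (*-congˡ (trans (*-congʳ (trans (Fr-cong ℓ y₁≈0) (Fr-0 ℓ))) (zeroˡ _)))
               (*-congˡ (trans (E₂-crossed ε≈0 (w + 1#)) (trans (*-congˡ y₁≈0) (zeroʳ _))))) ⟩
        κ * ((v + 1#) * (ω + 1#) * 0# + v * ω * 0#)
          ≈⟨ solve 3 (λ m x y → m :* (x :* :0 :+ y :* :0) := :0) refl κ _ _ ⟩
        0# ∎)
        where
        w+1≉0 : w + 1# ≉ 0#
        w+1≉0 eq = θ≉0 (trans (sym w²+w) (trans (solve 1 (λ w → w :* w :+ w := w :* (w :+ :1)) refl w) (trans (*-congˡ eq) (zeroʳ w))))
        y₁≈0 : y₁ (w + 1#) ≈ 0#
        y₁≈0 = trans (form-cong refl refl (trans (Fr-+ k w 1#) (+-cong (d≈1⇒w̄≈w+1 d≈1) (Fr-1 k))))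
          (solve 1 (λ w → w :* (w :+ :1) :+ (w :+ :1) :* (w :+ :1 :+ :1) := :0) refl w)

      -- form w r s and form w 1 1 = 1 have the same image under P.
      collision : ε ≈ 1# → ∀ {r s} → σ r * r ≈ 1# → σ s * s ≈ 1# → conj (form w r s) ≈ form w s r → r ≈ s
      collision ε≈1 {r} {s} Nr≈1 Ns≈1 W̄≈ = +≈0⇒≈ (begin
        r + s
          ≈⟨ solve 3 (λ w r s → r :+ s := w :* r :+ (w :+ :1) :* s :+ (w :* s :+ (w :+ :1) :* r)) refl w r s ⟩
        W + form w s r                 ≈⟨ +-congˡ W̄≈ ⟨
        W + conj W                     ≈⟨ ≈⇒+≈0 W≈W̄ ⟩
        0#                             ∎)
        where
        W = form w r s
        y₁W≈r : y₁ W ≈ r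
        y₁W≈r = trans (form-cong refl refl W̄≈)
          (solve 3 (λ w r s → w :* (w :* r :+ (w :+ :1) :* s) :+ (w :+ :1) :* (w :* s :+ (w :+ :1) :* r) := r) refl w r s)
        y₂W≈s : y₂ W ≈ s
        y₂W≈s = trans (form-cong refl W̄≈ refl)
          (solve 3 (λ w r s → w :* (w :* s :+ (w :+ :1) :* r) :+ (w :+ :1) :* (w :* r :+ (w :+ :1) :* s) := s) refl w r s)
        W≉0 : W ≉ 0#
        W≉0 W≈0 = 1≉0 (trans (sym Nr≈1) (trans (*-congˡ (trans (sym y₁W≈r)
          (trans (form-cong refl W≈0 (trans (Fr-cong k W≈0) (Fr-0 k))) (solve 1 (λ w → w :* :0 :+ (w :+ :1) :* :0 := :0) refl w)))) (zeroʳ _)))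
        norm-1 : ∀ {y z} → y ≈ z → σ z * z ≈ 1# → σ y * y ≈ 1#
        norm-1 y≈z eq = trans (*-cong (Fr-cong ℓ y≈z) y≈z) eq
        form-1 : ∀ {x y} → x ≈ 1# → y ≈ 1# → form w x y ≈ 1#
        form-1 x≈1 y≈1 = trans (form-cong refl x≈1 y≈1) (solve 1 (λ w → w :* :1 :+ (w :+ :1) :* :1 := :1) refl w)
        σ1*1 : σ 1# * 1# ≈ 1#
        σ1*1 = trans (*-identityʳ _) (Fr-1 ℓ)
        P-of : ∀ {X} → σ (y₁ X) * y₁ X ≈ 1# → σ (y₂ X) * y₂ X ≈ 1# → P X ≈ κ * ((v + 1#) * (ω + 1#) * 1# + v * ω * 1#)
        P-of {X} e₁ e₂ = trans (P≈ X) (*-congˡ (+-cong (*-congˡ (trans (E₁-straight ε≈1 X) e₁)) (*-congˡ (trans (E₂-straight ε≈1 X) e₂))))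
        PW≈P1 : P W ≈ P 1#
        PW≈P1 = trans (P-of (norm-1 y₁W≈r Nr≈1) (norm-1 y₂W≈s Ns≈1))
          (sym (P-of (norm-1 (form-1 refl (Fr-1 k)) σ1*1) (norm-1 (form-1 (Fr-1 k) refl) σ1*1)))
        W≈W̄ : W ≈ conj W
        W≈W̄ = begin
          W                  ≈⟨ trans (*-congˡ (Fr-1 k)) (*-identityʳ W) ⟨
          W * conj 1#
            ≈⟨ P-projectively-injective W≉0 1≉0 (trans (*-congʳ PW≈P1) (trans (*-comm _ _) (*-congʳ (Fr-cong k (sym PW≈P1))))) ⟩
          conj W * 1#        ≈⟨ *-identityʳ _ ⟩
          conj W             ∎

      private
        ρ : Carrier
        ρ = proj₁ cube-root
        ρ²+ρ = proj₂ cube-root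

        -- As ℓ is odd, σ sends ρ to its inverse ρ + 1, so ρ^(Q+1) = 1: the obstruction to
        -- injectivity of y^(Q+1).
        σρ : σ ρ ≈ ρ + 1#
        σρ = trans (Fr-parity ℓ ρ²+ρ) (+-congˡ (Tr-ℓ (*-identityʳ 1#)))

        Nρ : σ ρ * ρ ≈ 1#
        Nρ = trans (*-congʳ σρ) (trans (solve 1 (λ r → (r :+ :1) :* r := r :* r :+ r) refl ρ) ρ²+ρ)

        N[ρ+1] : σ (ρ + 1#) * (ρ + 1#) ≈ 1#
        N[ρ+1] = trans (*-congʳ (trans (Fr-+ ℓ ρ 1#) (+-cong σρ (Fr-1 ℓ))))
          (trans (solve 1 (λ r → (r :+ :1 :+ :1) :* (r :+ :1) := r :* r :+ r) refl ρ) ρ²+ρ)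

      -- For even k, ρ is real, so it is an admissible coordinate on a line whose coordinates are
      -- real; the pair (ρ, 1) collides with (1, 1).
      ¬even-split : ε ≈ 1# → d ≈ 1# → ∀ j → ¬ k ≡ j ℕ.+ j
      ¬even-split ε≈1 d≈1 j k≡ = 1≉0 (trans (sym ρ²+ρ) (trans (+-cong (*-cong ρ≈1 ρ≈1) ρ≈1) (solve 0 (:1 :* :1 :+ :1 := :0) refl)))
        where
        ρ-real : conj ρ ≈ ρ
        ρ-real = trans (Fr-parity k ρ²+ρ) (trans (+-congˡ (Tr-k-even j k≡ (*-identityʳ 1#))) (+-identityʳ ρ))
        ρ≈1 : ρ ≈ 1#
        ρ≈1 = collision ε≈1 Nρ (trans (*-identityʳ _) (Fr-1 ℓ))
          (trans (Fr-form k w ρ 1#) (trans (form-flip d≈1 (d≈1⇒w̄≈w+1 d≈1)) (form-cong refl (Fr-1 k) ρ-real)))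

      -- For odd k, conjugation exchanges ρ and ρ + 1, just as it exchanges the coordinates when d =
      -- 0; the pair (ρ, ρ + 1) collides with (1, 1).
      ¬odd-nonsplit : ε ≈ 1# → d ≈ 0# → ∀ j → ¬ k ≡ suc (j ℕ.+ j)
      ¬odd-nonsplit ε≈1 d≈0 j k≡ = 1≉0 (trans (solve 1 (λ r → :1 := r :+ (r :+ :1)) refl ρ) (≈⇒+≈0 ρ≈ρ+1))
        where
        ρ̄ : conj ρ ≈ ρ + 1#
        ρ̄ = trans (Fr-parity k ρ²+ρ) (+-congˡ (Tr-k-odd j k≡ (*-identityʳ 1#)))
        ρ≈ρ+1 : ρ ≈ ρ + 1#
        ρ≈ρ+1 = collision ε≈1 Nρ N[ρ+1] (trans (Fr-form k w ρ (ρ + 1#)) (form-cong (d≈0⇒w-real d≈0) ρ̄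
          (trans (Fr-+ k ρ 1#) (trans (+-cong ρ̄ (Fr-1 k)) (solve 1 (λ r → r :+ :1 :+ :1 := r) refl ρ)))))

      permutes⇒vanishing : Tr k (a / (a + b + 1#)) ≈ 0#
      permutes⇒vanishing = trans Tr[a/[a+b+1]] (cases (idempotent⇒0∨1 ε-idem) (idempotent⇒0∨1 d-idem) (even⊎odd k))
        where
        cases : ε ≈ 0# ⊎ ε ≈ 1# → d ≈ 0# ⊎ d ≈ 1# → ∃[ j ] (k ≡ j ℕ.+ j ⊎ k ≡ suc (j ℕ.+ j)) → Tr k ε + d ≈ 0#
        cases (inj₁ ε≈0) (inj₂ d≈1) _ = contradiction d≈1 (¬crossed-split ε≈0)
        cases _ (inj₁ d≈0) (j , inj₁ k≡) = trans (+-cong (Tr-k-even j k≡ ε-idem) d≈0) (+-identityʳ 0#)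
        cases (inj₂ ε≈1) (inj₂ d≈1) (j , inj₁ k≡) = contradiction k≡ (¬even-split ε≈1 d≈1 j)
        cases (inj₁ ε≈0) (inj₁ d≈0) (j , inj₂ k≡) = ≈⇒+≈0 (trans (Tr-k-odd j k≡ ε-idem) (trans ε≈0 (sym d≈0)))
        cases (inj₂ ε≈1) (inj₁ d≈0) (j , inj₂ k≡) = contradiction k≡ (¬odd-nonsplit ε≈1 d≈0 j)
        cases (inj₂ ε≈1) (inj₂ d≈1) (j , inj₂ k≡) = ≈⇒+≈0 (trans (Tr-k-odd j k≡ ε-idem) (trans ε≈1 (sym d≈1)))

-- Elements of the subfield, and the equivalence

module SubfieldProperties {c e p} (K : Field c e) (_≟_ : Decidable (Field._≈_ K)) (F : Subfield K p) where
  open FieldProperties K _≟_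
  open Subfield F

  ^-closed : ∀ {x} n → x ∈ → (x ^ n) ∈
  ^-closed zero    x∈ = 1∈
  ^-closed (suc n) x∈ = *-closed x∈ (^-closed n x∈)

  subfield-fermat : ∀ {n} → HasOrder elements n → ∀ {x} → x ∈ → x ≉ 0# → x ^ n ≈ x
  subfield-fermat order {x} x∈ x≉0 = fermat (proj₁ ∘ from) enum-injective (to (0# , 0∈)) (strictlyInverseʳ _) x≉0
    (λ i → to (x * proj₁ (from i) , *-closed x∈ (proj₂ (from i)))) (λ i → strictlyInverseʳ _)
    where
    open Inverse order
    enum-injective : Injective _≡_ _≈_ (proj₁ ∘ from)
    enum-injective {i} {j} eq = ≡.trans (≡.sym (strictlyInverseˡ i)) (≡.trans (to-cong eq) (strictlyInverseˡ j))

module Equivalence {c e p} (K : Field c e) (k ℓ : ℕ) .{{_ : NonZero k}} .{{_ : NonZero ℓ}}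
         .{{_ : NonZero (2 ℕ.* k)}} (order : HasOrder (Field.setoid K) (2 ℕ.^ (2 ℕ.* k)))
         (coprime : gcd (2 ℕ.* k) ℓ ≡ 1) (F : Subfield K p) (order-F : HasOrder (Subfield.elements F) (2 ℕ.^ k)) where
  open CoprimeFrobenius K k ℓ order coprime
  open Subfield F renaming (_∈ to _∈𝔽q)
  open SubfieldProperties K ≈-dec F
  open FieldNotions K using (_∈𝔽₂)
  open SetoidReasoning setoid

  ∈𝔽q⇒real : ∀ {x} → x ∈𝔽q → x ≉ 0# → conj x ≈ x
  ∈𝔽q⇒real = subfield-fermat order-F

  σ-iterates : ∀ {b lam} → b ∈𝔽q → σ lam ≈ b * lam → ∀ j → ∃[ β ] β ∈𝔽q × Fr (j ℕ.* ℓ) lam ≈ β * lam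
  σ-iterates b∈ eq zero = 1# , 1∈ , trans (*-identityʳ _) (sym (*-identityˡ _))
  σ-iterates {b} {lam} b∈ eq (suc j) with σ-iterates b∈ eq j
  ... | β , β∈ , iterate = σ β * b , *-closed (^-closed Q β∈) b∈ , (begin
    Fr (ℓ ℕ.+ j ℕ.* ℓ) lam      ≈⟨ Fr-∘ ℓ (j ℕ.* ℓ) lam ⟨
    σ (Fr (j ℕ.* ℓ) lam)        ≈⟨ Fr-cong ℓ iterate ⟩
    σ (β * lam)                 ≈⟨ Fr-* ℓ β lam ⟩
    σ β * σ lam                 ≈⟨ *-congˡ eq ⟩
    σ β * (b * lam)             ≈⟨ *-assoc _ b lam ⟨
    σ β * b * lam               ∎)

  -- Iterating σ multiplies λ by elements of 𝔽_q, and by Bézout some iterate of σ is the Frobenius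
  -- or its inverse. So λ² = β λ or (β λ)² = λ, and λ is β or the inverse of β²; membership follows
  -- from closure.
  σ-eigenvector∈𝔽q : ∀ {b lam} → b ∈𝔽q → lam ≉ 0# → σ lam ≈ b * lam → lam ∈𝔽q
  σ-eigenvector∈𝔽q {b} {lam} b∈ lam≉0 eq with Coprimality.coprime-Bézout (Coprimality.gcd≡1⇒coprime coprime)
  ... | Bézout.-+ x y 1+x2k≡yℓ with σ-iterates b∈ eq y
  ...   | β , β∈ , iterate = ∈-resp (*-cancelʳ lam≉0 (begin
    β * lam                         ≈⟨ iterate ⟨
    Fr (y ℕ.* ℓ) lam                ≡⟨ ≡.cong (λ i → Fr i lam) 1+x2k≡yℓ ⟨
    Fr (1 ℕ.+ x ℕ.* (2 ℕ.* k)) lam  ≈⟨ Fr-∘ 1 (x ℕ.* (2 ℕ.* k)) lam ⟨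
    Fr 1 (Fr (x ℕ.* (2 ℕ.* k)) lam) ≈⟨ Fr-cong 1 (fixed-*-multiple x (2 ℕ.* k) (fixed-order lam)) ⟩
    lam * (lam * 1#)                ≈⟨ *-congˡ (*-identityʳ lam) ⟩
    lam * lam                       ∎)) β∈
  σ-eigenvector∈𝔽q {b} {lam} b∈ lam≉0 eq | Bézout.+- x y 1+yℓ≡x2k with σ-iterates b∈ eq y
  ...   | β , β∈ , iterate = ∈-resp (sym lam≈) (⁻¹-closed β²≉0 (*-closed β∈ β∈))
    where
    β²lam≈1 : β * β * lam ≈ 1#
    β²lam≈1 = *-cancelʳ lam≉0 (begin
      β * β * lam * lam               ≈⟨ solve 2 (λ b l → b :* b :* l :* l := b :* l :* (b :* l)) refl β lam ⟩
      β * lam * (β * lam)             ≈⟨ *-congˡ (*-identityʳ _) ⟨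
      Fr 1 (β * lam)                  ≈⟨ Fr-cong 1 iterate ⟨
      Fr 1 (Fr (y ℕ.* ℓ) lam)         ≈⟨ Fr-∘ 1 (y ℕ.* ℓ) lam ⟩
      Fr (1 ℕ.+ y ℕ.* ℓ) lam          ≡⟨ ≡.cong (λ i → Fr i lam) 1+yℓ≡x2k ⟩
      Fr (x ℕ.* (2 ℕ.* k)) lam        ≈⟨ fixed-*-multiple x (2 ℕ.* k) (fixed-order lam) ⟩
      lam                             ≈⟨ *-identityˡ lam ⟨
      1# * lam                        ∎)
    β²≉0 : β * β ≉ 0#
    β²≉0 = factor-≉0ˡ (≉0-resp (sym β²lam≈1) 1≉0)
    lam≈ : lam ≈ (β * β) ⁻¹
    lam≈ = *-cancelˡ β²≉0 (trans β²lam≈1 (sym (*-inverseʳ _ β²≉0)))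

  -- λ^(Q - 2^j) is λ^Q times the 2^j-th power of 1 / λ. As j runs from 1 to ℓ rather than from 0,
  -- the trace is taken at the square of 1 / λ.
  power-sum≈κTr : ∀ {lam} → lam ≉ 0# →
    ∑[ i < ℓ ] (lam ^ (Q ℕ.∸ 2 ℕ.^ (toℕ i ℕ.+ 1))) ≈ σ lam * Tr ℓ ((lam ⁻¹) ²)
  power-sum≈κTr {lam} lam≉0 = trans (sum-cong-≋ {ℓ} term)
    (sym (*-distribˡ-sum {ℓ} (σ lam) (λ i → ((lam ⁻¹) ²) ^ (2 ℕ.^ toℕ i))))
    where
    term : ∀ i → lam ^ (Q ℕ.∸ 2 ℕ.^ (toℕ i ℕ.+ 1)) ≈ σ lam * Fr (toℕ i) ((lam ⁻¹) ²)
    term i = *-cancelʳ (Fr-≉0 j lam≉0) (begin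
      lam ^ (Q ℕ.∸ 2 ℕ.^ (toℕ i ℕ.+ 1)) * Fr j lam
        ≡⟨ ≡.cong (λ n → lam ^ (Q ℕ.∸ 2 ℕ.^ n) * Fr j lam) (ℕ.+-comm (toℕ i) 1) ⟩
      lam ^ (Q ℕ.∸ 2 ℕ.^ j) * Fr j lam              ≈⟨ ^-homo-* lam (Q ℕ.∸ 2 ℕ.^ j) (2 ℕ.^ j) ⟨
      lam ^ (Q ℕ.∸ 2 ℕ.^ j ℕ.+ 2 ℕ.^ j)             ≡⟨ ≡.cong (lam ^_) (ℕ.m∸n+n≡m (ℕ.^-monoʳ-≤ 2 (Fin.toℕ<n i))) ⟩
      σ lam                                         ≈⟨ *-identityʳ _ ⟨
      σ lam * 1#                                    ≈⟨ *-congˡ (Fr-⁻¹ j lam≉0) ⟨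
      σ lam * (Fr j (lam ⁻¹) * Fr j lam)            ≈⟨ *-assoc _ _ _ ⟨
      σ lam * Fr j (lam ⁻¹) * Fr j lam              ≈⟨ *-congʳ (*-congˡ (Fr-suc (toℕ i) (lam ⁻¹))) ⟩
      σ lam * Fr (toℕ i) ((lam ⁻¹) ²) * Fr j lam    ∎)
      where j = suc (toℕ i)

  module _ (a b : Carrier) (a≉0 : a ≉ 0#) (b∈ : b ∈𝔽q) (b≉0 : b ≉ 0#) (a+b≉1 : a + b ≉ 1#) where
    open Quadrinomial a b using (f)
    open PermutesForcesShape K k ℓ order coprime using (permutes⇒λ)

    Conditions : Carrier → Carrier → Set _
    Conditions lam ε = lam ∈𝔽q × ε ∈𝔽₂ × lam ^ Q-1 ≈ b ×
      a ≈ ε * lam ^ Q + ∑[ i < ℓ ] (lam ^ (Q ℕ.∸ 2 ℕ.^ (toℕ i ℕ.+ 1))) ×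
      Tr k (a / (a + b + 1#)) ≈ 0#

    b-real : conj b ≈ b
    b-real = ∈𝔽q⇒real b∈ b≉0

    permutes⇒conditions : Bijective _≈_ _≈_ f → ∃[ lam ] ∃[ ε ] Conditions lam ε
    permutes⇒conditions (f-inj , _) = lam , ε , lam∈ , idempotent⇒0∨1 ε-idem ,
      *-cancelˡ lam≉0 (trans (W*ψW≈σW lam) (trans σlam≈ (*-comm b lam))) ,
      trans a≈ (+-congˡ (sym (power-sum≈κTr lam≉0))) ,
      NormalForm.permutes⇒vanishing K k ℓ order coprime a b lam ε a≉0 b-real lam≉0 (∈𝔽q⇒real lam∈ lam≉0) ε-idem σlam≈ a≈ f-inj
      where
      shape = permutes⇒λ a b a≉0 b≉0 b-real f-inj
      lam = proj₁ shape
      σlam≈ = proj₁ (proj₂ shape)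
      aκ≈ = proj₂ (proj₂ shape)
      -- a λ^Q is the square of a + b + 1, so this is where a + b ≠ 1 enters.
      lam≉0 : lam ≉ 0#
      lam≉0 lam≈0 = a+b≉1 (+≈0⇒≈ (²-injective (begin
        (a + b + 1#) ²          ≈⟨ solve 2 (λ a b → (a :+ b :+ :1) :* (a :+ b :+ :1) := a :* a :+ b :* b :+ :1) refl a b ⟩
        a ² + b ² + 1#          ≈⟨ aκ≈ ⟨
        a * σ lam               ≈⟨ trans (*-congˡ (trans (Fr-cong ℓ lam≈0) (Fr-0 ℓ))) (zeroʳ a) ⟩
        0#                      ≈⟨ zeroˡ 0# ⟨
        0# ²                    ∎)))
      lam∈ = σ-eigenvector∈𝔽q b∈ lam≉0 σlam≈
      κ θ τ α ε : Carrier
      κ = σ lam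
      θ = lam ⁻¹
      τ = Tr ℓ (θ ²)
      α = κ ⁻¹ * a
      -- Condition (2) solved for ε; what remains is that this value lies in 𝔽₂.
      ε = α + τ
      κ≉0 = Fr-≉0 ℓ lam≉0
      κα≈a : κ * α ≈ a
      κα≈a = cancel-⁻¹ʳ a κ≉0
      a≈ : a ≈ ε * κ + κ * τ
      a≈ = trans (sym κα≈a) (solve 3 (λ m x t → m :* x := (x :+ t) :* m :+ m :* t) refl κ α τ)
      κθ≈b : κ * θ ≈ b
      κθ≈b = trans (*-congʳ σlam≈) (trans (*-assoc b lam θ) (trans (*-congˡ (*-inverseʳ lam lam≉0)) (*-identityʳ b)))
      κσθ≈1 : κ * σ θ ≈ 1#
      κσθ≈1 = trans (*-comm κ _) (Fr-⁻¹ ℓ lam≉0)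
      -- Dividing a κ = (a + b + 1)² by κ² gives α² + α = (b² + 1) / κ². With b / κ = θ and 1 / κ =
      -- σ θ this is θ² + σ(θ²), which telescopes to τ² + τ.
      α²+α≈τ²+τ : α ² + α ≈ τ ² + τ
      α²+α≈τ²+τ = *-cancelˡ (*-≉0 κ≉0 κ≉0) (begin
        κ * κ * (α ² + α)
          ≈⟨ solve 2 (λ m x → m :* m :* (x :* x :+ x) := m :* x :* (m :* x) :+ m :* x :* m) refl κ α ⟩
        κ * α * (κ * α) + κ * α * κ        ≈⟨ +-cong (*-cong κα≈a κα≈a) (*-congʳ κα≈a) ⟩
        a * a + a * κ                      ≈⟨ +-congˡ aκ≈ ⟩
        a * a + (a ² + b ² + 1#)
          ≈⟨ solve 2 (λ a b → a :* a :+ (a :* a :+ b :* b :+ :1) := b :* b :+ :1 :* :1) refl a b ⟩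
        b * b + 1# * 1#                    ≈⟨ +-cong (*-cong κθ≈b κθ≈b) (*-cong κσθ≈1 κσθ≈1) ⟨
        κ * θ * (κ * θ) + κ * σ θ * (κ * σ θ)
          ≈⟨ solve 3 (λ m x y → m :* x :* (m :* x) :+ m :* y :* (m :* y) := m :* m :* (x :* x :+ y :* y)) refl κ θ (σ θ) ⟩
        κ * κ * (θ ² + σ θ ²)              ≈⟨ *-congˡ (+-congˡ (Fr-* ℓ θ θ)) ⟨
        κ * κ * (θ ² + σ (θ ²))            ≈⟨ *-congˡ (Tr-℘ ℓ (θ ²)) ⟨
        κ * κ * Tr ℓ (θ ² + (θ ²) ²)
          ≈⟨ *-congˡ (trans (Tr-+ ℓ _ _) (trans (+-comm _ _) (+-congʳ (sym (²-Tr ℓ (θ ²)))))) ⟩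
        κ * κ * (τ ² + τ)                  ∎)
      ε-idem : ε ² ≈ ε
      ε-idem = +≈0⇒≈ (trans (solve 2 (λ x t → (x :+ t) :* (x :+ t) :+ (x :+ t) := x :* x :+ x :+ (t :* t :+ t)) refl α τ) (≈⇒+≈0 α²+α≈τ²+τ))

    conditions⇒permutes : ∃[ lam ] ∃[ ε ] Conditions lam ε → Bijective _≈_ _≈_ f
    conditions⇒permutes (lam , ε , lam∈ , ε∈ , lam^≈b , a≈ , Tr≈0) =
      NormalForm.vanishing⇒permutes K k ℓ order coprime a b lam ε a≉0 b-real lam≉0 (∈𝔽q⇒real lam∈ lam≉0)
        (0∨1⇒idempotent ε∈) (trans (sym (W*ψW≈σW lam)) (trans (*-congˡ lam^≈b) (*-comm lam b)))
        (trans a≈ (+-congˡ (power-sum≈κTr lam≉0))) Tr≈0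
      where
      lam≉0 : lam ≉ 0#
      lam≉0 lam≈0 = b≉0 (trans (sym lam^≈b) (trans (ψ-cong lam≈0) (0^ Q-1)))

corollary9p12 :
    ∀ {c e p} (k ℓ : ℕ) .{{_ : NonZero k}} .{{_ : NonZero ℓ}} →
    gcd (2 ℕ.* k) ℓ ≡ 1 →
    let q = 2 ℕ.^ k
        Q = 2 ℕ.^ ℓ
        u = exponent-u k ℓ
    in
    (𝔽q² : Field c e) (𝔽q : Subfield 𝔽q² p) →
    HasOrder (Field.setoid 𝔽q²) (q ℕ.^ 2) →
    HasOrder (Subfield.elements 𝔽q) q →
    let open Field 𝔽q²
        open FieldNotions 𝔽q²
        open Subfield 𝔽q using () renaming (_∈ to _∈𝔽q)
    in
    (a b : Carrier) → ¬ a ≈ 0# → b ∈𝔽q → ¬ b ≈ 0# → ¬ a + b ≈ 1# →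
    Permutes (λ X → X + b * X ^ q + a * X ^ u)
    ⇔
    (∃[ lam ] ∃[ ε ] lam ∈𝔽q × ε ∈𝔽₂ ×
      lam ^ (Q ℕ.∸ 1) ≈ b ×
      a ≈ ε * lam ^ Q + ∑[ i < ℓ ] (lam ^ (Q ℕ.∸ 2 ℕ.^ (toℕ i ℕ.+ 1))) ×
      Tr k (a / (a + b + 1#)) ≈ 0#)
corollary9p12 k ℓ coprime 𝔽q² 𝔽q order-𝔽q² order-𝔽q a b a≉0 b∈ b≉0 a+b≉1 =
  mk⇔ (permutes⇒conditions a b a≉0 b∈ b≉0 a+b≉1) (conditions⇒permutes a b a≉0 b∈ b≉0 a+b≉1)
  where
  instance
    2k≢0 : NonZero (2 ℕ.* k)
    2k≢0 = ℕ.m*n≢0 2 k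
  order : HasOrder (Field.setoid 𝔽q²) (2 ℕ.^ (2 ℕ.* k))
  order = ≡.subst (HasOrder (Field.setoid 𝔽q²)) (≡.trans (ℕ.^-*-assoc 2 k 2) (≡.cong (2 ℕ.^_) (ℕ.*-comm k 2))) order-𝔽q²
  open Equivalence 𝔽q² k ℓ order coprime 𝔽q order-𝔽q
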